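{- Let $n\ge 1$, let $w$ be a biword in lexicographic order on $[n]$ with key-pair $(\nu,\beta)$. Let $0\le k<n$ and $1\le r_1<\cdots<r_k<n$. The following are equivalent: (a) $w$ consists of a multiset of cells of the staircase $\rho=\{(i,j): i+j\le n+1\}$ together with the $k$ cells $(r_1+1,n-r_1+1),\dots,(r_k+1,n-r_k+1)$, each of these $k$ cells (i.e. biletters $\binom{n-r_i+1}{r_i+1}$) occurring in $w$ with multiplicity at least one. (b) $\beta\le\omega s_{r_k}\cdots s_{r_2}s_{r_1}\nu$, and $\beta\not\le\omega s_{r_k}\cdots\widehat{s_{r_i}}\cdots s_{r_1}\nu$ for every $1\le i\le k$, where $\widehat{\ }$ denotes omission. (c) $s_{n-r_1}\cdots s_{n-r_k}\beta\le\omega\nu$, and $s_{n-r_1}\cdots\widehat{s_{n-r_i}}\cdots s_{n-r_k}\beta\not\le\omega\nu$ for every $1\le i\le k$.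
   Context: Cells $(i,j)$ are in French convention (row $i$ from the bottom, column $j$ from the left). A biword on $[n]$ is a two-row array $\binom{j_1\cdots j_l}{i_1\cdots i_l}$ with entries in $[n]$, lexicographically ordered with respect to the first row; the biletter $\binom{j}{i}$ is identified with the cell $(i,j)$, and "$w$ consists of a multiset of cells of $D$" means every biletter's cell lies in $D$. SSAFs: for a reverse SSYT $\widetilde P$ (French; rows weakly decreasing left to right, columns strictly decreasing upward) with entries in $[n]$, $\varrho(\widetilde P)$ is obtained by starting from a basement row $0$ containing $1,\dots,n$ in columns $1,\dots,n$, placing each entry of the first column of $\widetilde P$ above the equal basement entry, and then, for $i\ge1$, inserting the entries of column $i+1$ of $\widetilde P$ in decreasing order, each entry $a$ placed in row $i+1$ on top of the leftmost entry $b$ of row $i$ with $b\ge a$ and empty cell above $b$. Its shape $sh\in\mathbb N^n$ is the vector of column heights (basement excluded). $\Phi(w)=(\varrho(\widetilde P),\varrho(\widetilde Q))$, where $(\widetilde P,\widetilde Q)$ is obtained by applying RSK to $\binom{n-j_l+1\cdots n-j_1+1}{n-i_l+1\cdots n-i_1+1}$ and replacing each entry $a$ by $n-a+1$. The key-pair of $w$ is $(sh(F),sh(G))$ where $(F,G)=\Phi(w)$. $\mathfrak S_n$ acts on $\mathbb N^n$ by permuting positions; $s_i$ swaps entries $i,i+1$; a product $s_as_b\alpha$ means $s_a(s_b\alpha)$; $\omega$ is the longest permutation, $\omega(\alpha_1,\dots,\alpha_n)=(\alpha_n,\dots,\alpha_1)$. Bruhat order on $\mathbb N^n$: $\alpha\le\gamma$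 iff $\gamma$ is obtained from $\alpha$ by a finite (possibly empty) sequence of steps, each replacing the current vector $\delta$ by $t\delta$ where $t=(i\,j)$, $i<j$, $\delta_i>\delta_j$; in particular $\alpha\le\gamma$ forces $\alpha,\gamma$ to be rearrangements of each other. $\not\le$ means the relation fails. -}

module Defs where

open import Data.Nat using (ℕ; zero; suc; _+_; _∸_; _≤_; _<_; _>_; _≤?_; _<?_; _≟_)
open import Data.Nat.Properties using ()
open import Data.Fin using (Fin; toℕ)
open import Data.List as L using (List; []; _∷_; [_]; _++_; length; reverse)
open import Data.Vec as V using (Vec; lookup; tabulate; _[_]≔_)
open import Data.Maybe using (Maybe; just; nothing; _>>=_)
open import Data.Product using (_×_; _,_)
open import Data.Sum using (_⊎_)
open import Relation.Binary.PropositionalEquality using (_≡_)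
open import Relation.Nullary using (yes; no)
open import Data.List.Relation.Unary.Linked using (Linked)

-- Biwords.  A biword is a list of biletters; the biletter (j , i)
-- stands for the column  j over i  (top entry j, bottom entry i),
-- i.e. the cell (i , j) (row i, column j, French convention).

Biletter : Set
Biletter = ℕ × ℕ

Biword : Set
Biword = List Biletter

LexLeq : Biletter → Biletter → Set
LexLeq (j , i) (j' , i') = (j < j') ⊎ ((j ≡ j') × (i ≤ i'))

data AllIn (n : ℕ) : Biword → Set where
  []  : AllIn n []
  _∷_ : ∀ {j i w} → (1 ≤ j × j ≤ n) × (1 ≤ i × i ≤ n) → AllIn n w → AllIn n ((j , i) ∷ w)

IsBiword : ℕ → Biword → Set
IsBiword n w = AllIn n w × Linked LexLeq w

-- Tableaux as lists of rows, bottom row first (French convention).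

Tableau : Set
Tableau = List (List ℕ)

insertRow : ℕ → List ℕ → List ℕ × Maybe ℕ
insertRow x [] = [ x ] , nothing
insertRow x (y ∷ ys) with x <? y
... | yes _ = x ∷ ys , just y
... | no _ with insertRow x ys
...   | ys' , b = y ∷ ys' , b

-- insertion into a tableau; also returns the (0-based) row index of
-- the newly created cell
insertTab : ℕ → Tableau → Tableau × ℕ
insertTab x [] = [ [ x ] ] , 0
insertTab x (row ∷ rows) with insertRow x row
... | row' , nothing = row' ∷ rows , 0
... | row' , just y with insertTab y rows
...   | rows' , k = row' ∷ rows' , suc k

addAt : ℕ → ℕ → Tableau → Tableau
addAt k v [] = [ [ v ] ]
addAt zero v (r ∷ rs) = (r ++ [ v ]) ∷ rs
addAt (suc k) v (r ∷ rs) = r ∷ addAt k v rs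

rskAux : Tableau → Tableau → Biword → Tableau × Tableau
rskAux P Q [] = P , Q
rskAux P Q ((j , i) ∷ w) with insertTab i P
... | P' , k = rskAux P' (addAt k j Q) w

RSK : Biword → Tableau × Tableau
RSK = rskAux [] []

compl : ℕ → ℕ → ℕ
compl n a = suc n ∸ a

complTab : ℕ → Tableau → Tableau
complTab n = L.map (L.map (compl n))

revCompl : ℕ → Biword → Biword
revCompl n w = reverse (L.map (λ { (j , i) → (compl n j , compl n i) }) w)

reverseRSK : ℕ → Biword → Tableau × Tableau
reverseRSK n w with RSK (revCompl n w)
... | P , Q = complTab n P , complTab n Q

nth : ℕ → List ℕ → Maybe ℕ
nth _ [] = nothing
nth zero (x ∷ xs) = just x
nth (suc k) (x ∷ xs) = nth k xs

colOf : ℕ → Tableau → List ℕ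
colOf c [] = []
colOf c (r ∷ rs) with nth c r
... | nothing = colOf c rs
... | just a = a ∷ colOf c rs

numCols : Tableau → ℕ
numCols [] = 0
numCols (r ∷ _) = length r

-- An SSAF filling with n columns.  Each column is stored as a list read
-- from top to bottom, ending with its basement entry; so a column of
-- height h is a list of length h + 1.
Filling : ℕ → Set
Filling n = Vec (List ℕ) n

basement : (n : ℕ) → Filling n
basement n = tabulate (λ c → [ suc (toℕ c) ])

-- place entry a in row i+1 on top of the leftmost entry b of row i with
-- b ≥ a and empty cell above b (i.e. the column has height exactly i)
place : ∀ {m} → ℕ → ℕ → Vec (List ℕ) m → Maybe (Vec (List ℕ) m)
place i a V.[] = nothing
place i a ([] V.∷ cols) with place i a cols
... | nothing = nothing
... | just cols' = just ([] V.∷ cols')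
place i a ((b ∷ rest) V.∷ cols) with length (b ∷ rest) ≟ suc i | a ≤? b
... | yes _ | yes _ = just ((a ∷ b ∷ rest) V.∷ cols)
... | _ | _ with place i a cols
...   | nothing = nothing
...   | just cols' = just ((b ∷ rest) V.∷ cols')

placeAll : ∀ {m} → ℕ → List ℕ → Vec (List ℕ) m → Maybe (Vec (List ℕ) m)
placeAll i [] F = just F
placeAll i (a ∷ as) F = place i a F >>= placeAll i as

-- insert columns i, i+1, ..., i+c-1 (0-based) of T into rows
-- i+1, ..., i+c; the entries of a column of a reverse SSYT read bottom
-- to top are in decreasing order
rhoAux : ∀ {m} → Tableau → ℕ → ℕ → Vec (List ℕ) m → Maybe (Vec (List ℕ) m)
rhoAux T i zero F = just F
rhoAux T i (suc c) F = placeAll i (colOf i T) F >>= rhoAux T (suc i) c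

-- ϱ (nothing only if the construction gets stuck, which does not
-- happen for reverse SSYT; kept total for Agda)
rho : (n : ℕ) → Tableau → Maybe (Filling n)
rho n T = rhoAux T 0 (numCols T) (basement n)

-- shape: column heights, basement excluded
sh : ∀ {n} → Filling n → Vec ℕ n
sh = V.map (λ col → length col ∸ 1)

keyPair : (n : ℕ) → Biword → Maybe (Vec ℕ n × Vec ℕ n)
keyPair n w with reverseRSK n w
... | P , Q with rho n P | rho n Q
...   | just F | just G = just (sh F , sh G)
...   | _ | _ = nothing

-- s r swaps positions r and r+1 (1-based); identity when out of range
s : ∀ {m} → ℕ → Vec ℕ m → Vec ℕ m
s (suc zero) (x V.∷ y V.∷ xs) = y V.∷ x V.∷ xs
s (suc (suc r)) (x V.∷ xs) = x V.∷ s (suc r) xs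
s _ xs = xs

-- applyS [r₁ , … , r_k] α = s_{r_k} ⋯ s_{r₁} α  (s_{r₁} applied first)
applyS : ∀ {m} → List ℕ → Vec ℕ m → Vec ℕ m
applyS [] α = α
applyS (r ∷ rs) α = applyS rs (s r α)

ω : ∀ {m} → Vec ℕ m → Vec ℕ m
ω = V.reverse

swap : ∀ {m} → Fin m → Fin m → Vec ℕ m → Vec ℕ m
swap i j δ = (δ [ i ]≔ lookup δ j) [ j ]≔ lookup δ i

data _≤B_ {m : ℕ} (α : Vec ℕ m) : Vec ℕ m → Set where
  brefl : α ≤B α
  bstep : ∀ {δ} (i j : Fin m) → α ≤B δ → toℕ i < toℕ j →
          lookup δ i > lookup δ j → α ≤B swap i j δ

InStaircase : ℕ → Biletter → Set
InStaircase n (j , i) = i + j ≤ suc n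

extraCell : ℕ → ℕ → Biletter
extraCell n r = (suc n ∸ r , suc r)

{-# OPTIONS --safe #-}
module Submission where

-- Read both tableaux as chains of boxes, in the order of their entries. Along a chain an SSAF grows by one box at a
-- time, on the leftmost column of the required height. When a biletter is inserted and the common shape gets a box in
-- column t, the SSAF G of the recording tableau grows in this way, whereas in F a column of height t - 1 grows which is
-- then the rightmost one of height t. Consequently, for fixed p and q, the inequalities
--   #{c > p : ν_c > t} ≤ #{c ≤ q : β_c > t}   for all t
-- are preserved and reflected by the insertion of biletters with j ≤ q; before these they say that no i exceeds p.
-- Hence they hold iff w has no cell with i > p and j > q. By the tableau criterion for the Bruhat order, (b) is a system
-- of such inequalities, describing the region of (a). They are symmetric in (p, ν) and (q, β) because ν and β are
-- rearrangements of each other, so (c) is (b) for the transposed biword.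

open import Defs
open import Data.Nat
open import Data.Nat.Properties
open import Data.Fin as Fin using (Fin; toℕ)
open import Data.Bool using (Bool; true; false; T)
open import Data.List as List using (List; []; _∷_; _++_; [_]; map; length; reverse; removeAt)
open import Data.List.Properties using (++-assoc; ++-identityʳ; ++-conicalˡ; ++-conicalʳ; length-++; length-map; map-++; map-∘;
  map-id-local; reverse-++; reverse-map; reverse-involutive; unfold-reverse)
open import Data.List.Relation.Unary.All as All using (All; []; _∷_)
open import Data.List.Relation.Unary.All.Properties as AllP using (++⁺)
open import Data.List.Relation.Unary.AllPairs using (AllPairs; []; _∷_)
open import Data.List.Relation.Unary.Any using (here; there)
open import Data.List.Relation.Unary.Any.Properties using (reverse⁺)
open import Data.List.Relation.Unary.Linked using (Linked; []; [-]; _∷_)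
open import Data.List.Relation.Unary.Linked.Properties as LinkedP using (Linked⇒AllPairs; AllPairs⇒Linked)
open import Data.List.Membership.Propositional using (_∈_; _∉_)
open import Data.List.Membership.Propositional.Properties using (∈-map⁺; ∈-map⁻; ∈-++⁻; ∈-++⁺ʳ; ∈-insert)
import Data.List.Membership.DecPropositional as DecMembership
open import Data.Vec as Vec using (Vec; []; _∷_; lookup; _[_]≔_; _∷ʳ_)
open import Data.Vec.Properties using ([]≔-idempotent; []≔-lookup; lookup∘updateAt; reverse-∷)
open import Data.Maybe using (Maybe; just; nothing; _>>=_)
open import Data.Product using (∃; ∃₂; _×_; _,_; proj₁; proj₂; map₂) renaming (swap to transpose)
open import Data.Product.Properties using (≡-dec)
open import Data.Sum using (_⊎_; inj₁; inj₂)
open import Data.Empty using (⊥; ⊥-elim)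
open import Data.Unit using (⊤; tt)
open import Function using (_∘_; flip; _on_)
open import Function.Bundles using (_⇔_; mk⇔; Equivalence)
open import Relation.Nullary using (¬_; Dec; yes; no; contradiction; _×-dec_)
open import Relation.Nullary.Decidable using (decidable-stable)
open import Relation.Binary.PropositionalEquality hiding ([_])

open DecMembership _≟_ using (_∈?_)
open DecMembership (≡-dec _≟_ _≟_) using () renaming (_∈?_ to _∈ᶜ?_)

-- An insertion moves entries all over the tableau, so the SSAFs before and after it are never
-- compared as fillings. For a fixed threshold m only the numbers of columns of height above t, up
-- to m and beyond m, are kept. Their growth depends on an entry only through its tableau column and
-- through whether it is at most m, so the chains before and after an insertion can be run in
-- lockstep, one box apart from the inserted letter on. The leftmost-column rule comes from
-- complementation: along a chain the SSAF entries weakly decrease, so each new one fits on every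
-- nonempty column of the right height. The first row above the basement is the exception, since
-- entry b goes to column b; hence the special role of height 0. In the region of (a), the extra
-- cell of r occurs exactly when the inequality with p = r and q = n - r fails. `s r` changes only
-- the count at p = r, so it is the one exchange that can repair this inequality; that it does
-- repair it is forced by the two neighbouring inequalities.

private variable
  X Y Z : Set

-- Column counts along a chain

inc : (ℕ → ℕ) → ℕ → ℕ → ℕ
inc f k i with i ≟ k
... | yes _ = suc (f i)
... | no _ = f i

inc-≡ : ∀ f k → inc f k k ≡ suc (f k)
inc-≡ f k with k ≟ k
... | yes _ = refl
... | no k≢k = contradiction refl k≢k

inc-≢ : ∀ f {k i} → i ≢ k → inc f k i ≡ f i
inc-≢ f {k} {i} i≢k with i ≟ k
... | yes i≡k = contradiction i≡k i≢k
... | no _ = refl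

inc-≥ : ∀ f k i → f i ≤ inc f k i
inc-≥ f k i with i ≟ k
... | yes _ = n≤1+n _
... | no _ = ≤-refl

inc-comm : ∀ f j k i → inc (inc f j) k i ≡ inc (inc f k) j i
inc-comm f j k i with i ≟ k | i ≟ j
... | yes p | yes q with i ≟ k | i ≟ j
...   | yes _ | yes _ = refl
...   | no p' | _ = contradiction p p'
...   | _ | no q' = contradiction q q'
inc-comm f j k i | yes p | no q with i ≟ k | i ≟ j
...   | yes _ | no _ = refl
...   | no p' | _ = contradiction p p'
...   | _ | yes q' = contradiction q' q
inc-comm f j k i | no p | yes q with i ≟ k | i ≟ j
...   | no _ | yes _ = refl
...   | yes p' | _ = contradiction p' p
...   | _ | no q' = contradiction q q'
inc-comm f j k i | no p | no q with i ≟ k | i ≟ j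
...   | no _ | no _ = refl
...   | yes p' | _ = contradiction p' p
...   | _ | yes q' = contradiction q' q

inc-cong : ∀ {f g} k → f ≗ g → inc f k ≗ inc g k
inc-cong k f≗g i with i ≟ k
... | yes _ = cong suc (f≗g i)
... | no _ = f≗g i

inc-+ˡ : ∀ (f g : ℕ → ℕ) k i → inc f k i + g i ≡ inc (λ j → f j + g j) k i
inc-+ˡ f g k i with i ≟ k
... | yes _ = refl
... | no _ = refl

inc-+ʳ : ∀ (f g : ℕ → ℕ) k i → f i + inc g k i ≡ inc (λ j → f j + g j) k i
inc-+ʳ f g k i with i ≟ k
... | yes _ = +-suc (f i) (g i)
... | no _ = refl

Antitone : (ℕ → ℕ) → Set
Antitone f = ∀ s → f (suc s) ≤ f s

antitone : ∀ {f} → Antitone f → ∀ {s t} → s ≤ t → f t ≤ f s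
antitone {f} anti {s} {zero} z≤n = ≤-refl
antitone {f} anti {s} {suc t} s≤t with m≤n⇒m<n∨m≡n s≤t
... | inj₁ (s≤s s≤t′) = ≤-trans (anti t) (antitone anti s≤t′)
... | inj₂ refl = ≤-refl

-- Serves two purposes: for row lengths it says that row `t` can receive a box, for column counts
-- that some column of height exactly `t` can grow. Height 0 is exempt because the basement supplies
-- the column.
Addable : (ℕ → ℕ) → ℕ → Set
Addable f zero = ⊤
Addable f (suc t) = f (suc t) < f t

addable? : ∀ f t → Dec (Addable f t)
addable? f zero = yes tt
addable? f (suc t) = f (suc t) <? f t

addable-cong : ∀ {f g} → f ≗ g → ∀ t → Addable f t → Addable g t
addable-cong f≗g zero _ = tt
addable-cong f≗g (suc t) p = subst₂ _<_ (f≗g (suc t)) (f≗g t) p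

addable-inc : ∀ (f : ℕ → ℕ) k t → t ≢ k → Addable f t → Addable (inc f k) t
addable-inc f k zero _ _ = tt
addable-inc f k (suc t) t≢k p = subst (_< inc f k t) (sym (inc-≢ f t≢k)) (<-≤-trans p (inc-≥ f k t))

inc-antitone : ∀ {f} k → Antitone f → Addable f k → Antitone (inc f k)
inc-antitone {f} k anti add s with suc s ≟ k
... | yes refl = ≤-trans add (inc-≥ f (suc s) s)
... | no _ = ≤-trans (anti s) (inc-≥ f k s)

antitone-cong : ∀ {f g} → f ≗ g → Antitone f → Antitone g
antitone-cong f≗g anti s = subst₂ _≤_ (f≗g (suc s)) (f≗g s) (anti s)

record State : Set where
  constructor state
  field
    η μ : ℕ → ℕ
open State public

height : State → ℕ → ℕ
height S t = η S t + μ S t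

empty : State
empty = state (λ _ → 0) (λ _ → 0)

-- The flag says whether the SSAF entry is at most the threshold. A larger entry can only stand in a
-- column beyond the threshold; otherwise the leftmost column of height `t` grows, which lies up to
-- the threshold as soon as one of that height does.
step : Bool → ℕ → State → State
step false t (state e m) = state e (inc m t)
step true t (state e m) with addable? e t
... | yes _ = state (inc e t) m
... | no _ = state e (inc m t)

-- States consist of functions compared pointwise, so the outcome of `step` is restated as a
-- relation. The counts of actual fillings satisfy it as well.
data Moved (b : Bool) (t : ℕ) (S S′ : State) : Set where
  left : b ≡ true → Addable (η S) t → η S′ ≗ inc (η S) t → μ S′ ≗ μ S → Moved b t S S′
  right : (b ≡ true → ¬ Addable (η S) t) → η S′ ≗ η S → μ S′ ≗ inc (μ S) t → Moved b t S S′

step-moved : ∀ b t S → Moved b t S (step b t S)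
step-moved false t S = right (λ ()) (λ _ → refl) (λ _ → refl)
step-moved true t (state e m) with addable? e t
... | yes p = left refl p (λ _ → refl) (λ _ → refl)
... | no ¬p = right (λ _ → ¬p) (λ _ → refl) (λ _ → refl)

-- The pair (a , ρ) puts a at the end of row ρ; pairs are listed by increasing a and, for equal a, from left to right.
Chain : Set
Chain = List (ℕ × ℕ)

rows : (ℕ → ℕ) → Chain → (ℕ → ℕ)
rows z [] = z
rows z ((a , ρ) ∷ ch) = rows (inc z ρ) ch

run : (ℕ → Bool) → (ℕ → ℕ) → State → Chain → State
run act z S [] = S
run act z S ((a , ρ) ∷ ch) = run act (inc z ρ) (step (act a) (z ρ) S) ch

-- The Yamanouchi condition: every initial segment of the chain fills a partition shape.
Lattice : (ℕ → ℕ) → Chain → Set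
Lattice z [] = ⊤
Lattice z ((a , ρ) ∷ ch) = Addable z ρ × Lattice (inc z ρ) ch

-- On a chain the bumping route is followed in the order of the entries: r is the row of the additional box, and the
-- next entry of row r is the one that is bumped to row r + 1.
bump : ℕ → Chain → Chain
bump r [] = []
bump r ((a , ρ) ∷ ch) with ρ ≟ r
... | yes _ = (a , suc r) ∷ bump (suc r) ch
... | no _ = (a , ρ) ∷ bump r ch

bumpRow : ℕ → Chain → ℕ
bumpRow r [] = r
bumpRow r ((a , ρ) ∷ ch) with ρ ≟ r
... | yes _ = bumpRow (suc r) ch
... | no _ = bumpRow r ch

insert : ℕ → Chain → Chain
insert x [] = [ x , 0 ]
insert x ((a , ρ) ∷ ch) with a ≤? x
... | yes _ = (a , ρ) ∷ insert x ch
... | no _ = (x , 0) ∷ bump 0 ((a , ρ) ∷ ch)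

insertedRow : ℕ → Chain → ℕ
insertedRow x [] = 0
insertedRow x ((a , ρ) ∷ ch) with a ≤? x
... | yes _ = insertedRow x ch
... | no _ = bumpRow 0 ((a , ρ) ∷ ch)

-- η t and μ t count the SSAF columns of height > t up to a threshold and beyond it; z lists the row lengths.
record Valid (z : ℕ → ℕ) (S : State) : Set where
  field
    η-anti : Antitone (η S)
    μ-anti : Antitone (μ S)
    conj→ : ∀ ρ t → t < z ρ → ρ < height S t
    conj← : ∀ ρ t → ρ < height S t → t < z ρ

module _ {z S} (V : Valid z S) where
  open Valid V

  height-anti : Antitone (height S)
  height-anti s = +-mono-≤ (η-anti s) (μ-anti s)

  z-anti : Antitone z
  z-anti ρ = ≮⇒≥ λ lt → <-irrefl refl (conj← ρ (z ρ) (<-trans (n<1+n ρ) (conj→ (suc ρ) (z ρ) lt)))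

  height-box : ∀ ρ → Addable z ρ → height S (z ρ) ≡ ρ
  height-box zero _ = n≤0⇒n≡0 (≮⇒≥ λ lt → <-irrefl refl (conj← 0 (z 0) lt))
  height-box (suc ρ) add = ≤-antisym (≮⇒≥ λ lt → <-irrefl refl (conj← (suc ρ) _ lt)) (conj→ ρ _ add)

  height-before : ∀ ρ {s} → Addable z ρ → z ρ ≡ suc s → height S (suc s) < height S s
  height-before ρ {s} add eq = subst (_< height S s) (trans (sym (height-box ρ add)) (cong (height S) eq))
    (conj→ ρ s (subst (s <_) (sym eq) (n<1+n s)))

-- When the box is not taken up to the threshold, no column there has height exactly `t`. For an
-- inactive letter this is because all those columns are still empty: active letters come last in a
-- chain.
flat : ∀ {b t S} → Antitone (η S) → (b ≡ false → ∀ s → η S s ≡ 0) → (b ≡ true → ¬ Addable (η S) t) →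
       ∀ {s} → t ≡ suc s → η S (suc s) ≡ η S s
flat {false} anti zer _ {s} refl = trans (zer refl (suc s)) (sym (zer refl s))
flat {true} anti _ ¬add {s} refl = ≤-antisym (anti s) (≮⇒≥ (¬add refl))

≡+-cancel-< : ∀ {a b c d} → a ≡ c → a + b < c + d → b < d
≡+-cancel-< {a} refl = +-cancelˡ-< a _ _

≗-valid : ∀ {z S S′} → η S′ ≗ η S → μ S′ ≗ μ S → Valid z S → Valid z S′
≗-valid e m V = record
  { η-anti = antitone-cong (λ i → sym (e i)) η-anti
  ; μ-anti = antitone-cong (λ i → sym (m i)) μ-anti
  ; conj→ = λ ρ t p → subst (ρ <_) (sym (cong₂ _+_ (e t) (m t))) (conj→ ρ t p)
  ; conj← = λ ρ t p → conj← ρ t (subst (ρ <_) (cong₂ _+_ (e t) (m t)) p) }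
  where open Valid V

moved-height : ∀ {b t S S′} → Moved b t S S′ → height S′ ≗ inc (height S) t
moved-height {t = t} {S} (left _ _ e m) i = trans (cong₂ _+_ (e i) (m i)) (inc-+ˡ (η S) (μ S) t i)
moved-height {t = t} {S} (right _ e m) i = trans (cong₂ _+_ (e i) (m i)) (inc-+ʳ (η S) (μ S) t i)

-- An addable row makes the total count drop strictly at `z ρ`; if `η` is flat there, the drop is in
-- `μ`.
right-addable : ∀ {b z S ρ} → Valid z S → Addable z ρ → (b ≡ false → ∀ s → η S s ≡ 0) →
                (b ≡ true → ¬ Addable (η S) (z ρ)) → Addable (μ S) (z ρ)
right-addable {b} {z} {S} {ρ} V add zer ¬a = at (z ρ) refl
  where
  at : ∀ t → z ρ ≡ t → Addable (μ S) t
  at zero _ = tt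
  at (suc s) eq = ≡+-cancel-< (flat {b} {z ρ} {S} (Valid.η-anti V) zer ¬a eq) (height-before V ρ add eq)

valid-moved : ∀ {b z S S′ ρ} → Valid z S → Addable z ρ → (b ≡ false → ∀ s → η S s ≡ 0) →
              Moved b (z ρ) S S′ → Valid (inc z ρ) S′
valid-moved {b} {z} {S} {S′} {ρ} V add zer mv = record { η-anti = ea mv ; μ-anti = ma mv ; conj→ = c→ ; conj← = c← }
  where
  open Valid V
  t = z ρ
  ea : Moved b t S S′ → Antitone (η S′)
  ea (left _ a e _) = antitone-cong (λ i → sym (e i)) (inc-antitone t η-anti a)
  ea (right _ e _) = antitone-cong (λ i → sym (e i)) η-anti
  ma : Moved b t S S′ → Antitone (μ S′)
  ma (left _ _ _ m) = antitone-cong (λ i → sym (m i)) μ-anti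
  ma (right ¬a _ m) = antitone-cong (λ i → sym (m i)) (inc-antitone t μ-anti (right-addable V add zer ¬a))
  c→ : ∀ ρ′ t′ → t′ < inc z ρ ρ′ → ρ′ < height S′ t′
  c→ ρ′ t′ p rewrite moved-height mv t′ with ρ′ ≟ ρ | t′ ≟ t
  ... | yes refl | yes refl = s≤s (≤-reflexive (sym (height-box V ρ add)))
  ... | yes refl | no t′≢t = conj→ ρ t′ (≤∧≢⇒< (s≤s⁻¹ p) t′≢t)
  ... | no _ | yes refl = m<n⇒m<1+n (conj→ ρ′ t p)
  ... | no _ | no _ = conj→ ρ′ t′ p
  c← : ∀ ρ′ t′ → ρ′ < height S′ t′ → t′ < inc z ρ ρ′
  c← ρ′ t′ p rewrite moved-height mv t′ with ρ′ ≟ ρ | t′ ≟ t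
  ... | yes refl | yes refl = n<1+n t
  ... | yes refl | no t′≢t = m<n⇒m<1+n (conj← ρ t′ p)
  ... | no ρ′≢ρ | yes refl = conj← ρ′ t (≤∧≢⇒< (s≤s⁻¹ p) (λ eq → ρ′≢ρ (trans eq (height-box V ρ add))))
  ... | no _ | no _ = conj← ρ′ t′ p

-- Column counts after an insertion

-- The last condition of left says that no column beyond the threshold has height exactly τ + 1: the SSAF column
-- that grows under an insertion is, after growing, the rightmost one of its height.
data Extra (τ : ℕ) (S S⁺ : State) : Set where
  right : η S⁺ ≗ η S → μ S⁺ ≗ inc (μ S) τ → Addable (μ S) τ → Extra τ S S⁺
  left : η S⁺ ≗ inc (η S) τ → μ S⁺ ≗ μ S → Addable (η S) τ → μ S τ ≡ μ S (suc τ) → Extra τ S S⁺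

_⨾_ : ∀ {f g h : ℕ → ℕ} → f ≗ g → g ≗ h → f ≗ h
(p ⨾ q) i = trans (p i) (q i)

flip≗ : ∀ {f g : ℕ → ℕ} → f ≗ g → g ≗ f
flip≗ p i = sym (p i)

moved-zero : ∀ {b t S S′} → (b ≡ false → ∀ s → η S s ≡ 0) → Moved b t S S′ → b ≡ false → ∀ s → η S′ s ≡ 0
moved-zero zer (left bt _ _ _) bf = contradiction (trans (sym bt) bf) (λ ())
moved-zero zer (right _ e _) bf s = trans (e s) (zer bf s)

-- Here the additional box itself obeys the growth rule; only the flatness of `μ` demanded by `left`
-- is left to the caller, as `key`.
extra-step : ∀ {b z S S₀ S⁺ ρ} → Valid z S → Addable z ρ → (b ≡ false → ∀ s → η S s ≡ 0) →
             η S₀ ≗ η S → μ S₀ ≗ μ S →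
             (b ≡ true → Addable (η S) (z ρ) → μ S (z ρ) ≡ μ S (suc (z ρ))) →
             Moved b (z ρ) S₀ S⁺ → Extra (z ρ) S S⁺
extra-step {ρ = ρ} V add zer e m key (left b a e⁺ m⁺) =
  left (e⁺ ⨾ inc-cong _ e) (m⁺ ⨾ m) (addable-cong e _ a) (key b (addable-cong e _ a))
extra-step {ρ = ρ} V add zer e m key (right ¬a e⁺ m⁺) =
  right (e⁺ ⨾ e) (m⁺ ⨾ inc-cong _ m)
        (right-addable {ρ = ρ} V add zer λ b a → ¬a b (addable-cong (flip≗ e) _ a))

module _ {b : Bool} {z : ℕ → ℕ} {S S₁ S⁺ S⁺₁ : State} (V : Valid z S) where
  open Valid V

  -- Distinct addable rows have their boxes in distinct columns, so the two growths commute as long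
  -- as the additional box does not change which side `step` chooses. It could do so only from the
  -- left and for the column just after `z r`; there both counts would be flat, against the strict
  -- drop of the height.
  extra-keep : ∀ {r ρ} → Addable z r → Addable z ρ → ρ ≢ r →
               (b ≡ false → ∀ s → η S s ≡ 0) →
               Moved b (z ρ) S S₁ → Moved b (z ρ) S⁺ S⁺₁ → Extra (z r) S S⁺ → Extra (z r) S₁ S⁺₁
  extra-keep {r} {ρ} addr addρ ρ≢r zer = go
    where
    t≢τ : z ρ ≢ z r
    t≢τ eq = ρ≢r (trans (sym (height-box V ρ addρ)) (trans (cong (height S) eq) (height-box V r addr)))
    τ≢t : z r ≢ z ρ
    τ≢t eq = t≢τ (sym eq)
    no-next : (b ≡ true → ¬ Addable (η S) (z ρ)) → μ S (z r) ≡ μ S (suc (z r)) → z ρ ≢ suc (z r)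
    no-next ¬a eq t≡ = <-irrefl (cong₂ _+_ (flat {b} {z ρ} {S} η-anti zer ¬a t≡) (sym eq)) (height-before V ρ addρ t≡)
    -- Raising `η` at `z r` creates addability only at `suc (z r)`, the value that `no-next`
    -- excludes.
    up-addable : b ≡ true → ∀ t → t ≢ z r → μ S (z r) ≡ μ S (suc (z r)) → t ≡ z ρ →
                 Addable (inc (η S) (z r)) t → Addable (η S) t
    up-addable _ zero _ _ _ _ = tt
    up-addable bt (suc s) t≢ eq t≡ p with addable? (η S) (suc s)
    ... | yes a = a
    ... | no ¬a with s ≟ z r
    ...   | yes refl = contradiction (sym t≡) (no-next (λ _ a → ¬a (subst (Addable (η S)) (sym t≡) a)) eq)
    ...   | no s≢ = contradiction (subst (_< η S s) (inc-≢ (η S) t≢) p) ¬a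
    go : Moved b (z ρ) S S₁ → Moved b (z ρ) S⁺ S⁺₁ → Extra (z r) S S⁺ → Extra (z r) S₁ S⁺₁
    go (left _ a e m) (left _ a⁺ e⁺ m⁺) (right e′ m′ c) =
      right (e⁺ ⨾ (inc-cong _ e′ ⨾ flip≗ e)) (m⁺ ⨾ (m′ ⨾ inc-cong _ (flip≗ m))) (addable-cong (flip≗ m) _ c)
    go (left bt a e m) (right ¬a⁺ e⁺ m⁺) (right e′ m′ c) =
      contradiction (addable-cong (flip≗ e′) _ a) (¬a⁺ bt)
    go (right ¬a e m) (left bt a⁺ e⁺ m⁺) (right e′ m′ c) =
      contradiction (addable-cong e′ _ a⁺) (¬a bt)
    go (right ¬a e m) (right ¬a⁺ e⁺ m⁺) (right e′ m′ c) =
      right (e⁺ ⨾ (e′ ⨾ flip≗ e))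
            (m⁺ ⨾ (inc-cong _ m′ ⨾ (inc-comm (μ S) (z r) (z ρ) ⨾ inc-cong _ (flip≗ m))))
            (addable-cong (flip≗ m) _ (addable-inc (μ S) (z ρ) (z r) τ≢t c))
    go (left bt a e m) (left _ a⁺ e⁺ m⁺) (left e′ m′ c q) =
      left (e⁺ ⨾ (inc-cong _ e′ ⨾ (inc-comm (η S) (z r) (z ρ) ⨾ inc-cong _ (flip≗ e)))) (m⁺ ⨾ (m′ ⨾ flip≗ m))
           (addable-cong (flip≗ e) _ (addable-inc (η S) (z ρ) (z r) τ≢t c))
           (trans (m _) (trans q (sym (m _))))
    go (left bt a e m) (right ¬a⁺ e⁺ m⁺) (left e′ m′ c q) =
      contradiction (addable-cong (flip≗ e′) _ (addable-inc (η S) (z r) (z ρ) t≢τ a)) (¬a⁺ bt)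
    go (right ¬a e m) (left bt a⁺ e⁺ m⁺) (left e′ m′ c q) =
      contradiction (up-addable bt (z ρ) t≢τ q refl (addable-cong e′ _ a⁺)) (¬a bt)
    go (right ¬a e m) (right ¬a⁺ e⁺ m⁺) (left e′ m′ c q) =
      left (e⁺ ⨾ (e′ ⨾ inc-cong _ (flip≗ e))) (m⁺ ⨾ (inc-cong _ m′ ⨾ flip≗ m)) (addable-cong (flip≗ e) _ c)
           (trans (m _) (trans (inc-≢ (μ S) τ≢t)
             (trans q (trans (sym (inc-≢ (μ S) λ eq → no-next ¬a q (sym eq))) (sym (m _))))))

not-false : ∀ b → ¬ b ≡ false → b ≡ true
not-false true _ = refl
not-false false p = contradiction refl p

flat-between : ∀ {f g} → Antitone f → Antitone g → ∀ {s t} → s < t → f s + g s ≡ f t + g t → g s ≡ g (suc s)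
flat-between {f} {g} fa ga {s} {t} s<t eq = ≤-antisym (≤-trans gs≤gt (antitone ga s<t)) (ga s)
  where
  gs≤gt : g s ≤ g t
  gs≤gt = +-cancelˡ-≤ (f s) _ _ (≤-trans (≤-reflexive eq) (+-monoˡ-≤ (g t) (antitone fa (<⇒≤ s<t))))

-- The old chain puts the entry into column `z r`, which the additional box already occupies in the
-- new chain; there the entry goes to column `z (suc r)`. If the two boxes in column `z r` are
-- counted on the same side, the states now agree and the bumped entry becomes the additional box.
-- Otherwise the entry is counted in `η` and the additional box in `μ`; then `z (suc r)` equals
-- `z r`, and the entry is counted in `η` in the new chain too.
extra-bump : ∀ {b z S S₁ S⁺ S⁺₁ r} → Valid z S → Addable z r →
             (b ≡ false → ∀ s → η S s ≡ 0) → (b ≡ false → ∀ s → η S⁺ s ≡ 0) →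
             Moved b (z r) S S₁ → Moved b (z (suc r)) S⁺ S⁺₁ → Extra (z r) S S⁺ → Extra (z (suc r)) S₁ S⁺₁
extra-bump {b} {z} {S} {S₁} {S⁺} {S⁺₁} {r} V add zer zer⁺ mv mv⁺ ex = go mv mv⁺ ex
  where
  V₁ = valid-moved {ρ = r} V add zer mv
  open Valid V₁
  z₁ = inc z r
  τ⁻≤τ : z (suc r) ≤ z r
  τ⁻≤τ = z-anti V r
  z₁≡ : z₁ (suc r) ≡ z (suc r)
  z₁≡ = inc-≢ z {r} (λ ())
  add₁ : Addable z₁ (suc r)
  add₁ = subst₂ _<_ (sym z₁≡) (sym (inc-≡ z r)) (s≤s τ⁻≤τ)
  zer₁ : b ≡ false → ∀ s → η S₁ s ≡ 0
  zer₁ = moved-zero zer mv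
  h⁻ : height S₁ (z (suc r)) ≡ suc r
  h⁻ = subst (λ t → height S₁ t ≡ suc r) z₁≡ (height-box V₁ (suc r) add₁)
  hτ : height S₁ (z r) ≡ suc r
  hτ = trans (moved-height mv (z r)) (trans (inc-≡ (height S) (z r)) (cong suc (height-box V r add)))
  same : η S⁺ ≗ η S₁ → μ S⁺ ≗ μ S₁ →
         (b ≡ true → z (suc r) ≡ z r → Addable (η S₁) (z r) → μ S₁ (z r) ≡ μ S₁ (suc (z r))) →
         Extra (z (suc r)) S₁ S⁺₁
  same e m key = subst (λ t → Extra t S₁ S⁺₁) z₁≡
    (extra-step {ρ = suc r} V₁ add₁ zer₁ e m
      (λ bt a → subst (λ t → μ S₁ t ≡ μ S₁ (suc t)) (sym z₁≡) (key′ bt (subst (Addable (η S₁)) z₁≡ a)))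
      (subst (λ t → Moved b t S⁺ S⁺₁) (sym z₁≡) mv⁺))
    where
    key′ : b ≡ true → Addable (η S₁) (z (suc r)) → μ S₁ (z (suc r)) ≡ μ S₁ (suc (z (suc r)))
    key′ bt a with z (suc r) ≟ z r
    ... | yes eq = subst (λ t → μ S₁ t ≡ μ S₁ (suc t)) (sym eq) (key bt eq (subst (Addable (η S₁)) eq a))
    -- After the step, columns `z (suc r)` and `z r` of the tableau both have length `suc r`, so `η`
    -- and `μ` are constant in between.
    ... | no neq = flat-between η-anti μ-anti (≤∧≢⇒< τ⁻≤τ neq) (trans h⁻ (sym hτ))
  -- If both parts drop at `z r`, the total drops by at least two there; the preceding column then
  -- passes row `suc r`, which is therefore as long as row `r`.
  stays : Addable (η S) (z r) → Addable (μ S) (z r) → z (suc r) ≡ z r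
  stays a c with z (suc r) ≟ z r
  ... | yes eq = eq
  ... | no neq = ⊥-elim (at (z r) refl a c)
    where
    at : ∀ t → z r ≡ t → Addable (η S) t → Addable (μ S) t → ⊥
    at zero eq _ _ = neq (trans (n≤0⇒n≡0 (subst (z (suc r) ≤_) eq τ⁻≤τ)) (sym eq))
    at (suc s) eq a c = <-irrefl refl (begin-strict
      suc r ≡⟨ cong suc (height-box V r add) ⟨
      suc (height S (z r)) ≡⟨ cong (λ t → suc (height S t)) eq ⟩
      suc (η S (suc s) + μ S (suc s)) ≡⟨ +-suc _ _ ⟨
      η S (suc s) + suc (μ S (suc s)) <⟨ +-mono-<-≤ a c ⟩
      height S s ≤⟨ inc-≥ (height S) (z r) s ⟩
      inc (height S) (z r) s ≡⟨ moved-height mv s ⟨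
      height S₁ s ≤⟨ antitone (height-anti V₁) (s≤s⁻¹ (subst (z (suc r) <_) eq (≤∧≢⇒< τ⁻≤τ neq))) ⟩
      height S₁ (z (suc r)) ≡⟨ h⁻ ⟩
      suc r ∎)
      where open ≤-Reasoning
  go : Moved b (z r) S S₁ → Moved b (z (suc r)) S⁺ S⁺₁ → Extra (z r) S S⁺ → Extra (z (suc r)) S₁ S⁺₁
  go (left bt a e m) (left _ _ e⁺ m⁺) (right e′ m′ c) = subst (λ t → Extra t S₁ S⁺₁) (sym eq)
    (right (subst (λ t → η S⁺₁ ≗ inc (η S⁺) t) eq e⁺ ⨾ (inc-cong _ e′ ⨾ flip≗ e))
           (m⁺ ⨾ (m′ ⨾ inc-cong _ (flip≗ m))) (addable-cong (flip≗ m) _ c))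
    where
    eq = stays a c
  go (left bt a e m) (right ¬a⁺ _ _) (right e′ m′ c) =
    contradiction (addable-cong (flip≗ e′) _ (subst (Addable (η S)) (sym (stays a c)) a)) (¬a⁺ bt)
  go (right ¬a e m) _ (right e′ m′ c) =
    same (e′ ⨾ flip≗ e) (m′ ⨾ flip≗ m) λ bt _ a → contradiction (addable-cong e _ a) (¬a bt)
  go (right ¬a e m) _ (left e′ m′ c q) = contradiction c (¬a (not-false b λ bf →
    contradiction (trans (sym (inc-≡ (η S) (z r))) (trans (sym (e′ (z r))) (zer⁺ bf (z r)))) (λ ())))
  go (left bt a e m) _ (left e′ m′ c q) =
    same (e′ ⨾ flip≗ e) (m′ ⨾ flip≗ m) λ _ _ _ → trans (m _) (trans q (sym (m _)))

-- Equal entries of a semistandard tableau form a horizontal strip: from left to right their rows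
-- weakly descend.
Before : ℕ × ℕ → ℕ × ℕ → Set
Before (a , ρ) (a′ , ρ′) = a < a′ ⊎ (a ≡ a′ × ρ′ ≤ ρ)

before-≤ : ∀ {a ρ a′ ρ′} → Before (a , ρ) (a′ , ρ′) → a ≤ a′
before-≤ (inj₁ lt) = <⇒≤ lt
before-≤ (inj₂ (eq , _)) = ≤-reflexive eq

Monotone : (ℕ → Bool) → Set
Monotone act = ∀ {a a′} → a ≤ a′ → act a ≡ true → act a′ ≡ true

monotone-false : ∀ {act} → Monotone act → ∀ {a a′} → a ≤ a′ → act a′ ≡ false → act a ≡ false
monotone-false {act} mono {a} a≤a′ ff with act a in eq
... | false = refl
... | true = trans (sym (mono a≤a′ eq)) ff

-- The chains before and after an insertion, read in lockstep

record Inserted (act : ℕ → Bool) (z z⁺ : ℕ → ℕ) (S S⁺ : State) (ch ch⁺ : Chain) (r : ℕ) : Set where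
  field
    valid : Valid (rows z ch) (run act z S ch)
    addable : Addable (rows z ch) r
    rows⁺ : rows z⁺ ch⁺ ≗ inc (rows z ch) r
    extra : Extra (rows z ch r) (run act z S ch) (run act z⁺ S⁺ ch⁺)

module _ {act : ℕ → Bool} (mono : Monotone act) where

  -- Induction along the route with `extra-bump` for entries of the current row and `extra-keep` for
  -- all others. Emptiness of `η` is tied to the last letter `lo`: if a later letter is inactive, so
  -- is `lo`, and nothing has yet been placed up to the threshold.
  bumped : ∀ ch {lo ρ₀ z z⁺ S S⁺ r} → Valid z S → Lattice z ch → Linked Before ((lo , ρ₀) ∷ ch) →
           (act lo ≡ false → ∀ s → η S s ≡ 0) → (act lo ≡ false → ∀ s → η S⁺ s ≡ 0) →
           z⁺ ≗ inc z r → Addable z r → Extra (z r) S S⁺ →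
           Inserted act z z⁺ S S⁺ ch (bump r ch) (bumpRow r ch)
  bumped [] V L B zer zer⁺ z⁺≗ add ex = record { valid = V ; addable = add ; rows⁺ = z⁺≗ ; extra = ex }
  bumped ((a , ρ) ∷ ch) {z = z} {z⁺} {S} {S⁺} {r} V (addρ , L) (B ∷ Bs) zer zer⁺ z⁺≗ add ex with ρ ≟ r
  ... | yes refl = record { Inserted rec }
    where
    zera = λ ff → zer (monotone-false {act} mono (before-≤ B) ff)
    zera⁺ = λ ff → zer⁺ (monotone-false {act} mono (before-≤ B) ff)
    mv = step-moved (act a) (z r) S
    mv⁺ = step-moved (act a) (z⁺ (suc r)) S⁺
    rec = bumped ch (valid-moved {ρ = ρ} V addρ zera mv) L Bs (moved-zero zera mv) (moved-zero zera⁺ mv⁺)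
        (λ i → inc-cong (suc r) z⁺≗ i)
        (subst₂ _<_ (sym (inc-≢ z {r} {suc r} λ ())) (sym (inc-≡ z r)) (s≤s (z-anti V r)))
        (subst (λ t → Extra t (step (act a) (z r) S) (step (act a) (z⁺ (suc r)) S⁺)) (sym (inc-≢ z {r} {suc r} λ ()))
          (extra-bump {b = act a} {r = r} V add zera zera⁺ mv
            (subst (λ t → Moved (act a) t S⁺ _) (trans (z⁺≗ (suc r)) (inc-≢ z {r} λ ())) mv⁺) ex))
  ... | no ρ≢r = record { Inserted rec }
    where
    zera = λ ff → zer (monotone-false {act} mono (before-≤ B) ff)
    zera⁺ = λ ff → zer⁺ (monotone-false {act} mono (before-≤ B) ff)
    mv = step-moved (act a) (z ρ) S
    mv⁺ = step-moved (act a) (z⁺ ρ) S⁺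
    rec = bumped ch (valid-moved {ρ = ρ} V addρ zera mv) L Bs (moved-zero zera mv) (moved-zero zera⁺ mv⁺)
        (λ i → trans (inc-cong ρ z⁺≗ i) (inc-comm z r ρ i))
        (addable-inc z ρ r (λ eq → ρ≢r (sym eq)) add)
        (subst (λ t → Extra t (step (act a) (z ρ) S) (step (act a) (z⁺ ρ) S⁺)) (sym (inc-≢ z (λ eq → ρ≢r (sym eq))))
          (extra-keep {b = act a} V {r} {ρ} add addρ ρ≢r zera mv
            (subst (λ t → Moved (act a) t S⁺ _) (trans (z⁺≗ ρ) (inc-≢ z ρ≢r)) mv⁺) ex))

  -- The box of `x` ends row 0, so its column is empty: the height vanishes at `z 0`, hence `μ` does
  -- from there on, and the flatness required by `left` is automatic.
  inserted-first : ∀ {x lo z S} ch → Valid z S → Lattice z ch → Linked Before ((x , 0) ∷ ch) → lo ≤ x →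
             (act lo ≡ false → ∀ s → η S s ≡ 0) →
             Inserted act z z S S ch ((x , 0) ∷ bump 0 ch) (bumpRow 0 ch)
  inserted-first {x} {z = z} {S} ch V L Bs lo≤x zer = record { Inserted rec }
    where
    mv = step-moved (act x) (z 0) S
    zerx = λ ff → zer (monotone-false {act} mono lo≤x ff)
    μ0 : μ S (z 0) ≡ 0
    μ0 = m+n≡0⇒n≡0 (η S (z 0)) (height-box V 0 tt)
    rec = bumped ch {z⁺ = inc z 0} {r = 0} V L Bs zerx (moved-zero zerx mv) (λ _ → refl) tt
      (extra-step {ρ = 0} V tt zerx (λ _ → refl) (λ _ → refl)
        (λ _ _ → trans μ0 (sym (n≤0⇒n≡0 (subst (μ S (suc (z 0)) ≤_) μ0 (Valid.μ-anti V (z 0)))))) mv)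

  inserted : ∀ x ch {lo ρ₀ z S} → Valid z S → Lattice z ch → Linked Before ((lo , ρ₀) ∷ ch) → lo ≤ x →
             (act lo ≡ false → ∀ s → η S s ≡ 0) →
             Inserted act z z S S ch (insert x ch) (insertedRow x ch)
  inserted x [] V L Bs lo≤x zer = inserted-first [] V L [-] lo≤x zer
  inserted x ((a , ρ) ∷ ch) {z = z} {S} V L (B ∷ Bs) lo≤x zer with a ≤? x
  ... | no a≰x = inserted-first ((a , ρ) ∷ ch) V L (inj₁ (≰⇒> a≰x) ∷ Bs) lo≤x zer
  ... | yes a≤x = record { Inserted rec }
    where
    zera = λ ff → zer (monotone-false {act} mono (before-≤ B) ff)
    mv = step-moved (act a) (z ρ) S
    rec = inserted x ch (valid-moved {ρ = ρ} V (proj₁ L) zera mv) (proj₂ L) Bs a≤x (moved-zero zera mv)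

-- The chain after an insertion is again a chain of a semistandard tableau

bump-lattice : ∀ {z z⁺ r} ch → Antitone z → Lattice z ch → z⁺ ≗ inc z r → Addable z r → Lattice z⁺ (bump r ch)
bump-lattice [] _ _ _ _ = tt
bump-lattice {z} {z⁺} {r} ((a , ρ) ∷ ch) anti (addρ , L) z⁺≗ add with ρ ≟ r
... | yes refl = subst₂ _<_ (sym (trans (z⁺≗ (suc r)) (inc-≢ z {r} λ ()))) (sym (trans (z⁺≗ r) (inc-≡ z r))) (s≤s (anti r)) ,
      bump-lattice ch (inc-antitone r anti addρ) L (inc-cong (suc r) z⁺≗)
        (subst₂ _<_ (sym (inc-≢ z {r} {suc r} λ ())) (sym (inc-≡ z r)) (s≤s (anti r)))
... | no ρ≢r = addable-cong (λ i → sym (z⁺≗ i)) ρ (addable-inc z r ρ ρ≢r addρ) ,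
      bump-lattice ch (inc-antitone ρ anti addρ) L (λ i → trans (inc-cong ρ z⁺≗ i) (inc-comm z r ρ i))
        (addable-inc z ρ r (λ eq → ρ≢r (sym eq)) add)

insert-lattice : ∀ {z} x ch → Antitone z → Lattice z ch → Lattice z (insert x ch)
insert-lattice x [] _ _ = tt , tt
insert-lattice {z} x ((a , ρ) ∷ ch) anti L with a ≤? x
... | yes _ = proj₁ L , insert-lattice x ch (inc-antitone ρ anti (proj₁ L)) (proj₂ L)
... | no _ = tt , bump-lattice ((a , ρ) ∷ ch) anti L (λ _ → refl) tt

-- The two hypotheses are all that must be known of the preceding entry, `e` in the old chain and
-- `e⁺` in the new one. Once an entry has moved up from row `r`, the next bumped entry lies in row
-- `suc r` and thus cannot be a copy of the same letter.
bump-before : ∀ {e e⁺ r} ch → (∀ e′ → Before e e′ → Before e⁺ e′) → (∀ a → Before e (a , r) → Before e⁺ (a , suc r)) →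
              Linked Before (e ∷ ch) → Linked Before (e⁺ ∷ bump r ch)
bump-before [] _ _ _ = [-]
bump-before {r = r} ((a , ρ) ∷ ch) keep move (B ∷ Bs) with ρ ≟ r
... | yes refl = move a B ∷ bump-before ch (λ { _ (inj₁ lt) → inj₁ lt ; _ (inj₂ (eq , le)) → inj₂ (eq , m≤n⇒m≤1+n le) })
                   (λ { _ (inj₁ lt) → inj₁ lt ; _ (inj₂ (_ , lt)) → contradiction lt (<⇒≱ ≤-refl) }) Bs
... | no ρ≢r = keep _ B ∷ bump-before ch (λ _ B → B)
                   (λ { _ (inj₁ lt) → inj₁ lt ; _ (inj₂ (eq , le)) → inj₂ (eq , ≤∧≢⇒< le λ eq → ρ≢r (sym eq)) }) Bs

insert-before : ∀ {lo ρ₀} x ch → lo ≤ x → Linked Before ((lo , ρ₀) ∷ ch) → Linked Before ((lo , ρ₀) ∷ insert x ch)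
insert-before {lo} {ρ₀} x ch lo≤x Bs with m≤n⇒m<n∨m≡n lo≤x
insert-before x [] lo≤x Bs | inj₁ lt = inj₁ lt ∷ [-]
insert-before x [] lo≤x Bs | inj₂ eq = inj₂ (eq , z≤n) ∷ [-]
insert-before x ((a , ρ) ∷ ch) lo≤x (B ∷ Bs) | d with a ≤? x
... | yes a≤x = B ∷ insert-before x ch a≤x Bs
-- The predecessor `(a , suc ρ)` is fictitious; it only transmits that all later letters are at
-- least `a`, hence larger than `x`.
... | no a≰x = first d ∷ bump-before {e = a , suc ρ} ((a , ρ) ∷ ch) (λ _ B → above B) (λ _ B → above B)
                   (inj₂ (refl , n≤1+n ρ) ∷ Bs)
  where
  above : ∀ {a′ ρ′ ρ″} → Before (a , suc ρ) (a′ , ρ′) → Before (x , 0) (a′ , ρ″)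
  above B = inj₁ (<-≤-trans (≰⇒> a≰x) (before-≤ B))
  first : _ → Before (_ , _) (x , 0)
  first (inj₁ lt) = inj₁ lt
  first (inj₂ eq) = inj₂ (eq , z≤n)

module _ {Pr : ℕ → Set} where

  bump-letters : ∀ r ch → All (λ e → Pr (proj₁ e)) ch → All (λ e → Pr (proj₁ e)) (bump r ch)
  bump-letters r [] [] = []
  bump-letters r ((a , ρ) ∷ ch) (p ∷ ps) with ρ ≟ r
  ... | yes _ = p ∷ bump-letters (suc r) ch ps
  ... | no _ = p ∷ bump-letters r ch ps

  bump-letters⁻ : ∀ r ch → All (λ e → Pr (proj₁ e)) (bump r ch) → All (λ e → Pr (proj₁ e)) ch
  bump-letters⁻ r [] [] = []
  bump-letters⁻ r ((a , ρ) ∷ ch) ps with ρ ≟ r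
  bump-letters⁻ r ((a , ρ) ∷ ch) (p ∷ ps) | yes _ = p ∷ bump-letters⁻ (suc r) ch ps
  bump-letters⁻ r ((a , ρ) ∷ ch) (p ∷ ps) | no _ = p ∷ bump-letters⁻ r ch ps

  insert-letters : ∀ {x} ch → Pr x → All (λ e → Pr (proj₁ e)) ch → All (λ e → Pr (proj₁ e)) (insert x ch)
  insert-letters [] px [] = px ∷ []
  insert-letters {x} ((a , ρ) ∷ ch) px (p ∷ ps) with a ≤? x
  ... | yes _ = p ∷ insert-letters ch px ps
  ... | no _ = px ∷ bump-letters 0 _ (p ∷ ps)

  insert-letters⁻ : ∀ {x} ch → All (λ e → Pr (proj₁ e)) (insert x ch) → Pr x × All (λ e → Pr (proj₁ e)) ch
  insert-letters⁻ [] (px ∷ []) = px , []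
  insert-letters⁻ {x} ((a , ρ) ∷ ch) ps with a ≤? x
  insert-letters⁻ ((a , ρ) ∷ ch) (p ∷ ps) | yes _ = proj₁ (insert-letters⁻ ch ps) , p ∷ proj₂ (insert-letters⁻ ch ps)
  insert-letters⁻ ((a , ρ) ∷ ch) (px ∷ ps) | no _ = px , bump-letters⁻ 0 _ ps

-- Successive bumping routes

bumpRow-bump : ∀ {r r′} ch → r′ ≤ r → bumpRow r′ (bump r ch) ≤ bumpRow r ch
bumpRow-bump [] r′≤r = r′≤r
bumpRow-bump {r} {r′} ((a , ρ) ∷ ch) r′≤r with ρ ≟ r
bumpRow-bump {r} {r′} ((a , ρ) ∷ ch) r′≤r | yes _ with suc r ≟ r′
... | yes refl = contradiction r′≤r (<⇒≱ ≤-refl)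
... | no _ = bumpRow-bump ch (m≤n⇒m≤1+n r′≤r)
bumpRow-bump {r} {r′} ((a , ρ) ∷ ch) r′≤r | no ρ≢r with ρ ≟ r′
... | yes refl = bumpRow-bump ch (≤∧≢⇒< r′≤r ρ≢r)
... | no _ = bumpRow-bump ch r′≤r

insertedRow-bump : ∀ x {r} ch → insertedRow x (bump r ch) ≤ bumpRow r ch
insertedRow-bump x [] = z≤n
insertedRow-bump x {r} ((a , ρ) ∷ ch) with ρ ≟ r | bumpRow-bump {r} {0} ((a , ρ) ∷ ch) z≤n
... | yes _ | le with a ≤? x
...   | yes _ = insertedRow-bump x ch
...   | no _ = le
insertedRow-bump x {r} ((a , ρ) ∷ ch) | no _ | le with a ≤? x
...   | yes _ = insertedRow-bump x ch
...   | no _ = le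

-- The row bumping lemma: read along the chain, the second route starts no higher than the first and
-- never overtakes it. It makes the boxes recorded under one top entry descend, as `Before` requires
-- of the recording chain.
insertedRow-insert : ∀ {x x′} ch → x ≤ x′ → insertedRow x′ (insert x ch) ≤ insertedRow x ch
insertedRow-insert {x} {x′} [] x≤x′ with x ≤? x′
... | yes _ = z≤n
... | no x≰x′ = contradiction x≤x′ x≰x′
insertedRow-insert {x} {x′} ((a , ρ) ∷ ch) x≤x′ with a ≤? x
insertedRow-insert {x} {x′} ((a , ρ) ∷ ch) x≤x′ | yes a≤x with a ≤? x′
... | yes _ = insertedRow-insert ch x≤x′
... | no a≰x′ = contradiction (≤-trans a≤x x≤x′) a≰x′
insertedRow-insert {x} {x′} ((a , ρ) ∷ ch) x≤x′ | no _ with x ≤? x′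
... | yes _ = insertedRow-bump x′ ((a , ρ) ∷ ch)
... | no x≰x′ = contradiction x≤x′ x≰x′

-- Row insertion on chains

rowOf : ℕ → Chain → List ℕ
rowOf k [] = []
rowOf k ((a , ρ) ∷ ch) with ρ ≟ k
... | yes _ = a ∷ rowOf k ch
... | no _ = rowOf k ch

rowOf-≡ : ∀ k a ch → rowOf k ((a , k) ∷ ch) ≡ a ∷ rowOf k ch
rowOf-≡ k a ch with k ≟ k
... | yes _ = refl
... | no k≢k = contradiction refl k≢k

rowOf-≢ : ∀ {k ρ} a ch → ρ ≢ k → rowOf k ((a , ρ) ∷ ch) ≡ rowOf k ch
rowOf-≢ {k} {ρ} a ch ρ≢k with ρ ≟ k
... | yes eq = contradiction eq ρ≢k
... | no _ = refl

rowOf-++ : ∀ k ch ch′ → rowOf k (ch ++ ch′) ≡ rowOf k ch ++ rowOf k ch′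
rowOf-++ k [] ch′ = refl
rowOf-++ k ((a , ρ) ∷ ch) ch′ with ρ ≟ k
... | yes _ = cong (a ∷_) (rowOf-++ k ch ch′)
... | no _ = rowOf-++ k ch ch′

rowOf-mid : ∀ {k ρ} pre a post → ρ ≢ k → rowOf k (pre ++ (a , ρ) ∷ post) ≡ rowOf k (pre ++ post)
rowOf-mid {k} pre a post ρ≢k = trans (rowOf-++ k pre _)
  (trans (cong (rowOf k pre ++_) (rowOf-≢ a post ρ≢k)) (sym (rowOf-++ k pre post)))

rowOf-at : ∀ k pre a post → rowOf k (pre ++ (a , k) ∷ post) ≡ rowOf k pre ++ a ∷ rowOf k post
rowOf-at k pre a post = trans (rowOf-++ k pre _) (cong (rowOf k pre ++_) (rowOf-≡ k a post))

rowOf-++-[] : ∀ k ch {ch′} → rowOf k ch′ ≡ [] → rowOf k (ch ++ ch′) ≡ rowOf k ch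
rowOf-++-[] k ch eq = trans (rowOf-++ k ch _) (trans (cong (rowOf k ch ++_) eq) (++-identityʳ _))

rowOf-bump : ∀ {k r} ch → k < r → rowOf k (bump r ch) ≡ rowOf k ch
rowOf-bump [] k<r = refl
rowOf-bump {k} {r} ((a , ρ) ∷ ch) k<r with ρ ≟ r
... | yes refl = trans (rowOf-≢ a _ (λ eq → <⇒≢ (m<n⇒m<1+n k<r) (sym eq)))
                 (trans (rowOf-bump ch (m<n⇒m<1+n k<r)) (sym (rowOf-≢ a ch (λ eq → <⇒≢ k<r (sym eq)))))
... | no _ with ρ ≟ k
...   | yes _ = cong (a ∷_) (rowOf-bump ch k<r)
...   | no _ = rowOf-bump ch k<r

rowOf-letters : ∀ {Pr : ℕ → Set} k {ch} → All (λ e → Pr (proj₁ e)) ch → All Pr (rowOf k ch)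
rowOf-letters k [] = []
rowOf-letters k {(a , ρ) ∷ ch} (p ∷ ps) with ρ ≟ k
... | yes _ = p ∷ rowOf-letters k ps
... | no _ = rowOf-letters k ps

-- Stored rows are nonempty and end where the chain has no more entries, so the chain determines the
-- tableau.
data Rep (ch : Chain) : ℕ → Tableau → Set where
  nil : ∀ {k} → (∀ ρ → k ≤ ρ → rowOf ρ ch ≡ []) → Rep ch k []
  cons : ∀ {k a as T} → rowOf k ch ≡ a ∷ as → Rep ch (suc k) T → Rep ch k ((a ∷ as) ∷ T)

rep-cong : ∀ {ch ch′ k T} → (∀ ρ → k ≤ ρ → rowOf ρ ch ≡ rowOf ρ ch′) → Rep ch k T → Rep ch′ k T
rep-cong eq (nil e) = nil λ ρ k≤ρ → trans (sym (eq ρ k≤ρ)) (e ρ k≤ρ)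
rep-cong {k = k} eq (cons e R) = cons (trans (sym (eq k ≤-refl)) e) (rep-cong (λ ρ k<ρ → eq ρ (<⇒≤ k<ρ)) R)

rep-unique : ∀ {ch k T T′} → Rep ch k T → Rep ch k T′ → T ≡ T′
rep-unique (nil _) (nil _) = refl
rep-unique {k = k} (nil e) (cons e′ _) with trans (sym (e k ≤-refl)) e′
... | ()
rep-unique {k = k} (cons e′ _) (nil e) with trans (sym (e k ≤-refl)) e′
... | ()
rep-unique (cons e R) (cons e′ R′) = cong₂ _∷_ (trans (sym e) e′) (rep-unique R R′)

cons′ : ∀ {ch k T} R → R ≢ [] → rowOf k ch ≡ R → Rep ch (suc k) T → Rep ch k (R ∷ T)
cons′ [] ne _ _ = contradiction refl ne
cons′ (_ ∷ _) _ eq R = cons eq R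

insertRow-append : ∀ {y as} → All (_≤ y) as → insertRow y as ≡ (as ++ [ y ] , nothing)
insertRow-append [] = refl
insertRow-append {y} {a ∷ as} (a≤y ∷ ps) with y <? a
... | yes y<a = contradiction a≤y (<⇒≱ y<a)
... | no _ = cong (λ p → a ∷ proj₁ p , proj₂ p) (insertRow-append ps)

insertRow-replace : ∀ {y as b bs} → All (_≤ y) as → y < b → insertRow y (as ++ b ∷ bs) ≡ (as ++ y ∷ bs , just b)
insertRow-replace {y} {b = b} [] y<b with y <? b
... | yes _ = refl
... | no y≮b = contradiction y<b y≮b
insertRow-replace {y} {a ∷ as} (a≤y ∷ ps) y<b with y <? a
... | yes y<a = contradiction a≤y (<⇒≱ y<a)
... | no _ = cong (λ p → a ∷ proj₁ p , proj₂ p) (insertRow-replace ps y<b)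

insertTab-nothing : ∀ {x row row′ T} → insertRow x row ≡ (row′ , nothing) → insertTab x (row ∷ T) ≡ (row′ ∷ T , 0)
insertTab-nothing eq rewrite eq = refl

insertTab-just : ∀ {x row row′ y T} → insertRow x row ≡ (row′ , just y) →
  insertTab x (row ∷ T) ≡ (row′ ∷ proj₁ (insertTab y T) , suc (proj₂ (insertTab y T)))
insertTab-just eq rewrite eq = refl

-- When `post` holds what follows the inserted entry, its first member of row `k` is the leftmost
-- larger entry of that row: the one that row insertion bumps.
data Split (k : ℕ) (post : Chain) : Set where
  none : rowOf k post ≡ [] → bump k post ≡ post → bumpRow k post ≡ k → Split k post
  some : ∀ post₁ a post₂ → post ≡ post₁ ++ (a , k) ∷ post₂ → rowOf k post₁ ≡ [] →
         bump k post ≡ post₁ ++ (a , suc k) ∷ bump (suc k) post₂ →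
         bumpRow k post ≡ bumpRow (suc k) post₂ → Split k post

bump-≡ : ∀ r a ch → bump r ((a , r) ∷ ch) ≡ (a , suc r) ∷ bump (suc r) ch × bumpRow r ((a , r) ∷ ch) ≡ bumpRow (suc r) ch
bump-≡ r a ch with r ≟ r
... | yes _ = refl , refl
... | no r≢r = contradiction refl r≢r

bump-≢ : ∀ {r ρ} a ch → ρ ≢ r → bump r ((a , ρ) ∷ ch) ≡ (a , ρ) ∷ bump r ch × bumpRow r ((a , ρ) ∷ ch) ≡ bumpRow r ch
bump-≢ {r} {ρ} a ch ρ≢r with ρ ≟ r
... | yes eq = contradiction eq ρ≢r
... | no _ = refl , refl

split : ∀ k post → Split k post
split k [] = none refl refl refl
split k ((a , ρ) ∷ post) with ρ ≟ k
... | yes refl = some [] a post refl refl (proj₁ (bump-≡ k a post)) (proj₂ (bump-≡ k a post))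
... | no ρ≢k with bump-≢ a post ρ≢k | split k post
...   | b≢ , r≢ | none e b r = none (trans (rowOf-≢ a post ρ≢k) e) (trans b≢ (cong (_ ∷_) b)) (trans r≢ r)
...   | b≢ , r≢ | some post₁ a′ post₂ e₁ e₂ b r =
  some ((a , ρ) ∷ post₁) a′ post₂ (cong (_ ∷_) e₁) (trans (rowOf-≢ a post₁ ρ≢k) e₂) (trans b≢ (cong (_ ∷_) b)) (trans r≢ r)

allPairs-mid : ∀ {X : Set} {R : X → X → Set} xs {e ys} → AllPairs R (xs ++ e ∷ ys) →
               All (λ e′ → R e′ e) xs × All (R e) ys × AllPairs R ys
allPairs-mid [] (p ∷ ps) = [] , p , ps
allPairs-mid (x ∷ xs) (p ∷ ps) with allPairs-mid xs ps
... | q , r , s = All.lookup p (mid xs) ∷ q , r , s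
  where
  mid : ∀ {X : Set} (xs : List X) {e ys} → e ∈ xs ++ e ∷ ys
  mid [] = here refl
  mid (_ ∷ xs) = there (mid xs)

-- The strict inequality is demanded only in rows from `k` on: after a bump, copies of `y` in lower
-- rows still follow it in the chain. Copies in higher rows would precede it, by `Before`.
rep-insertTab : ∀ k y pre post T → Rep (pre ++ post) k T → All (λ e → proj₁ e ≤ y) pre → AllPairs Before post →
  All (λ e → k ≤ proj₂ e → y < proj₁ e) post →
  proj₂ (insertTab y T) + k ≡ bumpRow k post ×
  Rep (pre ++ (y , k) ∷ bump k post) k (proj₁ (insertTab y T))
rep-insertTab k y pre post T R ≤y B >y with split k post
rep-insertTab k y pre post [] (nil e) ≤y B >y | none e₀ b r rewrite b =
  sym r , cons (trans (rowOf-at k pre y post) (cong₂ _++_ empty-pre (cong (y ∷_) e₀)))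
               (nil λ ρ k<ρ → trans (rowOf-mid pre y post (<⇒≢ k<ρ)) (e ρ (<⇒≤ k<ρ)))
  where
  empty-pre : rowOf k pre ≡ []
  empty-pre = ++-conicalˡ _ _ (trans (sym (rowOf-++ k pre post)) (e k ≤-refl))
rep-insertTab k y pre post (.(_ ∷ _) ∷ T) (cons {a = a} {as} e R) ≤y B >y | none e₀ b r
  rewrite insertTab-nothing {T = T} (insertRow-append {y} {a ∷ as} (subst (All (_≤ y)) (trans (sym (rowOf-++-[] k pre e₀)) e) (rowOf-letters k ≤y))) | b =
  sym r , cons (trans (rowOf-at k pre y post) (cong₂ _++_ (trans (sym (rowOf-++-[] k pre e₀)) e) (cong (y ∷_) e₀)))
               (rep-cong (λ ρ k<ρ → sym (rowOf-mid pre y post (<⇒≢ k<ρ))) R)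
rep-insertTab k y pre _ [] (nil e) ≤y B >y | some post₁ a post₂ refl e₀ b r
  with ++-conicalʳ (rowOf k (pre ++ post₁)) _ (trans (sym (trans (cong (rowOf k) (sym (++-assoc pre post₁ _))) (rowOf-at k (pre ++ post₁) a post₂))) (e k ≤-refl))
... | ()
rep-insertTab k y pre _ (.(_ ∷ _) ∷ T) (cons {a = c} {cs} e R) ≤y B >y | some post₁ a post₂ refl e₀ b r = row , rep
  where
  row≡ : c ∷ cs ≡ rowOf k pre ++ a ∷ rowOf k post₂
  row≡ = trans (sym e) (trans (rowOf-++ k pre _) (cong (rowOf k pre ++_)
           (trans (rowOf-at k post₁ a post₂) (cong (_++ a ∷ rowOf k post₂) e₀))))
  mid = allPairs-mid {R = Before} post₁ B
  y<a : y < a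
  y<a = All.lookup >y (∈-++⁺ʳ post₁ (here refl)) ≤-refl
  ins : insertTab y ((c ∷ cs) ∷ T) ≡ ((rowOf k pre ++ y ∷ rowOf k post₂) ∷ proj₁ (insertTab a T) , suc (proj₂ (insertTab a T)))
  ins = insertTab-just (trans (cong (insertRow y) row≡) (insertRow-replace (rowOf-letters k ≤y) y<a))
  pre′ = pre ++ (y , k) ∷ post₁
  rec = rep-insertTab (suc k) a pre′ post₂ T
    (rep-cong (λ ρ k<ρ → trans (cong (rowOf ρ) (sym (++-assoc pre post₁ _)))
        (trans (rowOf-mid (pre ++ post₁) a post₂ (<⇒≢ k<ρ))
        (trans (cong (rowOf ρ) (++-assoc pre post₁ post₂))
        (trans (sym (rowOf-mid pre y (post₁ ++ post₂) (<⇒≢ k<ρ)))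
          (cong (rowOf ρ) (sym (++-assoc pre ((y , k) ∷ post₁) post₂))))))) R)
    (++⁺ (All.map (λ le → ≤-trans le (<⇒≤ y<a)) ≤y) (<⇒≤ y<a ∷ All.map (λ {e} B → before-≤ B) (proj₁ mid)))
    (proj₂ (proj₂ mid))
    (All.map (λ { (inj₁ lt) _ → lt ; (inj₂ (_ , le)) lt → contradiction lt (≤⇒≯ le) }) (proj₁ (proj₂ mid)))
  row : proj₂ (insertTab y ((c ∷ cs) ∷ T)) + k ≡ bumpRow k (post₁ ++ (a , k) ∷ post₂)
  row rewrite ins = trans (sym (+-suc _ k)) (trans (proj₁ rec) (sym r))
  target : pre′ ++ (a , suc k) ∷ bump (suc k) post₂ ≡ pre ++ (y , k) ∷ bump k (post₁ ++ (a , k) ∷ post₂)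
  target = trans (++-assoc pre ((y , k) ∷ post₁) _) (cong (λ l → pre ++ (y , k) ∷ l) (sym b))
  nonempty : ∀ (xs : List ℕ) {x ys} → xs ++ x ∷ ys ≢ []
  nonempty [] ()
  nonempty (_ ∷ _) ()
  after : rowOf k (bump k (post₁ ++ (a , k) ∷ post₂)) ≡ rowOf k post₂
  after = trans (cong (rowOf k) b) (trans (rowOf-++ k post₁ _) (trans (cong₂ _++_ e₀ (rowOf-≢ {k} {suc k} a (bump (suc k) post₂) (λ ()))) (rowOf-bump post₂ (n<1+n k))))
  rep : Rep (pre ++ (y , k) ∷ bump k (post₁ ++ (a , k) ∷ post₂)) k (proj₁ (insertTab y ((c ∷ cs) ∷ T)))
  rep rewrite ins = cons′ _ (nonempty (rowOf k pre)) (trans (rowOf-at k pre y _) (cong (λ l → rowOf k pre ++ y ∷ l) after))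
    (subst (λ ch → Rep ch (suc k) _) target (proj₂ rec))

split-insert : ∀ x ch → AllPairs Before ch → ∃₂ λ pre post → ch ≡ pre ++ post × All (λ e → proj₁ e ≤ x) pre ×
  AllPairs Before post × All (λ e → x < proj₁ e) post ×
  insert x ch ≡ pre ++ (x , 0) ∷ bump 0 post × insertedRow x ch ≡ bumpRow 0 post
split-insert x [] B = [] , [] , refl , [] , [] , [] , refl , refl
split-insert x ((a , ρ) ∷ ch) (B ∷ Bs) with a ≤? x
... | no a≰x = [] , _ , refl , [] , B ∷ Bs , ≰⇒> a≰x ∷ All.map (λ p → <-≤-trans (≰⇒> a≰x) (before-≤ p)) B , refl , refl
... | yes a≤x with split-insert x ch Bs
...   | pre , post , e , ≤x , Bp , >x , i , r =
  (a , ρ) ∷ pre , post , cong (_ ∷_) e , a≤x ∷ ≤x , Bp , >x , cong (_ ∷_) i , r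

rep-insert : ∀ x ch T → Rep ch 0 T → AllPairs Before ch →
  proj₂ (insertTab x T) ≡ insertedRow x ch × Rep (insert x ch) 0 (proj₁ (insertTab x T))
rep-insert x ch T R B with split-insert x ch B
... | pre , post , refl , ≤x , Bp , >x , i , r
  with rep-insertTab 0 x pre post T R ≤x Bp (All.map (λ lt _ → lt) >x)
... | row , rep = trans (sym (+-identityʳ _)) (trans row (sym r)) , subst (λ c → Rep c 0 _) (sym i) rep

rowOf-snoc-≡ : ∀ ch k a → rowOf k (ch ++ [ a , k ]) ≡ rowOf k ch ++ [ a ]
rowOf-snoc-≡ ch k a = rowOf-at k ch a []

rowOf-snoc-≢ : ∀ ch {k ρ} a → ρ ≢ k → rowOf k (ch ++ [ a , ρ ]) ≡ rowOf k ch
rowOf-snoc-≢ ch a ne = trans (rowOf-mid ch a [] ne) (cong (rowOf _) (++-identityʳ ch))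

-- Past the last row `addAt` opens a new row whatever index remains, so all rows below the target
-- must exist.
rep-addAt : ∀ i {ch k T} a → Rep ch k T → (∀ ρ → k ≤ ρ → ρ < i + k → rowOf ρ ch ≢ []) →
            Rep (ch ++ [ a , i + k ]) k (addAt i a T)
rep-addAt zero {ch} {k} a (nil e) ne =
  cons (trans (rowOf-snoc-≡ ch k a) (cong (_++ [ a ]) (e k ≤-refl)))
       (nil λ ρ k<ρ → trans (rowOf-snoc-≢ ch a (<⇒≢ k<ρ)) (e ρ (<⇒≤ k<ρ)))
rep-addAt (suc i) {ch} {k} a (nil e) ne = contradiction (e k ≤-refl) (ne k ≤-refl (s≤s (m≤n+m k i)))
rep-addAt zero {ch} {k} a (cons e R) ne =
  cons (trans (rowOf-snoc-≡ ch k a) (cong (_++ [ a ]) e))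
       (rep-cong (λ ρ k<ρ → sym (rowOf-snoc-≢ ch a (<⇒≢ k<ρ))) R)
rep-addAt (suc i) {ch} {k} a (cons {T = T} e R) ne =
  cons (trans (rowOf-snoc-≢ ch a (λ eq → <⇒≢ (s≤s (m≤n+m k i)) (sym eq))) e)
       (subst (λ r → Rep (ch ++ [ a , r ]) (suc k) (addAt i a T)) (+-suc i k)
         (rep-addAt i a R (λ ρ k<ρ lt → ne ρ (<⇒≤ k<ρ) (subst (ρ <_) (+-suc i k) lt))))

build : Tableau → Chain → Tableau
build T [] = T
build T ((a , ρ) ∷ ch) = build (addAt ρ a T) ch

addable-below : ∀ {z ρ} → Antitone z → Addable z ρ → ∀ {ρ′} → ρ′ < ρ → 0 < z ρ′
addable-below {ρ = suc ρ} anti add (s≤s ρ′≤ρ) = ≤-<-trans z≤n (<-≤-trans add (antitone anti ρ′≤ρ))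

rep-snoc : ∀ {z pre T a ρ} → Antitone z → (∀ ρ → length (rowOf ρ pre) ≡ z ρ) → Rep pre 0 T →
           Addable z ρ → Rep (pre ++ [ a , ρ ]) 0 (addAt ρ a T)
rep-snoc {z} {pre} {T} {a} {ρ} anti len R add =
  subst (λ r → Rep (pre ++ [ a , r ]) 0 (addAt ρ a T)) (+-identityʳ ρ)
    (rep-addAt ρ a R λ ρ′ _ lt empty-row → <-irrefl (trans (cong length (sym empty-row)) (len ρ′))
      (addable-below anti add (subst (ρ′ <_) (+-identityʳ ρ) lt)))

rep-build : ∀ {z pre T} ch → Antitone z → (∀ ρ → length (rowOf ρ pre) ≡ z ρ) → Rep pre 0 T → Lattice z ch →
            Rep (pre ++ ch) 0 (build T ch)
rep-build {pre = pre} [] _ _ R _ = subst (λ c → Rep c 0 _) (sym (++-identityʳ pre)) R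
rep-build {z} {pre} {T} ((a , ρ) ∷ ch) anti len R (add , L) =
  subst (λ c → Rep c 0 _) (++-assoc pre [ a , ρ ] ch)
    (rep-build ch (inc-antitone ρ anti add) len′ (rep-snoc anti len R add) L)
  where
  len′ : ∀ ρ′ → length (rowOf ρ′ (pre ++ [ a , ρ ])) ≡ inc z ρ ρ′
  len′ ρ′ with ρ′ ≟ ρ
  ... | yes refl = trans (cong length (rowOf-snoc-≡ pre ρ a)) (trans (length-++ (rowOf ρ pre)) (trans (+-comm _ 1) (cong suc (len ρ))))
  ... | no ne = trans (cong length (rowOf-snoc-≢ pre a (λ eq → ne (sym eq)))) (len ρ′)

-- SSAFs

nthRow : ℕ → Tableau → List ℕ
nthRow _ [] = []
nthRow zero (r ∷ _) = r
nthRow (suc k) (_ ∷ T) = nthRow k T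

nth-≥ : ∀ {c} r → length r ≤ c → nth c r ≡ nothing
nth-≥ [] _ = refl
nth-≥ {suc c} (x ∷ r) (s≤s le) = nth-≥ r le

nth-snoc-< : ∀ {c} r b → c < length r → nth c (r ++ [ b ]) ≡ nth c r
nth-snoc-< {zero} (x ∷ r) b _ = refl
nth-snoc-< {suc c} (x ∷ r) b (s≤s lt) = nth-snoc-< r b lt

nth-snoc-≡ : ∀ r b → nth (length r) (r ++ [ b ]) ≡ just b
nth-snoc-≡ [] b = refl
nth-snoc-≡ (x ∷ r) b = nth-snoc-≡ r b

colOf-just : ∀ c r {a} T → nth c r ≡ just a → colOf c (r ∷ T) ≡ a ∷ colOf c T
colOf-just c r T eq rewrite eq = refl

colOf-nothing : ∀ c r T → nth c r ≡ nothing → colOf c (r ∷ T) ≡ colOf c T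
colOf-nothing c r T eq rewrite eq = refl

colOf-empty : ∀ {c} T → (∀ k → length (nthRow k T) ≤ c) → colOf c T ≡ []
colOf-empty [] _ = refl
colOf-empty {c} (r ∷ T) le = trans (colOf-nothing c r T (nth-≥ r (le 0))) (colOf-empty T (le ∘ suc))

colOf-cong : ∀ c r r′ T → nth c r ≡ nth c r′ → colOf c (r ∷ T) ≡ colOf c (r′ ∷ T)
colOf-cong c r r′ T eq rewrite eq = refl

colOf-cong-tail : ∀ {c T T′} r → colOf c T ≡ colOf c T′ → colOf c (r ∷ T) ≡ colOf c (r ∷ T′)
colOf-cong-tail {c} r eq with nth c r
... | nothing = eq
... | just a = cong (a ∷_) eq

colOf-addAt-≢ : ∀ ρ b {c} T → c ≢ length (nthRow ρ T) → colOf c (addAt ρ b T) ≡ colOf c T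
colOf-addAt-≢ ρ b {zero} [] c≢ = contradiction refl c≢
colOf-addAt-≢ zero b {suc c} [] c≢ = refl
colOf-addAt-≢ (suc ρ) b {suc c} [] c≢ = refl
colOf-addAt-≢ (suc ρ) b {c} (r ∷ T) c≢ = colOf-cong-tail r (colOf-addAt-≢ ρ b T c≢)
colOf-addAt-≢ zero b {c} (r ∷ T) c≢ with c <? length r
... | yes lt = colOf-cong c (r ++ [ b ]) r T (nth-snoc-< r b lt)
... | no ≮ = trans (colOf-nothing c (r ++ [ b ]) T (nth-≥ (r ++ [ b ]) (subst (_≤ c) (trans (+-comm 1 _) (sym (length-++ r)))
                 (≤∧≢⇒< (≮⇒≥ ≮) (c≢ ∘ sym))))) (sym (colOf-nothing c r T (nth-≥ r (≮⇒≥ ≮))))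

colOf-addAt-≡ : ∀ ρ b T → (∀ k → ρ < k → length (nthRow k T) ≤ length (nthRow ρ T)) →
                colOf (length (nthRow ρ T)) (addAt ρ b T) ≡ colOf (length (nthRow ρ T)) T ++ [ b ]
colOf-addAt-≡ zero b [] le = refl
colOf-addAt-≡ (suc ρ) b [] le = refl
colOf-addAt-≡ zero b (r ∷ T) le = trans (colOf-just (length r) (r ++ [ b ]) T (nth-snoc-≡ r b))
  (trans (cong (b ∷_) (colOf-empty T λ k → le (suc k) (s≤s z≤n)))
    (cong (_++ [ b ]) (sym (trans (colOf-nothing (length r) r T (nth-≥ r ≤-refl)) (colOf-empty T λ k → le (suc k) (s≤s z≤n))))))
colOf-addAt-≡ (suc ρ) b (r ∷ T) le with nth (length (nthRow ρ T)) r
... | nothing = colOf-addAt-≡ ρ b T (λ k lt → le (suc k) (s≤s lt))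
... | just a = cong (a ∷_) (colOf-addAt-≡ ρ b T (λ k lt → le (suc k) (s≤s lt)))

nth-All : ∀ {Pr : ℕ → Set} c {r a} → All Pr r → nth c r ≡ just a → Pr a × c < length r
nth-All zero (p ∷ ps) refl = p , s≤s z≤n
nth-All (suc c) (p ∷ ps) eq = map₂ s≤s (nth-All c ps eq)

colOf-All : ∀ {Pr : ℕ → Set} c T → (∀ k → c < length (nthRow k T) → All Pr (nthRow k T)) → All Pr (colOf c T)
colOf-All c [] _ = []
colOf-All {Pr} c (r ∷ T) all with nth c r in eq
... | nothing = colOf-All c T (all ∘ suc)
... | just a = proj₁ (nth-All c (all 0 (long r eq)) eq) ∷ colOf-All c T (all ∘ suc)
  where
  long : ∀ {c a} r → nth c r ≡ just a → c < length r
  long {zero} (x ∷ r) _ = s≤s z≤n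
  long {suc c} (x ∷ r) eq = s≤s (long r eq)

>>=-assoc : (x : Maybe X) {f : X → Maybe Y} {g : Y → Maybe Z} → ((x >>= f) >>= g) ≡ (x >>= λ a → f a >>= g)
>>=-assoc nothing = refl
>>=-assoc (just _) = refl

>>=-cong : (x : Maybe X) {f g : X → Maybe Y} → f ≗ g → (x >>= f) ≡ (x >>= g)
>>=-cong nothing _ = refl
>>=-cong (just a) eq = eq a

>>=-just : (x : Maybe X) → (x >>= just) ≡ x
>>=-just nothing = refl
>>=-just (just _) = refl

Eligible : ℕ → ℕ → List ℕ → Set
Eligible i a [] = ⊥
Eligible i a (y ∷ rest) = length (y ∷ rest) ≡ suc i × a ≤ y

eligible? : ∀ i a col → Dec (Eligible i a col)
eligible? i a [] = no λ ()
eligible? i a (y ∷ rest) = (length (y ∷ rest) ≟ suc i) ×-dec (a ≤? y)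

place-hit : ∀ {m i a col} {cols : Vec (List ℕ) m} → Eligible i a col → place i a (col ∷ cols) ≡ just ((a ∷ col) ∷ cols)
place-hit {i = i} {a} {y ∷ rest} (len , le) with length (y ∷ rest) ≟ suc i | a ≤? y
... | yes _ | yes _ = refl
... | no ¬p | _ = contradiction len ¬p
... | yes _ | no ¬p = contradiction le ¬p

place-miss : ∀ {m i a col} {cols : Vec (List ℕ) m} → ¬ Eligible i a col →
             place i a (col ∷ cols) ≡ (place i a cols >>= λ cols′ → just (col ∷ cols′))
place-miss {i = i} {a} {[]} {cols} _ with place i a cols
... | nothing = refl
... | just _ = refl
place-miss {i = i} {a} {y ∷ rest} {cols} ¬e with length (y ∷ rest) ≟ suc i | a ≤? y
... | yes p | yes q = contradiction (p , q) ¬e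
... | no _ | yes _ with place i a cols
...   | nothing = refl
...   | just _ = refl
place-miss {i = i} {a} {y ∷ rest} {cols} ¬e | no _ | no _ with place i a cols
...   | nothing = refl
...   | just _ = refl
place-miss {i = i} {a} {y ∷ rest} {cols} ¬e | yes _ | no _ with place i a cols
...   | nothing = refl
...   | just _ = refl

module _ {t i b a} (t<i : t < i) (b<a : b < a) where

  -- Neither placement affects the other: a column raised by `b` has top `b < a` and rejects `a`,
  -- and a column raised by `a` is too tall for `b`.
  place-comm : ∀ {m} (F : Vec (List ℕ) m) → (place t b F >>= place i a) ≡ (place i a F >>= place t b)
  place-comm [] = refl
  place-comm (col ∷ cols) with eligible? t b col | eligible? i a col
  ... | yes e | yes e′ = ⊥-elim (excl col e e′)
    where
    excl : ∀ col → Eligible t b col → Eligible i a col → ⊥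
    excl (y ∷ rest) (l , _) (l′ , _) = <⇒≢ t<i (suc-injective (trans (sym l) l′))
  ... | yes e | no ¬e′ = begin
    (place t b (col ∷ cols) >>= place i a) ≡⟨ cong (_>>= place i a) (place-hit e) ⟩
    place i a ((b ∷ col) ∷ cols) ≡⟨ place-miss {col = b ∷ col} {cols} (λ p → <⇒≱ b<a (proj₂ p)) ⟩
    (place i a cols >>= λ X → just ((b ∷ col) ∷ X)) ≡⟨ >>=-cong (place i a cols) (λ X → sym (place-hit e)) ⟩
    (place i a cols >>= λ X → place t b (col ∷ X)) ≡⟨ >>=-assoc (place i a cols) ⟨
    ((place i a cols >>= λ X → just (col ∷ X)) >>= place t b) ≡⟨ cong (_>>= place t b) (place-miss ¬e′) ⟨
    (place i a (col ∷ cols) >>= place t b) ∎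
    where open ≡-Reasoning
  ... | no ¬e | yes e′ = begin
    (place t b (col ∷ cols) >>= place i a) ≡⟨ cong (_>>= place i a) (place-miss ¬e) ⟩
    ((place t b cols >>= λ X → just (col ∷ X)) >>= place i a) ≡⟨ >>=-assoc (place t b cols) ⟩
    (place t b cols >>= λ X → place i a (col ∷ X)) ≡⟨ >>=-cong (place t b cols) (λ X → place-hit e′) ⟩
    (place t b cols >>= λ X → just ((a ∷ col) ∷ X)) ≡⟨ place-miss {col = a ∷ col} {cols} (tall col e′) ⟨
    place t b ((a ∷ col) ∷ cols) ≡⟨ cong (_>>= place t b) (place-hit e′) ⟨
    (place i a (col ∷ cols) >>= place t b) ∎
    where
    open ≡-Reasoning
    tall : ∀ col → Eligible i a col → ¬ Eligible t b (a ∷ col)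
    tall (y ∷ rest) (l , _) (l′ , _) =
      <⇒≢ (<-trans t<i (n<1+n i)) (trans (sym (suc-injective l′)) l)
  ... | no ¬e | no ¬e′ = begin
    (place t b (col ∷ cols) >>= place i a) ≡⟨ cong (_>>= place i a) (place-miss ¬e) ⟩
    ((place t b cols >>= λ X → just (col ∷ X)) >>= place i a) ≡⟨ >>=-assoc (place t b cols) ⟩
    (place t b cols >>= λ X → place i a (col ∷ X)) ≡⟨ >>=-cong (place t b cols) (λ X → place-miss ¬e′) ⟩
    (place t b cols >>= λ X → place i a X >>= λ Y → just (col ∷ Y)) ≡⟨ >>=-assoc (place t b cols) ⟨
    ((place t b cols >>= place i a) >>= λ Y → just (col ∷ Y)) ≡⟨ cong (_>>= λ Y → just (col ∷ Y)) (place-comm cols) ⟩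
    ((place i a cols >>= place t b) >>= λ Y → just (col ∷ Y)) ≡⟨ >>=-assoc (place i a cols) ⟩
    (place i a cols >>= λ X → place t b X >>= λ Y → just (col ∷ Y)) ≡⟨ >>=-cong (place i a cols) (λ X → place-miss ¬e) ⟨
    (place i a cols >>= λ X → place t b (col ∷ X)) ≡⟨ >>=-assoc (place i a cols) ⟨
    ((place i a cols >>= λ X → just (col ∷ X)) >>= place t b) ≡⟨ cong (_>>= place t b) (place-miss ¬e′) ⟨
    (place i a (col ∷ cols) >>= place t b) ∎
    where open ≡-Reasoning

module _ {m t b : ℕ} where

  placeAll-comm : ∀ {i as} → t < i → All (b <_) as → (F : Vec (List ℕ) m) →
                  (place t b F >>= placeAll i as) ≡ (placeAll i as F >>= place t b)
  placeAll-comm t<i [] F = >>=-just (place t b F)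
  placeAll-comm {i} {a ∷ as} t<i (b<a ∷ ps) F = begin
    (place t b F >>= λ X → place i a X >>= placeAll i as) ≡⟨ >>=-assoc (place t b F) ⟨
    ((place t b F >>= place i a) >>= placeAll i as) ≡⟨ cong (_>>= placeAll i as) (place-comm t<i b<a F) ⟩
    ((place i a F >>= place t b) >>= placeAll i as) ≡⟨ >>=-assoc (place i a F) ⟩
    (place i a F >>= λ X → place t b X >>= placeAll i as) ≡⟨ >>=-cong (place i a F) (placeAll-comm t<i ps) ⟩
    (place i a F >>= λ X → placeAll i as X >>= place t b) ≡⟨ >>=-assoc (place i a F) ⟨
    ((place i a F >>= placeAll i as) >>= place t b) ∎
    where open ≡-Reasoning

  rhoAux-comm : ∀ {U} k {i} → t < i → (∀ c → i ≤ c → All (b <_) (colOf c U)) → (F : Vec (List ℕ) m) →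
                (place t b F >>= rhoAux U i k) ≡ (rhoAux U i k F >>= place t b)
  rhoAux-comm zero t<i all F = >>=-just (place t b F)
  rhoAux-comm {U} (suc k) {i} t<i all F = begin
    (place t b F >>= λ X → placeAll i (colOf i U) X >>= rhoAux U (suc i) k) ≡⟨ >>=-assoc (place t b F) ⟨
    ((place t b F >>= placeAll i (colOf i U)) >>= rhoAux U (suc i) k)
      ≡⟨ cong (_>>= rhoAux U (suc i) k) (placeAll-comm t<i (all i ≤-refl) F) ⟩
    ((placeAll i (colOf i U) F >>= place t b) >>= rhoAux U (suc i) k) ≡⟨ >>=-assoc (placeAll i (colOf i U) F) ⟩
    (placeAll i (colOf i U) F >>= λ X → place t b X >>= rhoAux U (suc i) k)
      ≡⟨ >>=-cong (placeAll i (colOf i U) F) (rhoAux-comm k (m<n⇒m<1+n t<i) (λ c le → all c (<⇒≤ le))) ⟩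
    (placeAll i (colOf i U) F >>= λ X → rhoAux U (suc i) k X >>= place t b) ≡⟨ >>=-assoc (placeAll i (colOf i U) F) ⟨
    ((placeAll i (colOf i U) F >>= rhoAux U (suc i) k) >>= place t b) ∎
    where open ≡-Reasoning

  placeAll-snoc : ∀ as (F : Vec (List ℕ) m) → placeAll t (as ++ [ b ]) F ≡ (placeAll t as F >>= place t b)
  placeAll-snoc [] F = >>=-just (place t b F)
  placeAll-snoc (a ∷ as) F = trans (>>=-cong (place t a F) (placeAll-snoc as)) (sym (>>=-assoc (place t a F)))

  rhoAux-cong : ∀ {U U′} k {i} → (∀ c → i ≤ c → colOf c U′ ≡ colOf c U) → (F : Vec (List ℕ) m) →
                 rhoAux U′ i k F ≡ rhoAux U i k F
  rhoAux-cong zero eq F = refl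
  rhoAux-cong {U} {U′} (suc k) {i} eq F rewrite eq i ≤-refl =
    >>=-cong (placeAll i (colOf i U) F) (rhoAux-cong k λ c le → eq c (<⇒≤ le))

  rhoAux-snoc : ∀ {U U′} k {i} → i ≤ t → t < i + k → colOf t U′ ≡ colOf t U ++ [ b ] →
                (∀ c → c ≢ t → colOf c U′ ≡ colOf c U) → (∀ c → t < c → All (b <_) (colOf c U)) →
                (F : Vec (List ℕ) m) → rhoAux U′ i k F ≡ (rhoAux U i k F >>= place t b)
  rhoAux-snoc zero {i} i≤t t<i+k _ _ _ F = contradiction (subst (t <_) (+-identityʳ i) t<i+k) (≤⇒≯ i≤t)
  rhoAux-snoc {U} {U′} (suc k) {i} i≤t t<i+k at other all F with i ≟ t
  ... | no i≢t rewrite other i i≢t = trans (>>=-cong (placeAll i (colOf i U) F)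
          (rhoAux-snoc k (≤∧≢⇒< i≤t i≢t) (subst (t <_) (+-suc i k) t<i+k) at other all))
          (sym (>>=-assoc (placeAll i (colOf i U) F)))
  ... | yes refl rewrite at = begin
    (placeAll t (colOf t U ++ [ b ]) F >>= rhoAux U′ (suc t) k) ≡⟨ cong (_>>= rhoAux U′ (suc t) k) (placeAll-snoc (colOf t U) F) ⟩
    ((placeAll t (colOf t U) F >>= place t b) >>= rhoAux U′ (suc t) k) ≡⟨ >>=-assoc (placeAll t (colOf t U) F) ⟩
    (placeAll t (colOf t U) F >>= λ X → place t b X >>= rhoAux U′ (suc t) k)
      ≡⟨ >>=-cong (placeAll t (colOf t U) F) (λ X → >>=-cong (place t b X) (rhoAux-cong k λ c le → other c (λ eq → <⇒≢ le (sym eq)))) ⟩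
    (placeAll t (colOf t U) F >>= λ X → place t b X >>= rhoAux U (suc t) k)
      ≡⟨ >>=-cong (placeAll t (colOf t U) F) (rhoAux-comm k (n<1+n t) all) ⟩
    (placeAll t (colOf t U) F >>= λ X → rhoAux U (suc t) k X >>= place t b) ≡⟨ >>=-assoc (placeAll t (colOf t U) F) ⟨
    ((placeAll t (colOf t U) F >>= rhoAux U (suc t) k) >>= place t b) ∎
    where open ≡-Reasoning

  rhoAux-suc : ∀ {U} k {i} → colOf (i + k) U ≡ [] → (F : Vec (List ℕ) m) → rhoAux U i (suc k) F ≡ rhoAux U i k F
  rhoAux-suc {U} zero {i} eq F rewrite trans (cong (λ c → colOf c U) (sym (+-identityʳ i))) eq = refl
  rhoAux-suc {U} (suc k) {i} eq F =
    >>=-cong (placeAll i (colOf i U) F) (rhoAux-suc k (trans (cong (λ c → colOf c U) (sym (+-suc i k))) eq))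

numCols-row : ∀ T → numCols T ≡ length (nthRow 0 T)
numCols-row [] = refl
numCols-row (_ ∷ _) = refl

-- ϱ proceeds by columns, the chain by letters. The new entry is the last of its column and smaller
-- than everything further right, so its placement commutes past all later columns and may come at
-- the very end.
rho-addAt : ∀ n {ρ b} U → Antitone (λ k → length (nthRow k U)) →
            Antitone (λ k → length (nthRow k (addAt ρ b U))) → (∀ c → length (nthRow ρ U) < c → All (b <_) (colOf c U)) →
            rho n (addAt ρ b U) ≡ (rho n U >>= place (length (nthRow ρ U)) b)
rho-addAt n {ρ} {b} U anti anti′ all = begin
  -- Both runs are extended to one column more than `U` has, whether or not the new box opens a
  -- column; an empty column places nothing.
  rhoAux U′ 0 (numCols U′) F ≡⟨ grow′ (numCols′ ρ U) ⟩
  rhoAux U′ 0 (suc (numCols U)) F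
    ≡⟨ rhoAux-snoc {U = U} {U′} (suc (numCols U)) z≤n (s≤s (≤-numCols ρ)) (colOf-addAt-≡ ρ b U (λ k lt → antitone anti (<⇒≤ lt)))
         (λ c → colOf-addAt-≢ ρ b U) all F ⟩
  (rhoAux U 0 (suc (numCols U)) F >>= place _ b)
    ≡⟨ cong (_>>= place _ b) (rhoAux-suc {t = 0} {b = 0} {U} (numCols U) (colOf-empty U ≤-numCols) F) ⟩
  (rhoAux U 0 (numCols U) F >>= place _ b) ∎
  where
  open ≡-Reasoning
  U′ = addAt ρ b U
  F = basement n
  ≤-numCols : ∀ k → length (nthRow k U) ≤ numCols U
  ≤-numCols k = subst (length (nthRow k U) ≤_) (sym (numCols-row U)) (antitone anti z≤n)
  numCols′ : ∀ ρ U → numCols (addAt ρ b U) ≡ suc (numCols U) ⊎ numCols (addAt ρ b U) ≡ numCols U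
  numCols′ zero [] = inj₁ refl
  numCols′ (suc ρ) [] = inj₁ refl
  numCols′ zero (r ∷ U) = inj₁ (trans (length-++ r) (+-comm _ 1))
  numCols′ (suc ρ) (r ∷ U) = inj₂ refl
  grow′ : numCols U′ ≡ suc (numCols U) ⊎ numCols U′ ≡ numCols U →
          rhoAux U′ 0 (numCols U′) F ≡ rhoAux U′ 0 (suc (numCols U)) F
  grow′ (inj₁ eq) = cong (λ k → rhoAux U′ 0 k F) eq
  grow′ (inj₂ eq) = trans (cong (λ k → rhoAux U′ 0 k F) eq) (sym (rhoAux-suc {t = 0} {b = 0} {U′} (numCols U)
    (colOf-empty U′ λ k → ≤-trans (antitone anti′ z≤n) (≤-reflexive (trans (sym (numCols-row U′)) eq))) F))

-- Counts of a shape on either side of a threshold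

above : ℕ → ℕ → ℕ
above t x with t <? x
... | yes _ = 1
... | no _ = 0

N M : ∀ {k} → ℕ → ℕ → Vec ℕ k → ℕ
N zero t v = 0
N (suc m) t [] = 0
N (suc m) t (x ∷ v) = above t x + N m t v
M m t [] = 0
M zero t (x ∷ v) = above t x + M zero t v
M (suc m) t (x ∷ v) = M m t v

above-< : ∀ {t x} → t < x → above t x ≡ 1
above-< {t} {x} lt with t <? x
... | yes _ = refl
... | no ≮ = contradiction lt ≮

above-≥ : ∀ {t x} → x ≤ t → above t x ≡ 0
above-≥ {t} {x} le with t <? x
... | yes lt = contradiction le (<⇒≱ lt)
... | no _ = refl

above-anti : ∀ x → Antitone (λ t → above t x)
above-anti x t with suc t <? x | t <? x
... | yes _ | yes _ = ≤-refl
... | yes lt | no ≮ = contradiction (<-trans (n<1+n t) lt) ≮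
... | no _ | _ = z≤n

above-suc : ∀ t x → above t (suc x) ≡ inc (λ s → above s x) x t
above-suc t x with t ≟ x
... | yes refl = trans (above-< (n<1+n t)) (cong suc (sym (above-≥ ≤-refl)))
... | no t≢x with t <? x
...   | yes lt = above-< (m<n⇒m<1+n lt)
...   | no ≮ = above-≥ (≤∧≢⇒< (≮⇒≥ ≮) (t≢x ∘ sym))

above-≢ : ∀ {s x} → x ≢ suc s → above (suc s) x ≡ above s x
above-≢ {s} {x} ne with s <? x
... | yes lt = above-< (≤∧≢⇒< lt (ne ∘ sym))
... | no ≮ = above-≥ (m≤n⇒m≤1+n (≮⇒≥ ≮))

N+M : ∀ m t {k} (v : Vec ℕ k) → N m t v + M m t v ≡ M 0 t v
N+M zero t v = refl
N+M (suc m) t [] = refl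
N+M (suc m) t (x ∷ v) = trans (+-assoc (above t x) _ _) (cong (above t x +_) (N+M m t v))

N-anti : ∀ m {k} (v : Vec ℕ k) → Antitone (λ t → N m t v)
N-anti zero v t = z≤n
N-anti (suc m) [] t = z≤n
N-anti (suc m) (x ∷ v) t = +-mono-≤ (above-anti x t) (N-anti m v t)

-- The growing column is the leftmost of height `t`, except for `t = 0`, where the basement fixes
-- its position.
data Grow (t : ℕ) : ∀ {k} → ℕ → Vec ℕ k → Vec ℕ k → Set where
  here : ∀ {k} {v : Vec ℕ k} → Grow t 0 (t ∷ v) (suc t ∷ v)
  there : ∀ {k x d} {v v′ : Vec ℕ k} → (t ≢ 0 → x ≢ t) → Grow t d v v′ → Grow t (suc d) (x ∷ v) (x ∷ v′)

module _ {t : ℕ} where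

  N-grow : ∀ {k d m} {v v′ : Vec ℕ k} → Grow t d v v′ → d < m → (λ s → N m s v′) ≗ inc (λ s → N m s v) t
  N-grow {m = suc m} (here {v = v}) _ s =
    trans (cong (_+ N m s v) (above-suc s t)) (inc-+ˡ (λ s → above s t) (λ s → N m s v) t s)
  N-grow {m = suc m} (there {x = x} {v = v} _ g) (s≤s lt) s =
    trans (cong (above s x +_) (N-grow g lt s)) (inc-+ʳ (λ s → above s x) (λ s → N m s v) t s)

  N-same : ∀ {k d m} {v v′ : Vec ℕ k} → Grow t d v v′ → m ≤ d → (λ s → N m s v′) ≗ λ s → N m s v
  N-same {m = zero} _ _ s = refl
  N-same {m = suc m} (there {x = x} _ g) (s≤s le) s = cong (above s x +_) (N-same g le s)

  M-grow : ∀ {k d m} {v v′ : Vec ℕ k} → Grow t d v v′ → m ≤ d → (λ s → M m s v′) ≗ inc (λ s → M m s v) t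
  M-grow {m = zero} (here {v = v}) _ s =
    trans (cong (_+ M 0 s v) (above-suc s t)) (inc-+ˡ (λ s → above s t) (λ s → M 0 s v) t s)
  M-grow {m = zero} (there {x = x} {v = v} _ g) _ s =
    trans (cong (above s x +_) (M-grow g z≤n s)) (inc-+ʳ (λ s → above s x) (λ s → M 0 s v) t s)
  M-grow {m = suc m} (there _ g) (s≤s le) s = M-grow g le s

  M-same : ∀ {k d m} {v v′ : Vec ℕ k} → Grow t d v v′ → d < m → (λ s → M m s v′) ≗ λ s → M m s v
  M-same {m = suc m} here _ s = refl
  M-same {m = suc m} (there _ g) (s≤s lt) s = M-same g lt s

N-hit : ∀ {s k d m} {v v′ : Vec ℕ k} → Grow (suc s) d v v′ → d < m → N m (suc s) v < N m s v
N-hit {s} {m = suc m} (here {v = v}) _ =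
  subst₂ _<_ (cong (_+ N m (suc s) v) (sym (above-≥ {suc s} ≤-refl))) (cong (_+ N m s v) (sym (above-< (n<1+n s))))
    (s≤s (N-anti m v s))
N-hit {s} {m = suc m} (there {x = x} _ g) (s≤s lt) = +-mono-≤-< (above-anti x s) (N-hit g lt)

N-miss : ∀ {s k d m} {v v′ : Vec ℕ k} → Grow (suc s) d v v′ → m ≤ d → N m (suc s) v ≡ N m s v
N-miss {m = zero} _ _ = refl
N-miss {m = suc m} (there ne g) (s≤s le) = cong₂ _+_ (above-≢ (ne λ ())) (N-miss g le)

counts : ∀ {k} → ℕ → Vec ℕ k → State
counts m v = state (λ t → N m t v) (λ t → M m t v)

-- An entry `b > m` stands in a column at least `b`, hence beyond `m`. If `b ≤ m` and the column
-- still lies beyond `m`, then `t ≠ 0`, and being leftmost it leaves no column of height `t` among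
-- the first `m`. Positions `d` start at 0, columns at 1.
counts-moved : ∀ {t k d b m} {v v′ : Vec ℕ k} → Grow t d v v′ → b ≤ suc d → (t ≡ 0 → suc d ≡ b) →
               Moved (b ≤ᵇ m) t (counts m v) (counts m v′)
counts-moved {t} {d = d} {b} {m} g b≤ first with b ≤ᵇ m in eq | d <? m
counts-moved {zero} {d = d} {b} {m} g b≤ first | true | yes lt = left refl tt (N-grow g lt) (M-same g lt)
counts-moved {suc s} {d = d} {b} {m} g b≤ first | true | yes lt = left refl (N-hit g lt) (N-grow g lt) (M-same g lt)
counts-moved {zero} {d = d} {b} {m} g b≤ first | true | no ≮ =
  contradiction (subst (_≤ m) (sym (first refl)) (≤ᵇ⇒≤ b m (subst T (sym eq) tt))) ≮
counts-moved {suc s} {d = d} {b} {m} g b≤ first | true | no ≮ =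
  right (λ _ lt → <-irrefl (N-miss g (≮⇒≥ ≮)) lt) (N-same g (≮⇒≥ ≮)) (M-grow g (≮⇒≥ ≮))
counts-moved {t} {d = d} {b} {m} g b≤ first | false | yes lt = ⊥-elim (subst T eq (≤⇒≤ᵇ (≤-trans b≤ lt)))
counts-moved {t} {d = d} {b} {m} g b≤ first | false | no ≮ =
  right (λ ()) (N-same g (≮⇒≥ ≮)) (M-grow g (≮⇒≥ ≮))

-- All tops are at least the latest entry `b`, so later entries, being no larger, fit on every
-- nonempty column; `y ≤ c` keeps entries from standing left of their own column.
data GoodCol (c b : ℕ) : List ℕ → Set where
  base : GoodCol c b [ c ]
  tall : ∀ {y x rest} → b ≤ y → y ≤ c → GoodCol c b (y ∷ x ∷ rest)

data Good (b : ℕ) : ∀ {k} → ℕ → Vec (List ℕ) k → Set where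
  [] : ∀ {o} → Good b o []
  _∷_ : ∀ {k o col} {cols : Vec (List ℕ) k} → GoodCol (suc o) b col → Good b (suc o) cols → Good b o (col ∷ cols)

good-weaken : ∀ {b b′ k o} {F : Vec (List ℕ) k} → b′ ≤ b → Good b o F → Good b′ o F
good-weaken le [] = []
good-weaken le (base ∷ G) = base ∷ good-weaken le G
good-weaken le (tall p q ∷ G) = tall (≤-trans le p) q ∷ good-weaken le G

good-basement : ∀ {b} k o (f : Fin k → ℕ) → (∀ c → f c ≡ o + toℕ c) → Good b o (Vec.tabulate (λ c → [ suc (f c) ]))
good-basement zero o f eq = []
good-basement (suc k) o f eq = subst (λ c → GoodCol (suc o) _ [ suc c ]) (sym (trans (eq Fin.zero) (+-identityʳ o))) base
  ∷ good-basement k (suc o) (f ∘ Fin.suc) (λ c → trans (eq (Fin.suc c)) (+-suc o (toℕ c)))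

total : ∀ {k} → ℕ → Vec ℕ k → ℕ
total = M 0

record Placed {k} (t b o : ℕ) (F : Vec (List ℕ) k) : Set where
  field
    {F′} : Vec (List ℕ) k
    {d} : ℕ
    placed : place t b F ≡ just F′
    good : Good b o F′
    grow : Grow t d (sh F) (sh F′)
    bound : b ≤ suc (o + d)
    first : t ≡ 0 → suc (o + d) ≡ b

-- Column `b` is still bare, since a top entry in it would be both larger than `b` and at most `b`;
-- bare columns further left have too small a basement entry.
place-first : ∀ {k o b} {F : Vec (List ℕ) k} → Good (suc b) o F → o < b → b ≤ o + k → Placed 0 b o F
place-first {o = o} [] o<b b≤ = contradiction (subst (_ ≤_) (+-identityʳ o) b≤) (<⇒≱ o<b)
place-first {suc k} {o} {b} {col ∷ cols} (g ∷ G) o<b b≤ with suc o ≟ b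
place-first {o = o} {F = _ ∷ _} (base ∷ G) o<b b≤ | yes refl = record
  { placed = place-hit {col = [ suc o ]} (refl , ≤-refl) ; good = tall ≤-refl ≤-refl ∷ good-weaken (n≤1+n _) G ; grow = here
  ; bound = s≤s (≤-reflexive (sym (+-identityʳ o))) ; first = λ _ → cong suc (+-identityʳ o) }
place-first {F = _ ∷ _} (tall p q ∷ G) o<b b≤ | yes refl = contradiction p (≤⇒≯ q)
place-first {suc k} {o} {b} {col ∷ cols} (g ∷ G) o<b b≤ | no ne = record
  { placed = trans (place-miss {col = col} {cols} (miss g)) (cong (_>>= λ X → just (col ∷ X)) (Placed.placed rec))
  ; good = weak g ∷ Placed.good rec ; grow = there (λ ne → contradiction refl ne) (Placed.grow rec)
  ; bound = subst (λ c → b ≤ suc c) (sym (+-suc o _)) (Placed.bound rec)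
  ; first = λ e → trans (cong suc (+-suc o _)) (Placed.first rec e) }
  where
  rec = place-first G (≤∧≢⇒< o<b ne) (subst (b ≤_) (+-suc o k) b≤)
  miss : ∀ {col} → GoodCol (suc o) (suc b) col → ¬ Eligible 0 b col
  miss base (_ , le) = ne (≤-antisym o<b le)
  miss (tall _ _) (() , _)
  weak : ∀ {col} → GoodCol (suc o) (suc b) col → GoodCol (suc o) b col
  weak base = base
  weak (tall p q) = tall (<⇒≤ p) q

missing : ∀ {c b t col} → GoodCol c b col → length col ∸ 1 ≢ t → ¬ Eligible t b col
missing base ne (len , _) = ne (cong (_∸ 1) len)
missing (tall _ _) ne (len , _) = ne (cong (_∸ 1) len)

-- The drop of the total exhibits a column of height `suc s`, and by `GoodCol` the leftmost such
-- column accepts `b`.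
place-next : ∀ {k o b s} {F : Vec (List ℕ) k} → Good b o F → total (suc s) (sh F) < total s (sh F) → Placed (suc s) b o F
place-next {o = o} {b} {s} {col ∷ cols} (g ∷ G) lt with length col ∸ 1 ≟ suc s
place-next {o = o} {b} {s} {.(y ∷ x ∷ rest) ∷ cols} (tall {y} {x} {rest} p q ∷ G) lt | yes refl = record
  { placed = place-hit {col = y ∷ x ∷ rest} (refl , p) ; good = tall ≤-refl (≤-trans p q) ∷ G ; grow = here
  ; bound = subst (λ c → b ≤ suc c) (sym (+-identityʳ o)) (≤-trans p q) ; first = λ () }
place-next {o = o} {b} {s} {.(_ ∷ []) ∷ cols} (base ∷ G) lt | yes ()
place-next {o = o} {b} {s} {col ∷ cols} (g ∷ G) lt | no ne = record
  { placed = trans (place-miss {col = col} {cols} miss) (cong (_>>= λ X → just (col ∷ X)) (Placed.placed rec))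
  ; good = g ∷ Placed.good rec ; grow = there (λ _ → ne) (Placed.grow rec)
  ; bound = subst (λ c → b ≤ suc c) (sym (+-suc o _)) (Placed.bound rec)
  ; first = λ () }
  where
  rec = place-next G (≡+-cancel-< (above-≢ ne) lt)
  miss : ¬ Eligible (suc s) b col
  miss = missing g ne

-- Growing the tableau and its SSAF along a chain

record _≈_ (S S′ : State) : Set where
  constructor _,_
  field
    η≗ : η S ≗ η S′
    μ≗ : μ S ≗ μ S′
open _≈_

moved-≈ : ∀ {b t S S₀ S₁ S₁′} → S ≈ S₀ → Moved b t S S₁ → Moved b t S₀ S₁′ → S₁ ≈ S₁′
moved-≈ (e , m) (left _ _ e₁ m₁) (left _ _ e₂ m₂) =
  (λ i → trans (e₁ i) (trans (inc-cong _ e i) (sym (e₂ i)))) , λ i → trans (m₁ i) (trans (m i) (sym (m₂ i)))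
moved-≈ (e , m) (right _ e₁ m₁) (right _ e₂ m₂) =
  (λ i → trans (e₁ i) (trans (e i) (sym (e₂ i)))) , λ i → trans (m₁ i) (trans (inc-cong _ m i) (sym (m₂ i)))
moved-≈ (e , m) (left b a _ _) (right ¬a _ _) = contradiction (addable-cong e _ a) (¬a b)
moved-≈ (e , m) (right ¬a _ _) (left b a _ _) = contradiction (addable-cong (λ i → sym (e i)) _ a) (¬a b)

nthRow-map : ∀ n k T → nthRow k (complTab n T) ≡ map (compl n) (nthRow k T)
nthRow-map n k [] = refl
nthRow-map n zero (r ∷ T) = refl
nthRow-map n (suc k) (r ∷ T) = nthRow-map n k T

complTab-addAt : ∀ n ρ a T → complTab n (addAt ρ a T) ≡ addAt ρ (compl n a) (complTab n T)
complTab-addAt n ρ a [] = refl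
complTab-addAt n zero a (r ∷ T) = cong (_∷ complTab n T) (map-++ (compl n) r [ a ])
complTab-addAt n (suc ρ) a (r ∷ T) = cong (map (compl n) r ∷_) (complTab-addAt n ρ a T)

nthRow-addAt-≡ : ∀ ρ a T → (∀ k → k < ρ → nthRow k T ≢ []) → nthRow ρ (addAt ρ a T) ≡ nthRow ρ T ++ [ a ]
nthRow-addAt-≡ zero a [] ne = refl
nthRow-addAt-≡ (suc ρ) a [] ne = contradiction refl (ne 0 (s≤s z≤n))
nthRow-addAt-≡ zero a (r ∷ T) ne = refl
nthRow-addAt-≡ (suc ρ) a (r ∷ T) ne = nthRow-addAt-≡ ρ a T λ k lt → ne (suc k) (s≤s lt)

nthRow-addAt-≢ : ∀ ρ a T {k} → (∀ k → k < ρ → nthRow k T ≢ []) → k ≢ ρ → nthRow k (addAt ρ a T) ≡ nthRow k T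
nthRow-addAt-≢ zero a [] {zero} ne k≢ = contradiction refl k≢
nthRow-addAt-≢ zero a [] {suc k} ne k≢ = refl
nthRow-addAt-≢ (suc ρ) a [] ne k≢ = contradiction refl (ne 0 (s≤s z≤n))
nthRow-addAt-≢ zero a (r ∷ T) {zero} ne k≢ = contradiction refl k≢
nthRow-addAt-≢ zero a (r ∷ T) {suc k} ne k≢ = refl
nthRow-addAt-≢ (suc ρ) a (r ∷ T) {zero} ne k≢ = refl
nthRow-addAt-≢ (suc ρ) a (r ∷ T) {suc k} ne k≢ =
  nthRow-addAt-≢ ρ a T (λ k lt → ne (suc k) (s≤s lt)) (k≢ ∘ cong suc)

InRange : ℕ → ℕ → Set
InRange n a = 1 ≤ a × a ≤ n

module _ (n : ℕ) where

  private
    c = compl n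

  compl-< : ∀ {a a′} → a < a′ → a′ ≤ n → c a′ < c a
  compl-< a<a′ a′≤n = ∸-monoʳ-< a<a′ (m≤n⇒m≤1+n a′≤n)

  compl-≤ : ∀ {a a′} → a ≤ a′ → c a′ ≤ c a
  compl-≤ a≤a′ = ∸-monoʳ-≤ (suc n) a≤a′

  act : ℕ → ℕ → Bool
  act m a = c a ≤ᵇ m

  -- `e` is the pair read last. `last` says that its row is nonempty, with an exception for the
  -- fictitious starting letter 0, which occurs in no tableau.
  record Keyed (T : Tableau) (z : ℕ → ℕ) (e : ℕ × ℕ) : Set where
    field
      F : Filling n
      rho≡ : rho n (complTab n T) ≡ just F
      len : ∀ k → length (nthRow k T) ≡ z k
      letters : ∀ k → All (λ a → a < proj₁ e ⊎ (a ≡ proj₁ e × proj₂ e ≤ k)) (nthRow k T)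
      last : proj₁ e ≡ 0 ⊎ 0 < z (proj₂ e)
      good : Good (c (proj₁ e)) 0 F
      valid : Valid z (counts 0 (sh F))

  module _ {T z lo ρ₀ a ρ} (K : Keyed T z (lo , ρ₀)) (B : Before (lo , ρ₀) (a , ρ)) (range : InRange n a) (add : Addable z ρ) where
    open Keyed K
    private
      U = complTab n T
      t = z ρ
      b = c a

      nonempty : ∀ k → k < ρ → nthRow k T ≢ []
      nonempty k lt eq = <-irrefl (trans (sym (cong length eq)) (len k)) (addable-below (z-anti valid) add lt)

      lenU : ∀ k → length (nthRow k U) ≡ z k
      lenU k = trans (cong length (nthRow-map n k T)) (trans (length-map c (nthRow k T)) (len k))

      len′ : ∀ k → length (nthRow k (addAt ρ a T)) ≡ inc z ρ k
      len′ k with k ≟ ρ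
      ... | yes refl = trans (cong length (nthRow-addAt-≡ ρ a T nonempty))
                         (trans (length-++ (nthRow ρ T)) (trans (+-comm _ 1) (cong suc (len ρ))))
      ... | no ne = trans (cong length (nthRow-addAt-≢ ρ a T nonempty ne)) (len k)

      lenU′ : ∀ k → length (nthRow k (addAt ρ b U)) ≡ inc z ρ k
      lenU′ k = trans (cong (λ X → length (nthRow k X)) (sym (complTab-addAt n ρ a T)))
        (trans (cong length (nthRow-map n k (addAt ρ a T))) (trans (length-map c (nthRow k (addAt ρ a T))) (len′ k)))

      smaller : ∀ {k a′} → Before (lo , ρ₀) (a , ρ) → k < ρ → a′ < lo ⊎ (a′ ≡ lo × ρ₀ ≤ k) → a′ < a
      smaller B lt (inj₁ a′<lo) = <-≤-trans a′<lo (before-≤ B)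
      smaller (inj₁ lo<a) lt (inj₂ (refl , le)) = lo<a
      smaller (inj₂ (_ , ρ≤ρ₀)) lt (inj₂ (refl , le)) = contradiction lt (≤⇒≯ (≤-trans ρ≤ρ₀ le))

      -- A row reaching further right than row `ρ` lies strictly below it, and by `smaller` it
      -- contains no copy of `a`; complementation turns smaller into larger.
      right-columns : ∀ k → length (nthRow ρ U) < k → All (b <_) (colOf k U)
      right-columns k lt = colOf-All k U λ r k<len →
        subst (All (b <_)) (sym (nthRow-map n r T)) (AllP.map⁺ (All.map (λ q → compl-< (smaller B (r<ρ r k<len) q) (proj₂ range)) (letters r)))
        where
        r<ρ : ∀ r → k < length (nthRow r U) → r < ρ
        r<ρ r k<len = ≰⇒> λ ρ≤r → <⇒≱ (<-trans lt k<len)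
          (subst₂ _≤_ (sym (lenU r)) (sym (lenU ρ)) (antitone (z-anti valid) ρ≤r))

      rho-step : rho n (complTab n (addAt ρ a T)) ≡ place t b F
      rho-step = begin
        rho n (complTab n (addAt ρ a T)) ≡⟨ cong (rho n) (complTab-addAt n ρ a T) ⟩
        rho n (addAt ρ b U) ≡⟨ rho-addAt n U (antitone-cong (λ k → sym (lenU k)) (z-anti valid))
                                 (antitone-cong (λ k → sym (lenU′ k)) (inc-antitone ρ (z-anti valid) add)) right-columns ⟩
        (rho n U >>= place (length (nthRow ρ U)) b) ≡⟨ cong₂ (λ x k → x >>= place k b) rho≡ (lenU ρ) ⟩
        place t b F ∎
        where open ≡-Reasoning

      placed : ∀ t → z ρ ≡ t → Placed t b 0 F
      placed zero z≡0 = place-first (good-weaken (compl-< lo<a (proj₂ range)) good)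
          (m<n⇒0<n∸m (s≤s (proj₂ range))) (∸-monoʳ-≤ (suc n) (proj₁ range))
        where
        -- A new first-column letter is strictly larger: a repeated one would lie in a row no higher
        -- than the nonempty row of its predecessor, yet its own row is empty.
        strict : Before (lo , ρ₀) (a , ρ) → lo ≡ 0 ⊎ 0 < z ρ₀ → lo < a
        strict (inj₁ lt) _ = lt
        strict (inj₂ (refl , _)) (inj₁ refl) = contradiction (proj₁ range) λ ()
        strict (inj₂ (refl , ρ≤ρ₀)) (inj₂ 0<z) =
          contradiction (<-≤-trans 0<z (antitone (z-anti valid) ρ≤ρ₀)) (<-irrefl (sym z≡0))
        lo<a = strict B last
      placed (suc s) z≡ = place-next (good-weaken (compl-≤ (before-≤ B)) good) (height-before valid ρ add z≡)

      P = placed t refl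

    keyed-step : Keyed (addAt ρ a T) (inc z ρ) (a , ρ)
    keyed-step = record
      { F = Placed.F′ P
      ; rho≡ = trans rho-step (Placed.placed P)
      ; len = len′
      ; letters = letters′
      ; last = inj₂ (subst (0 <_) (sym (inc-≡ z ρ)) (s≤s z≤n))
      ; good = Placed.good P
      ; valid = valid-moved {b = false} {ρ = ρ} valid add (λ _ _ → refl) (right (λ ()) (λ _ → refl) (M-grow (Placed.grow P) z≤n))
      }
      where
      letters′ : ∀ k → All (λ a′ → a′ < a ⊎ (a′ ≡ a × ρ ≤ k)) (nthRow k (addAt ρ a T))
      weaken′ : ∀ k {a′} → Before (lo , ρ₀) (a , ρ) → a′ < lo ⊎ (a′ ≡ lo × ρ₀ ≤ k) → a′ < a ⊎ (a′ ≡ a × ρ ≤ k)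
      weaken′ k B (inj₁ lt) = inj₁ (<-≤-trans lt (before-≤ B))
      weaken′ k (inj₁ lt) (inj₂ (refl , le)) = inj₁ lt
      weaken′ k (inj₂ (refl , ρ≤ρ₀)) (inj₂ (refl , le)) = inj₂ (refl , ≤-trans ρ≤ρ₀ le)
      weaken = λ k {a′} → weaken′ k {a′} B
      letters′ k with k ≟ ρ
      ... | yes refl = subst (All _) (sym (nthRow-addAt-≡ ρ a T nonempty))
                         (++⁺ (All.map (weaken ρ) (letters ρ)) (inj₂ (refl , ≤-refl) ∷ []))
      ... | no ne = subst (All _) (sym (nthRow-addAt-≢ ρ a T nonempty ne)) (All.map (weaken k) (letters k))

    keyed-moved : ∀ m → Moved (act m a) t (counts m (sh F)) (counts m (sh (Keyed.F keyed-step)))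
    keyed-moved m = counts-moved (Placed.grow P) (Placed.bound P) (Placed.first P)

  -- All thresholds are followed at once, because a single filling must account for all of them.
  keyed-run : ∀ ch {T z e} (K : Keyed T z e) → Linked Before (e ∷ ch) → All (InRange n ∘ proj₁) ch → Lattice z ch →
    (S : ℕ → State) → (∀ m → S m ≈ counts m (sh (Keyed.F K))) →
    ∃ λ F → rho n (complTab n (build T ch)) ≡ just F × (∀ m → run (act m) z (S m) ch ≈ counts m (sh F))
  keyed-run [] K _ _ _ S eq = Keyed.F K , Keyed.rho≡ K , eq
  keyed-run ((a , ρ) ∷ ch) {z = z} K (B ∷ Bs) (r ∷ rs) (add , L) S eq =
    keyed-run ch (keyed-step K B r add) Bs rs L (λ m → step (act m a) (z ρ) (S m))
      λ m → moved-≈ (eq m) (step-moved (act m a) (z ρ) (S m)) (keyed-moved K B r add m)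

  rows₀ : ℕ → ℕ
  rows₀ _ = 0

  basement-flat : ∀ m t k (f : Fin k → ℕ) → N m t (sh (Vec.tabulate (λ i → [ f i ]))) ≡ 0 × M m t (sh (Vec.tabulate (λ i → [ f i ]))) ≡ 0
  basement-flat zero t zero f = refl , refl
  basement-flat (suc m) t zero f = refl , refl
  basement-flat zero t (suc k) f = refl , proj₂ (basement-flat zero t k (f ∘ Fin.suc))
  basement-flat (suc m) t (suc k) f = basement-flat m t k (f ∘ Fin.suc)

  empty-valid : Valid rows₀ empty
  empty-valid = record { η-anti = λ _ → ≤-refl ; μ-anti = λ _ → ≤-refl ; conj→ = λ _ _ () ; conj← = λ _ _ () }

  keyed-empty : Keyed [] rows₀ (0 , 0)
  keyed-empty = record
    { F = basement n ; rho≡ = refl ; len = λ { zero → refl ; (suc k) → refl } ; letters = λ { zero → [] ; (suc k) → [] }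
    ; last = inj₁ refl ; good = good-basement n 0 toℕ (λ _ → refl)
    ; valid = ≗-valid (λ _ → refl) (λ t → proj₂ (basement-flat 0 t n (suc ∘ toℕ))) empty-valid }

  rho-chain : ∀ ch → Linked Before ((0 , 0) ∷ ch) → All (InRange n ∘ proj₁) ch → Lattice rows₀ ch →
    ∃ λ F → rho n (complTab n (build [] ch)) ≡ just F × (∀ m → run (act m) rows₀ empty ch ≈ counts m (sh F))
  rho-chain ch Bs rs L = keyed-run ch keyed-empty Bs rs L (λ _ → empty)
    λ m → (λ t → sym (proj₁ (basement-flat m t n (suc ∘ toℕ)))) , (λ t → sym (proj₂ (basement-flat m t n (suc ∘ toℕ))))

-- The key-pair of a biword

linked-snoc : ∀ {R : X → X → Set} {xs y} → Linked R xs → All (λ x → R x y) xs → Linked R (xs ++ [ y ])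
linked-snoc [] [] = [-]
linked-snoc [-] (p ∷ []) = p ∷ [-]
linked-snoc (r ∷ rs) (_ ∷ ps) = r ∷ linked-snoc rs ps

all-reverse : ∀ {Pr : X → Set} {xs} → All Pr xs → All Pr (reverse xs)
all-reverse [] = []
all-reverse {Pr = Pr} {x ∷ xs} (p ∷ ps) = subst (All Pr) (sym (unfold-reverse x xs)) (++⁺ (all-reverse ps) (p ∷ []))

linked-reverse : ∀ {R : X → X → Set} {xs} → AllPairs R xs → Linked (flip R) (reverse xs)
linked-reverse [] = []
linked-reverse {R = R} {x ∷ xs} (p ∷ ps) =
  subst (Linked (flip R)) (sym (unfold-reverse x xs)) (linked-snoc (linked-reverse ps) (all-reverse p))

rows-snoc : ∀ {z} ch a ρ → rows z (ch ++ [ a , ρ ]) ≡ inc (rows z ch) ρ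
rows-snoc [] a ρ = refl
rows-snoc (_ ∷ ch) a ρ = rows-snoc ch a ρ

run-snoc : ∀ {act z S} ch a ρ → run act z S (ch ++ [ a , ρ ]) ≡ step (act a) (rows z ch ρ) (run act z S ch)
run-snoc [] a ρ = refl
run-snoc (_ ∷ ch) a ρ = run-snoc ch a ρ

lattice-snoc : ∀ {z} ch {a ρ} → Lattice z ch → Addable (rows z ch) ρ → Lattice z (ch ++ [ a , ρ ])
lattice-snoc [] _ add = add , tt
lattice-snoc (_ ∷ ch) (add′ , L) add = add′ , lattice-snoc ch L add

build-snoc : ∀ {T} ch a ρ → build T (ch ++ [ a , ρ ]) ≡ addAt ρ a (build T ch)
build-snoc [] a ρ = refl
build-snoc (_ ∷ ch) a ρ = build-snoc ch a ρ

moved-μ : ∀ {b t S S′} → Moved b t S S′ → ∀ s → μ S s ≤ μ S′ s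
moved-μ (left _ _ _ m) s = ≤-reflexive (sym (m s))
moved-μ {t = t} {S} (right _ _ m) s = ≤-trans (inc-≥ (μ S) t s) (≤-reflexive (sym (m s)))

run-μ : ∀ {act z S} ch s → μ S s ≤ μ (run act z S ch) s
run-μ [] s = ≤-refl
run-μ {act} {z} {S} ((a , ρ) ∷ ch) s = ≤-trans (moved-μ (step-moved (act a) (z ρ) S) s) (run-μ ch s)

-- An inactive letter always adds to `μ`, which never decreases.
μ-zero⇒active : ∀ {act z S} ch → (∀ s → μ (run act z S ch) s ≡ 0) → All (λ e → act (proj₁ e) ≡ true) ch
μ-zero⇒active [] _ = []
μ-zero⇒active {act} {z} {S} ((a , ρ) ∷ ch) zero-μ =
  not-false (act a) (λ ff → grown ff (step-moved (act a) (z ρ) S)) ∷ μ-zero⇒active ch zero-μ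
  where
  grown : act a ≡ false → ¬ Moved (act a) (z ρ) S (step (act a) (z ρ) S)
  grown ff (left tr _ _ _) = contradiction (trans (sym tr) ff) λ ()
  grown ff (right _ _ m) = contradiction (≤-trans (run-μ ch (z ρ)) (≤-reflexive (zero-μ (z ρ))))
    (subst (λ k → ¬ k ≤ 0) (sym (trans (m (z ρ)) (inc-≡ (μ S) (z ρ)))) λ ())

-- While `μ` vanishes, `η` is the whole height, so every addable row finds a column up to the
-- threshold that can grow.
active⇒μ-zero : ∀ {act z S} ch → Valid z S → Lattice z ch → All (λ e → act (proj₁ e) ≡ true) ch →
                (∀ s → μ S s ≡ 0) → ∀ s → μ (run act z S ch) s ≡ 0
active⇒μ-zero [] V L all zero-μ = zero-μ
active⇒μ-zero {act} {z} {S} ((a , ρ) ∷ ch) V (add , L) (p ∷ all) zero-μ =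
  active⇒μ-zero ch (valid-moved {ρ = ρ} V add (λ ff → contradiction (trans (sym p) ff) λ ()) mv) L all (still-zero mv)
  where
  mv = step-moved (act a) (z ρ) S
  η-addable : ∀ t → z ρ ≡ t → Addable (η S) t
  η-addable zero _ = tt
  η-addable (suc s) eq = subst₂ _<_ (η≡ (suc s)) (η≡ s) (height-before V ρ add eq)
    where
    η≡ : ∀ s → height S s ≡ η S s
    η≡ s = trans (cong (η S s +_) (zero-μ s)) (+-identityʳ _)
  still-zero : ∀ {S′} → Moved (act a) (z ρ) S S′ → ∀ s → μ S′ s ≡ 0
  still-zero (left _ _ _ m) s = trans (m s) (zero-μ s)
  still-zero (right ¬add _ _) s = contradiction (η-addable (z ρ) refl) (¬add p)

extra-height : ∀ {τ S S⁺} → Extra τ S S⁺ → height S⁺ ≗ inc (height S) τ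
extra-height {τ} {S} (right e m _) i = trans (cong₂ _+_ (e i) (m i)) (inc-+ʳ (η S) (μ S) τ i)
extra-height {τ} {S} (left e m _ _) i = trans (cong₂ _+_ (e i) (m i)) (inc-+ˡ (η S) (μ S) τ i)

moved-η : ∀ {b τ S S′} → Moved b τ S S′ → ∀ t → η S t ≤ η S′ t × η S′ t ≤ inc (η S) τ t
moved-η {τ = τ} {S} (left _ _ e _) t = ≤-trans (inc-≥ (η S) τ t) (≤-reflexive (sym (e t))) , ≤-reflexive (e t)
moved-η {τ = τ} {S} (right _ e _) t = ≤-reflexive (sym (e t)) , ≤-trans (≤-reflexive (e t)) (inc-≥ (η S) τ t)

-- In G the leftmost column of height τ grows, so η Sβ stays put at τ only if it equals its neighbour at τ - 1; in F the
-- rightmost one does, so μ Sν stays put at τ only if it equals its neighbour at τ + 1.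
module _ {τ : ℕ} {Sν Sν′ Sβ Sβ′ : State} (ηβ-anti : Antitone (η Sβ)) (mv : Moved true τ Sβ Sβ′) where

  domination→ : Extra τ Sν Sν′ → (∀ t → μ Sν t ≤ η Sβ t) → ∀ t → μ Sν′ t ≤ η Sβ′ t
  domination→ (left _ m _ _) dom t = ≤-trans (≤-reflexive (m t)) (≤-trans (dom t) (proj₁ (moved-η mv t)))
  domination→ (right _ m a) dom t with t ≟ τ
  ... | no t≢τ = ≤-trans (≤-reflexive (trans (m t) (inc-≢ (μ Sν) t≢τ))) (≤-trans (dom t) (proj₁ (moved-η mv t)))
  ... | yes refl = ≤-trans (≤-reflexive (trans (m τ) (inc-≡ (μ Sν) τ))) (grows mv t refl a)
    where
    grows : Moved true τ Sβ Sβ′ → ∀ t → t ≡ τ → Addable (μ Sν) t → suc (μ Sν τ) ≤ η Sβ′ τ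
    grows (left _ _ e _) _ _ _ = ≤-trans (s≤s (dom τ)) (≤-reflexive (sym (trans (e τ) (inc-≡ (η Sβ) τ))))
    grows (right ¬a _ _) zero refl _ = contradiction tt (¬a refl)
    grows (right ¬a e _) (suc s) refl a = ≤-trans a (≤-trans (dom s) (≤-trans (≮⇒≥ (¬a refl)) (≤-reflexive (sym (e τ)))))

  domination← : Extra τ Sν Sν′ → (∀ t → μ Sν′ t ≤ η Sβ′ t) → ∀ t → μ Sν t ≤ η Sβ t
  domination← ex dom t with t ≟ τ
  domination← (right _ m _) dom t | no t≢τ = ≤-trans (≤-reflexive (sym (trans (m t) (inc-≢ (μ Sν) t≢τ))))
    (≤-trans (dom t) (≤-trans (proj₂ (moved-η mv t)) (≤-reflexive (inc-≢ (η Sβ) t≢τ))))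
  domination← (left _ m _ _) dom t | no t≢τ = ≤-trans (≤-reflexive (sym (m t)))
    (≤-trans (dom t) (≤-trans (proj₂ (moved-η mv t)) (≤-reflexive (inc-≢ (η Sβ) t≢τ))))
  domination← (right _ m _) dom t | yes refl = s≤s⁻¹ (≤-trans (≤-reflexive (sym (trans (m τ) (inc-≡ (μ Sν) τ))))
    (≤-trans (dom τ) (≤-trans (proj₂ (moved-η mv τ)) (≤-reflexive (inc-≡ (η Sβ) τ)))))
  domination← (left _ m _ q) dom t | yes refl = ≤-trans (≤-reflexive (trans q (sym (m (suc τ)))))
    (≤-trans (dom (suc τ)) (≤-trans (proj₂ (moved-η mv (suc τ)))
      (≤-trans (≤-reflexive (inc-≢ (η Sβ) {τ} {suc τ} (1+n≢n))) (ηβ-anti τ))))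

before-trans : ∀ {e e′ e″} → Before e e′ → Before e′ e″ → Before e e″
before-trans (inj₁ p) q = inj₁ (<-≤-trans p (before-≤ q))
before-trans (inj₂ (refl , p)) (inj₁ q) = inj₁ q
before-trans (inj₂ (refl , p)) (inj₂ (refl , q)) = inj₂ (refl , ≤-trans q p)

lex-trans : ∀ {b b′ b″} → LexLeq b b′ → LexLeq b′ b″ → LexLeq b b″
lex-trans (inj₁ p) (inj₁ q) = inj₁ (<-trans p q)
lex-trans (inj₁ p) (inj₂ (refl , q)) = inj₁ p
lex-trans (inj₂ (refl , p)) (inj₁ q) = inj₁ q
lex-trans (inj₂ (refl , p)) (inj₂ (refl , q)) = inj₂ (refl , ≤-trans p q)

lex-≤ : ∀ {b b′} → LexLeq b b′ → proj₁ b ≤ proj₁ b′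
lex-≤ (inj₁ lt) = <⇒≤ lt
lex-≤ (inj₂ (eq , _)) = ≤-reflexive eq

-- Reading the complemented biword letter by letter

module _ (n : ℕ) where

  private
    c = compl n

  act-mono : ∀ m → Monotone (act n m)
  act-mono m {a} {a′} le p with c a′ ≤ᵇ m in eq
  ... | true = refl
  ... | false = ⊥-elim (subst T eq (≤⇒≤ᵇ (≤-trans (compl-≤ n le) (≤ᵇ⇒≤ (c a) m (subst T (sym p) tt)))))

  act-true : ∀ m a → act n m a ≡ true → c a ≤ m
  act-true m a p = ≤ᵇ⇒≤ (c a) m (subst T (sym p) tt)

  act-false : ∀ m a → act n m a ≡ false → m < c a
  act-false m a p = ≰⇒> λ le → subst T p (≤⇒≤ᵇ le)

  chain-state : ℕ → Chain → State
  chain-state m ch = run (act n m) (rows₀ n) empty ch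

  -- Letters here are already complemented, so `c i` and `c j` are the entries of the original
  -- biword.
  Avoids : ℕ → ℕ → Biletter → Set
  Avoids P q (j , i) = ¬ (P < c i × q < c j)

  Dominated : ℕ → ℕ → Chain → Chain → Set
  Dominated P q chP chQ = ∀ t → μ (chain-state P chP) t ≤ η (chain-state q chQ) t

  record ValidChain (ch : Chain) : Set where
    field
      sorted : Linked Before ((0 , 0) ∷ ch)
      range : All (InRange n ∘ proj₁) ch
      lattice : Lattice (rows₀ n) ch

  module _ {ch} (VC : ValidChain ch) where
    open ValidChain VC

    chain-inserted : ∀ m x → Inserted (act n m) (rows₀ n) (rows₀ n) empty empty ch (insert x ch) (insertedRow x ch)
    chain-inserted m x = inserted (act-mono m) x ch (empty-valid n) lattice sorted z≤n (λ _ _ → refl)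

    chain-valid : ∀ m → Valid (rows (rows₀ n) ch) (chain-state m ch)
    chain-valid m = Inserted.valid (chain-inserted m 0)

    chain-pairs : AllPairs Before ch
    chain-pairs with Linked⇒AllPairs (λ {e} {e′} {e″} → before-trans {e} {e′} {e″}) sorted
    ... | _ ∷ ps = ps

    insert-valid : ∀ {x} → InRange n x → ValidChain (insert x ch)
    insert-valid {x} r = record
      { sorted = insert-before x ch z≤n sorted ; range = insert-letters ch r range
      ; lattice = insert-lattice x ch (λ _ → ≤-refl) lattice }

  -- `recorded` looks ahead: under the same top entry, any admissible next bottom entry `x` ends in
  -- a row no higher than the boxes already recorded. `inactive` says that the columns of G up to
  -- `q` are empty until a top entry becomes active.
  record Stage (P Q : Tableau) (last : Biletter) (chP chQ : Chain) : Set where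
    field
      repP : Rep chP 0 P
      buildQ : Q ≡ build [] chQ
      validP : ValidChain chP
      validQ : ValidChain chQ
      rows≗ : rows (rows₀ n) chP ≗ rows (rows₀ n) chQ
      recorded : All (λ e → proj₁ e < proj₁ last ⊎ (proj₁ e ≡ proj₁ last ×
                   (∀ x → proj₂ last ≤ x → insertedRow x chP ≤ proj₂ e))) chQ
      inactive : ∀ q → act n q (proj₁ last) ≡ false → ∀ s → η (chain-state q chQ) s ≡ 0
      same-height : ∀ P q → height (chain-state P chP) ≗ height (chain-state q chQ)

  module _ {P Q last chP chQ j i} (St : Stage P Q last chP chQ) (lex : LexLeq last (j , i))
           (jr : InRange n j) (ir : InRange n i) where
    open Stage St
    private
      r = insertedRow i chP
      chP′ = insert i chP
      chQ′ = chQ ++ [ j , r ]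
      ins : ∀ m → Inserted (act n m) (rows₀ n) (rows₀ n) empty empty chP chP′ r
      ins m = chain-inserted validP m i
      addQ : Addable (rows (rows₀ n) chQ) r
      addQ = addable-cong rows≗ r (Inserted.addable (ins 0))
      τ = rows (rows₀ n) chQ r
      mv : ∀ q → Moved (act n q j) τ (chain-state q chQ) (chain-state q chQ′)
      mv q = subst (Moved (act n q j) τ (chain-state q chQ)) (sym (run-snoc chQ j r)) (step-moved (act n q j) τ _)
      ex : ∀ P → Extra τ (chain-state P chP) (chain-state P chP′)
      ex P = subst (λ t → Extra t (chain-state P chP) (chain-state P chP′)) (rows≗ r) (Inserted.extra (ins P))
      zero-before : ∀ q → act n q j ≡ false → ∀ s → η (chain-state q chQ) s ≡ 0
      zero-before q ff = inactive q (monotone-false {act n q} (act-mono q) (lex-≤ lex) ff)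
      before-new : ∀ {last} {e} → LexLeq last (j , i) →
                   proj₁ e < proj₁ last ⊎ (proj₁ e ≡ proj₁ last × (∀ x → proj₂ last ≤ x → insertedRow x chP ≤ proj₂ e)) →
                   Before e (j , r)
      before-new (inj₁ lt) (inj₁ p) = inj₁ (<-trans p lt)
      before-new (inj₁ lt) (inj₂ (refl , _)) = inj₁ lt
      before-new (inj₂ (refl , le)) (inj₁ p) = inj₁ p
      before-new (inj₂ (refl , le)) (inj₂ (refl , f)) = inj₂ (refl , f i le)
      to-recorded : ∀ {e} → Before e (j , r) → proj₁ e < j ⊎ (proj₁ e ≡ j × (∀ x → i ≤ x → insertedRow x chP′ ≤ proj₂ e))
      to-recorded (inj₁ lt) = inj₁ lt
      to-recorded (inj₂ (refl , le)) = inj₂ (refl , λ x i≤x → ≤-trans (insertedRow-insert chP i≤x) le)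
      all-before : All (λ e → Before e (j , r)) chQ
      all-before = All.map (before-new lex) recorded
      tab = rep-insert i chP P repP (chain-pairs validP)

    stage-step : Stage (proj₁ (insertTab i P)) (addAt (proj₂ (insertTab i P)) j Q) (j , i) chP′ chQ′
    stage-step = record
      { repP = proj₂ tab
      ; buildQ = trans (cong₂ (λ k Q → addAt k j Q) (proj₁ tab) buildQ) (sym (build-snoc chQ j r))
      ; validP = insert-valid validP ir
      ; validQ = record
        { sorted = linked-snoc (ValidChain.sorted validQ) (inj₁ (proj₁ jr) ∷ all-before)
        ; range = ++⁺ (ValidChain.range validQ) (jr ∷ [])
        ; lattice = lattice-snoc chQ (ValidChain.lattice validQ) addQ }
      ; rows≗ = λ k → trans (Inserted.rows⁺ (ins 0) k) (trans (inc-cong r rows≗ k) (cong (λ f → f k) (sym (rows-snoc chQ j r))))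
      ; recorded = ++⁺ (All.map to-recorded all-before) (to-recorded (inj₂ (refl , ≤-refl)) ∷ [])
      ; inactive = λ q ff → moved-zero (zero-before q) (mv q) ff
      ; same-height = λ P q t → trans (extra-height (ex P) t) (trans (inc-cong τ (same-height P q) t) (sym (moved-height (mv q) t)))
      }

    -- If `c j ≤ q`, avoidance is automatic and the two domination lemmas apply. Otherwise the
    -- right-hand counts are all 0, so domination means that every inserted letter is active for
    -- `P`, which for `i` is exactly avoidance.
    dominated-step : ∀ P q → (Dominated P q chP chQ × Avoids P q (j , i)) ⇔ Dominated P q chP′ chQ′
    dominated-step P q with act n q j in eq
    ... | true = mk⇔ (λ { (dom , _) → domination→ anti mv′ (ex P) dom })
                     (λ dom → domination← anti mv′ (ex P) dom , λ { (_ , lt) → <⇒≱ lt (act-true q j eq) })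
      where
      anti = Valid.η-anti (chain-valid validQ q)
      mv′ = subst (λ b → Moved b τ (chain-state q chQ) (chain-state q chQ′)) eq (mv q)
    ... | false = mk⇔ to from
      where
      η0 = zero-before q eq
      η0′ = moved-zero (zero-before q) (mv q) eq
      to : Dominated P q chP chQ × Avoids P q (j , i) → Dominated P q chP′ chQ′
      to (dom , avoid) t = ≤-trans (≤-reflexive (active⇒μ-zero chP′ (empty-valid n)
        (ValidChain.lattice (insert-valid validP ir)) (insert-letters chP i-act all-act) (λ _ → refl) t)) z≤n
        where
        i-act : act n P i ≡ true
        i-act = not-false _ λ ff → avoid (act-false P i ff , act-false q j eq)
        all-act = μ-zero⇒active chP λ s → n≤0⇒n≡0 (≤-trans (dom s) (≤-reflexive (η0 s)))
      from : Dominated P q chP′ chQ′ → Dominated P q chP chQ × Avoids P q (j , i)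
      from dom = (λ t → ≤-trans (≤-reflexive (active⇒μ-zero chP (empty-valid n) (ValidChain.lattice validP) (proj₂ split-act) (λ _ → refl) t)) z≤n)
               , λ { (lt , _) → <⇒≱ lt (act-true P i (proj₁ split-act)) }
        where
        split-act = insert-letters⁻ {Pr = λ a → act n P a ≡ true} chP
          (μ-zero⇒active chP′ λ s → n≤0⇒n≡0 (≤-trans (dom s) (≤-reflexive (η0′ s))))

  record Outcome (P Q : Tableau) (chP chQ : Chain) (u : Biword) : Set where
    field
      {last} : Biletter
      {chP′ chQ′} : Chain
      stage : Stage (proj₁ (rskAux P Q u)) (proj₂ (rskAux P Q u)) last chP′ chQ′
      dominated : ∀ p q → (Dominated p q chP chQ × All (Avoids p q) u) ⇔ Dominated p q chP′ chQ′

  rsk-outcome : ∀ u {P Q last chP chQ} → Stage P Q last chP chQ → Linked LexLeq (last ∷ u) → AllIn n u →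
                Outcome P Q chP chQ u
  rsk-outcome [] St _ _ = record { stage = St ; dominated = λ p q → mk⇔ proj₁ (_, []) }
  rsk-outcome ((j , i) ∷ u) {P} {Q} St (lex ∷ Ls) ((jr , ir) ∷ rs) = record
    { stage = Outcome.stage rec
    ; dominated = λ p q → mk⇔
        (λ { (dom , av ∷ avs) → Equivalence.to (Outcome.dominated rec p q) (Equivalence.to (dominated-step St lex jr ir p q) (dom , av) , avs) })
        (λ dom → let (dom′ , avs) = Equivalence.from (Outcome.dominated rec p q) dom
                     (dom″ , av) = Equivalence.from (dominated-step St lex jr ir p q) dom′
                 in dom″ , av ∷ avs) }
    where
    rec = rsk-outcome u (stage-step St lex jr ir) Ls rs

  stage-empty : Stage [] [] (0 , 0) [] []
  stage-empty = record
    { repP = nil λ _ _ → refl ; buildQ = refl ; validP = valid-empty ; validQ = valid-empty ; rows≗ = λ _ → refl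
    ; recorded = [] ; inactive = λ _ _ _ → refl ; same-height = λ _ _ _ → refl }
    where
    valid-empty = record { sorted = [-] ; range = [] ; lattice = tt }

-- From the complemented biword back to the given one

all-reverse⁻ : ∀ {Pr : X → Set} {xs} → All Pr (reverse xs) → All Pr xs
all-reverse⁻ {Pr = Pr} {xs} ps = subst (All Pr) (reverse-involutive xs) (all-reverse ps)

allIn⇒all : ∀ {n w} → AllIn n w → All (λ b → InRange n (proj₁ b) × InRange n (proj₂ b)) w
allIn⇒all [] = []
allIn⇒all (r ∷ rs) = r ∷ allIn⇒all rs

all⇒allIn : ∀ {n w} → All (λ b → InRange n (proj₁ b) × InRange n (proj₂ b)) w → AllIn n w
all⇒allIn [] = []
all⇒allIn (r ∷ rs) = r ∷ all⇒allIn rs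

compl-range : ∀ {n a} → InRange n a → InRange n (compl n a)
compl-range {n} (1≤a , a≤n) = m<n⇒0<n∸m (s≤s a≤n) , ∸-monoʳ-≤ (suc n) 1≤a

compl-involutive : ∀ {n a} → InRange n a → compl n (compl n a) ≡ a
compl-involutive (_ , a≤n) = m∸[m∸n]≡n (m≤n⇒m≤1+n a≤n)

module _ {n : ℕ} where

  revCompl-range : ∀ {w} → AllIn n w → AllIn n (revCompl n w)
  revCompl-range rs = all⇒allIn (all-reverse (AllP.map⁺ (All.map (λ { (p , q) → compl-range p , compl-range q }) (allIn⇒all rs))))

  lex-compl : ∀ {b b′} → InRange n (proj₁ b) × InRange n (proj₂ b) → InRange n (proj₁ b′) × InRange n (proj₂ b′) → LexLeq b b′ →
              LexLeq (compl n (proj₁ b′) , compl n (proj₂ b′)) (compl n (proj₁ b) , compl n (proj₂ b))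
  lex-compl _ (p , _) (inj₁ lt) = inj₁ (compl-< n lt (proj₂ p))
  lex-compl _ _ (inj₂ (refl , le)) = inj₂ (refl , compl-≤ n le)

  revCompl-linked : ∀ {w} → IsBiword n w → Linked LexLeq (revCompl n w)
  revCompl-linked {w} (rs , Ls) = linked-reverse (Linked⇒AllPairs (λ p q → lex-trans q p) (LinkedP.map⁺ (go (allIn⇒all rs) Ls)))
    where
    f : Biletter → Biletter
    f b = compl n (proj₁ b) , compl n (proj₂ b)
    go : ∀ {w} → All (λ b → InRange n (proj₁ b) × InRange n (proj₂ b)) w → Linked LexLeq w → Linked (flip LexLeq on f) w
    go [] [] = []
    go (r ∷ []) [-] = [-]
    go (r ∷ r′ ∷ rs) (L ∷ Ls) = lex-compl r r′ L ∷ go (r′ ∷ rs) Ls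

  revCompl-avoids : ∀ {w} p q → AllIn n w → All (Avoids n p q) (revCompl n w) ⇔ All (λ b → ¬ (p < proj₂ b × q < proj₁ b)) w
  revCompl-avoids p q rs = mk⇔
    (λ av → All.zipWith (λ { ((jr , ir) , a) → subst₂ (λ i j → ¬ (p < i × q < j)) (compl-involutive ir) (compl-involutive jr) a })
              (allIn⇒all rs , AllP.map⁻ (all-reverse⁻ av)))
    (λ av → all-reverse (AllP.map⁺ (All.zipWith (λ { ((jr , ir) , a) → subst₂ (λ i j → ¬ (p < i × q < j))
              (sym (compl-involutive ir)) (sym (compl-involutive jr)) a }) (allIn⇒all rs , av))))

  keyPair-just : ∀ w {F G} → rho n (complTab n (proj₁ (RSK (revCompl n w)))) ≡ just F →
                 rho n (complTab n (proj₂ (RSK (revCompl n w)))) ≡ just G → keyPair n w ≡ just (sh F , sh G)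
  keyPair-just w eF eG rewrite eF | eG = refl

  chain-tableau : ∀ {ch} → ValidChain n ch → Rep ch 0 (build [] ch)
  chain-tableau V = rep-build _ (λ _ → ≤-refl) (λ _ → refl) (nil λ _ _ → refl) (ValidChain.lattice V)

  linked-start : ∀ {u} → AllIn n u → Linked LexLeq u → Linked LexLeq ((0 , 0) ∷ u)
  linked-start [] [] = [-]
  linked-start ((jr , _) ∷ _) Ls = inj₁ (proj₁ jr) ∷ Ls

  -- For empty chains domination is trivial, so the accumulated equivalences leave just the
  -- avoidance conditions of the biletters. The totals agree because both chains fill the same
  -- shape.
  key-cells : ∀ {w ν β} → IsBiword n w → keyPair n w ≡ just (ν , β) →
    (∀ p q → All (λ b → ¬ (p < proj₂ b × q < proj₁ b)) w ⇔ (∀ t → M p t ν ≤ N q t β)) × (∀ t → total t ν ≡ total t β)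
  key-cells {w} biword eq
    with rsk-outcome n (revCompl n w) (stage-empty n)
           (linked-start (revCompl-range (proj₁ biword)) (revCompl-linked biword)) (revCompl-range (proj₁ biword))
  ... | out
    with rho-chain n (Outcome.chP′ out) (ValidChain.sorted (Stage.validP (Outcome.stage out)))
           (ValidChain.range (Stage.validP (Outcome.stage out))) (ValidChain.lattice (Stage.validP (Outcome.stage out)))
       | rho-chain n (Outcome.chQ′ out) (ValidChain.sorted (Stage.validQ (Outcome.stage out)))
           (ValidChain.range (Stage.validQ (Outcome.stage out))) (ValidChain.lattice (Stage.validQ (Outcome.stage out)))
  ... | F , eF , cF | G , eG , cG
    -- The insertion tableau is determined by its rows, so it is the one built along its chain, to
    -- which `rho-chain` applies.
    with trans (sym eq) (keyPair-just w
           (trans (cong (λ T → rho n (complTab n T)) (rep-unique (Stage.repP (Outcome.stage out))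
             (chain-tableau (Stage.validP (Outcome.stage out))))) eF)
           (trans (cong (λ T → rho n (complTab n T)) (Stage.buildQ (Outcome.stage out))) eG))
  ... | refl = (λ p q → mk⇔
      (λ av t → subst₂ _≤_ (μ≗ (cF p) t) (η≗ (cG q) t)
        (Equivalence.to (Outcome.dominated out p q) ((λ _ → z≤n) , Equivalence.from (revCompl-avoids p q (proj₁ biword)) av) t))
      (λ dom → Equivalence.to (revCompl-avoids p q (proj₁ biword)) (proj₂ (Equivalence.from (Outcome.dominated out p q)
        λ t → subst₂ _≤_ (sym (μ≗ (cF p) t)) (sym (η≗ (cG q) t)) (dom t)))))
    , λ t → trans (sym (sum (sh F) (cF 0) t)) (trans (Stage.same-height (Outcome.stage out) 0 0 t) (sum (sh G) (cG 0) t))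
    where
    sum : ∀ {S : State} (v : Vec ℕ n) → S ≈ counts 0 v → ∀ t → height S t ≡ total t v
    sum v (e , m) t = cong₂ _+_ (e t) (m t)

-- Bruhat order

cons-≤B : ∀ {k x} {α γ : Vec ℕ k} → α ≤B γ → (x ∷ α) ≤B (x ∷ γ)
cons-≤B brefl = brefl
cons-≤B (bstep i j le i<j gt) = bstep (Fin.suc i) (Fin.suc j) (cons-≤B le) (s≤s i<j) gt

above-mono : ∀ t {x y} → x ≤ y → above t x ≤ above t y
above-mono t {x} {y} x≤y with t <? x | t <? y
... | yes _ | yes _ = ≤-refl
... | yes lt | no ≮ = contradiction (<-≤-trans lt x≤y) ≮
... | no _ | _ = z≤n

above-≤1 : ∀ t x → above t x ≤ 1
above-≤1 t x with t <? x
... | yes _ = ≤-refl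
... | no _ = z≤n

N-update-< : ∀ {k} (v : Vec ℕ k) j x m t → toℕ j < m → above t (lookup v j) + N m t (v [ j ]≔ x) ≡ above t x + N m t v
N-update-< (y ∷ v) Fin.zero x (suc m) t _ = begin
  above t y + (above t x + N m t v) ≡⟨ +-assoc (above t y) _ _ ⟨
  above t y + above t x + N m t v ≡⟨ cong (_+ N m t v) (+-comm (above t y) _) ⟩
  above t x + above t y + N m t v ≡⟨ +-assoc (above t x) _ _ ⟩
  above t x + (above t y + N m t v) ∎
  where open ≡-Reasoning
N-update-< (y ∷ v) (Fin.suc j) x (suc m) t (s≤s lt) = begin
  above t (lookup v j) + (above t y + N m t (v [ j ]≔ x)) ≡⟨ x∙yz≈y∙xz (above t (lookup v j)) (above t y) _ ⟩
  above t y + (above t (lookup v j) + N m t (v [ j ]≔ x)) ≡⟨ cong (above t y +_) (N-update-< v j x m t lt) ⟩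
  above t y + (above t x + N m t v) ≡⟨ x∙yz≈y∙xz (above t y) (above t x) _ ⟩
  above t x + (above t y + N m t v) ∎
  where
  open ≡-Reasoning
  open import Algebra.Properties.CommutativeSemigroup +-commutativeSemigroup using (x∙yz≈y∙xz)

N-update-≥ : ∀ {k} (v : Vec ℕ k) j x m t → m ≤ toℕ j → N m t (v [ j ]≔ x) ≡ N m t v
N-update-≥ v j x zero t _ = refl
N-update-≥ (y ∷ v) (Fin.suc j) x (suc m) t (s≤s le) = cong (above t y +_) (N-update-≥ v j x m t le)

N-over : ∀ {k} m t (v : Vec ℕ k) → k ≤ m → N m t v ≡ total t v
N-over zero t [] _ = refl
N-over (suc m) t [] _ = refl
N-over (suc m) t (x ∷ v) (s≤s le) = cong (above t x +_) (N-over m t v le)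

N-swap : ∀ {k} (i j : Fin k) δ → toℕ i < toℕ j → lookup δ i > lookup δ j → ∀ m t → N m t (swap i j δ) ≤ N m t δ
N-swap i j δ i<j gt zero t = z≤n
N-swap Fin.zero (Fin.suc j) (x ∷ v) i<j gt (suc m) t with toℕ j <? m
... | yes lt = ≤-reflexive (N-update-< v j x m t lt)
... | no ≮ = +-mono-≤ (above-mono t (<⇒≤ gt)) (≤-reflexive (N-update-≥ v j x m t (≮⇒≥ ≮)))
N-swap (Fin.suc i) (Fin.suc j) (x ∷ v) (s≤s i<j) gt (suc m) t = +-monoʳ-≤ (above t x) (N-swap i j v i<j gt m t)

≤B⇒N : ∀ {k} {α γ : Vec ℕ k} → α ≤B γ → ∀ m t → N m t γ ≤ N m t α
≤B⇒N brefl m t = ≤-refl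
≤B⇒N (bstep {δ} i j le i<j gt) m t = ≤-trans (N-swap i j δ i<j gt m t) (≤B⇒N le m t)

above-outside : ∀ {c a t x} → c ≤ t → t ≤ a → ¬ (c < x × x ≤ a) → above t x ≡ above a x
above-outside {c} {a} {t} {x} c≤t t≤a out with t <? x
... | yes lt = sym (above-< (≰⇒> λ le → out (≤-<-trans c≤t lt , le)))
... | no ≮ = sym (above-≥ (≤-trans (≮⇒≥ ≮) t≤a))

-- Entries before the first one in the interval from `c` (excluded) to `a` lie outside it, so their
-- counts do not depend on `t` between `c` and `a`.
data Find (c a : ℕ) {k} (v : Vec ℕ k) : Set where
  found : ∀ j → c < lookup v j → lookup v j ≤ a →
          (∀ m t → m ≤ toℕ j → c ≤ t → t ≤ a → N m t v ≡ N m a v) → Find c a v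
  none : (∀ t → c ≤ t → t ≤ a → total t v ≡ total a v) → Find c a v

find : ∀ c a {k} (v : Vec ℕ k) → Find c a v
find c a [] = none λ _ _ _ → refl
find c a (x ∷ v) with (c <? x) ×-dec (x ≤? a)
... | yes (c<x , x≤a) = found Fin.zero c<x x≤a λ { zero t _ _ _ → refl }
... | no out with find c a v
...   | none eq = none λ t p q → cong₂ _+_ (above-outside p q out) (eq t p q)
...   | found j c<x x≤a eq = found (Fin.suc j) c<x x≤a λ
        { zero t _ _ _ → refl
        ; (suc m) t (s≤s le) p q → cong₂ _+_ (above-outside p q out) (eq m t le p q) }

total-update : ∀ {k} (v : Vec ℕ k) j x t → above t (lookup v j) + total t (v [ j ]≔ x) ≡ above t x + total t v
total-update {k} v j x t = begin
  above t (lookup v j) + total t (v [ j ]≔ x) ≡⟨ cong (above t (lookup v j) +_) (N-over k t (v [ j ]≔ x) ≤-refl) ⟨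
  above t (lookup v j) + N k t (v [ j ]≔ x) ≡⟨ N-update-< v j x k t (toℕ<n j) ⟩
  above t x + N k t v ≡⟨ cong (above t x +_) (N-over k t v ≤-refl) ⟩
  above t x + total t v ∎
  where
  open ≡-Reasoning
  open import Data.Fin.Properties using (toℕ<n)

head-≤ : ∀ {k a c} (α γ : Vec ℕ k) → (∀ t → N 1 t (c ∷ γ) ≤ N 1 t (a ∷ α)) → c ≤ a
head-≤ {a = a} α γ dom = ≮⇒≥ λ a<c → contradiction (≤-trans (≤-reflexive (sym (trans (+-identityʳ _) (above-< a<c))))
  (≤-trans (dom a) (≤-reflexive (trans (+-identityʳ _) (above-≥ {a} ≤-refl))))) λ ()

-- The tableau criterion. If the first entries c < a differ, some later entry y of γ with c < y ≤ a can be
-- exchanged with c; taking the first such y keeps the counts below those of α.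
N⇒≤B : ∀ {k} (α γ : Vec ℕ k) → (∀ m t → N m t γ ≤ N m t α) → (∀ t → total t α ≡ total t γ) → α ≤B γ
raise : ∀ {k} d a c (α γ : Vec ℕ k) → a ≤ c + d → (∀ m t → N m t (c ∷ γ) ≤ N m t (a ∷ α)) →
        (∀ t → total t (a ∷ α) ≡ total t (c ∷ γ)) → (a ∷ α) ≤B (c ∷ γ)
N⇒≤B [] [] _ _ = brefl
N⇒≤B (a ∷ α) (c ∷ γ) dom tot = raise a a c α γ (m≤n+m a c) dom tot
raise d a c α γ a≤ dom tot with m≤n⇒m<n∨m≡n (head-≤ α γ (dom 1))
... | inj₂ refl = cons-≤B (N⇒≤B α γ (λ m t → +-cancelˡ-≤ (above t a) _ _ (dom (suc m) t))
                                     (λ t → +-cancelˡ-≡ (above t a) _ _ (tot t)))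
... | inj₁ c<a with find c a γ
-- With no entry of `γ` in the interval, the totals of `c ∷ γ` at `c` and `a` would agree, whereas
-- those of `a ∷ α` differ on account of `a`.
...   | none eq = contradiction (tot c) (λ eq′ → <-irrefl (sym eq′) (begin-strict
    above c c + total c γ ≡⟨ cong₂ _+_ (above-≥ {c} ≤-refl) (eq c ≤-refl (<⇒≤ c<a)) ⟩
    total a γ ≡⟨ cong (_+ total a γ) (above-≥ (<⇒≤ c<a)) ⟨
    above a c + total a γ ≡⟨ tot a ⟨
    above a a + total a α ≡⟨ cong (_+ total a α) (above-≥ {a} ≤-refl) ⟩
    total a α ≤⟨ antitone (λ t → M-anti t α) (<⇒≤ c<a) ⟩
    total c α <⟨ n<1+n _ ⟩
    suc (total c α) ≡⟨ cong (_+ total c α) (above-< c<a) ⟨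
    above c a + total c α ∎))
  where
  open ≤-Reasoning
  M-anti : ∀ t {k} (v : Vec ℕ k) → total (suc t) v ≤ total t v
  M-anti t {k} v = subst₂ _≤_ (N-over k (suc t) v ≤-refl) (N-over k t v ≤-refl) (N-anti k v t)
-- `d` bounds the gap `a - c`, which shrinks each time the first entry is replaced by the larger
-- `y`.
raise zero a c α γ a≤ dom tot | inj₁ c<a | found j c<y y≤a eq =
  contradiction c<a (≤⇒≯ (subst (a ≤_) (+-identityʳ c) a≤))
raise (suc d) a c α γ a≤ dom tot | inj₁ c<a | found j c<y y≤a eq =
  subst ((a ∷ α) ≤B_) back (bstep Fin.zero (Fin.suc j) (raise d a y α u a≤′ dom′ tot′) (s≤s z≤n)
    (subst (_< y) (sym look) c<y))
  where
  y = lookup γ j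
  u = γ [ j ]≔ c
  look : lookup u j ≡ c
  look = lookup∘updateAt j γ
  back : swap Fin.zero (Fin.suc j) (y ∷ u) ≡ c ∷ γ
  back = cong₂ _∷_ look (trans ([]≔-idempotent γ j) ([]≔-lookup γ j))
  a≤′ : a ≤ y + d
  a≤′ = ≤-trans a≤ (≤-trans (≤-reflexive (+-suc c d)) (+-monoˡ-≤ d c<y))
  tot′ : ∀ t → total t (a ∷ α) ≡ total t (y ∷ u)
  tot′ t = trans (tot t) (sym (total-update γ j c t))
  dom′ : ∀ m t → N m t (y ∷ u) ≤ N m t (a ∷ α)
  dom′ zero t = z≤n
  dom′ (suc m) t with toℕ j <? m
  ... | yes lt = ≤-trans (≤-reflexive (N-update-< γ j c m t lt)) (dom (suc m) t)
  ... | no ≮ = low (t <? c) (t <? y)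
    where
    u≡γ : N m t u ≡ N m t γ
    u≡γ = N-update-≥ γ j c m t (≮⇒≥ ≮)
    low : Dec (t < c) → Dec (t < y) → above t y + N m t u ≤ above t a + N m t α
    low (yes t<c) _ = ≤-trans (≤-reflexive (cong₂ _+_ (trans (above-< (<-trans t<c c<y)) (sym (above-< t<c))) u≡γ)) (dom (suc m) t)
    low (no _) (no t≮y) = ≤-trans (+-mono-≤ (≤-reflexive (above-≥ (≮⇒≥ t≮y))) (≤-reflexive u≡γ))
      (≤-trans (m≤n+m _ (above t c)) (dom (suc m) t))
    -- For `c ≤ t < y` the prefix before `j` has the same count at `t` as at `a`, where neither
    -- first entry is counted; the hypothesis is used at `a`.
    low (no t≮c) (yes t<y) = +-mono-≤ (above-mono t y≤a) (begin
      N m t u ≡⟨ u≡γ ⟩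
      N m t γ ≡⟨ eq m t (≮⇒≥ ≮) (≮⇒≥ t≮c) t≤a ⟩
      N m a γ ≡⟨ cong (_+ N m a γ) (above-≥ (<⇒≤ c<a)) ⟨
      N (suc m) a (c ∷ γ) ≤⟨ dom (suc m) a ⟩
      above a a + N m a α ≡⟨ cong (_+ N m a α) (above-≥ {a} ≤-refl) ⟩
      N m a α ≤⟨ antitone (N-anti m α) t≤a ⟩
      N m t α ∎)
      where
      open ≤-Reasoning
      t≤a : t ≤ a
      t≤a = ≤-trans (<⇒≤ t<y) y≤a

-- Reversal and simple transpositions in terms of counts

N-∷ʳ-≤ : ∀ {k} m t (v : Vec ℕ k) x → m ≤ k → N m t (v ∷ʳ x) ≡ N m t v
N-∷ʳ-≤ zero t v x _ = refl
N-∷ʳ-≤ (suc m) t (y ∷ v) x (s≤s le) = cong (above t y +_) (N-∷ʳ-≤ m t v x le)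

total-∷ʳ : ∀ {k} t (v : Vec ℕ k) x → total t (v ∷ʳ x) ≡ above t x + total t v
total-∷ʳ t [] x = refl
total-∷ʳ t (y ∷ v) x = begin
  above t y + total t (v ∷ʳ x) ≡⟨ cong (above t y +_) (total-∷ʳ t v x) ⟩
  above t y + (above t x + total t v) ≡⟨ +-assoc (above t y) _ _ ⟨
  above t y + above t x + total t v ≡⟨ cong (_+ total t v) (+-comm (above t y) _) ⟩
  above t x + above t y + total t v ≡⟨ +-assoc (above t x) _ _ ⟩
  above t x + (above t y + total t v) ∎
  where open ≡-Reasoning

total-ω : ∀ {k} t (v : Vec ℕ k) → total t (ω v) ≡ total t v
total-ω t [] = refl
total-ω t (x ∷ v) = trans (cong (total t) (reverse-∷ x v)) (trans (total-∷ʳ t (ω v) x) (cong (above t x +_) (total-ω t v)))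

N-ω : ∀ {k} m t (v : Vec ℕ k) → m ≤ k → N m t (ω v) ≡ M (k ∸ m) t v
N-ω zero t [] _ = refl
N-ω {suc k} m t (x ∷ v) m≤ with m≤n⇒m<n∨m≡n m≤
... | inj₂ refl = trans (N-over (suc k) t (ω (x ∷ v)) ≤-refl) (trans (total-ω t (x ∷ v))
                    (cong (λ p → M p t (x ∷ v)) (sym (n∸n≡0 k))))
... | inj₁ (s≤s m≤k) = trans (cong (N m t) (reverse-∷ x v)) (trans (N-∷ʳ-≤ m t (ω v) x m≤k) (trans (N-ω m t v m≤k)
                    (cong (λ p → M p t (x ∷ v)) (sym (+-∸-assoc 1 m≤k)))))

M-over : ∀ {k} m t (v : Vec ℕ k) → k ≤ m → M m t v ≡ 0
M-over m t [] _ = refl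
M-over (suc m) t (x ∷ v) (s≤s le) = M-over m t v le

M-s-≢ : ∀ {k} r P t (v : Vec ℕ k) → P ≢ r → M P t (s r v) ≡ M P t v
M-s-≢ zero P t v _ = refl
M-s-≢ (suc zero) P t [] _ = refl
M-s-≢ (suc zero) P t (x ∷ []) _ = refl
M-s-≢ (suc zero) zero t (x ∷ y ∷ v) _ = begin
  above t y + (above t x + total t v) ≡⟨ +-assoc (above t y) _ _ ⟨
  above t y + above t x + total t v ≡⟨ cong (_+ total t v) (+-comm (above t y) _) ⟩
  above t x + above t y + total t v ≡⟨ +-assoc (above t x) _ _ ⟩
  above t x + (above t y + total t v) ∎
  where open ≡-Reasoning
M-s-≢ (suc zero) (suc zero) t (x ∷ y ∷ v) ne = contradiction refl ne
M-s-≢ (suc zero) (suc (suc P)) t (x ∷ y ∷ v) _ = refl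
M-s-≢ (suc (suc r)) P t [] _ = refl
M-s-≢ (suc (suc r)) zero t (x ∷ v) _ = cong (above t x +_) (M-s-≢ (suc r) 0 t v λ ())
M-s-≢ (suc (suc r)) (suc P) t (x ∷ v) ne = M-s-≢ (suc r) P t v (ne ∘ cong suc)

M-anti : ∀ {k} P t (v : Vec ℕ k) → M (suc P) t v ≤ M P t v
M-anti P t [] = ≤-refl
M-anti zero t (x ∷ v) = m≤n+m _ (above t x)
M-anti (suc P) t (x ∷ v) = M-anti P t v

N-suc : ∀ {k} m t (v : Vec ℕ k) → N (suc m) t v ≤ suc (N m t v)
N-suc m t [] = z≤n
N-suc zero t (x ∷ v) = +-monoˡ-≤ 0 (above-≤1 t x)
N-suc (suc m) t (x ∷ v) = ≤-trans (+-monoʳ-≤ (above t x) (N-suc m t v)) (≤-reflexive (+-suc _ _))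

M-s-≡ : ∀ {k} r (v : Vec ℕ k) → suc r < k → ∃₂ λ x y → ∀ t →
        M r t v ≡ above t x + M (suc r) t v × M (suc r) t v ≡ above t y + M (suc (suc r)) t v ×
        M (suc r) t (s (suc r) v) ≡ above t x + M (suc (suc r)) t v
M-s-≡ zero (x ∷ []) (s≤s ())
M-s-≡ zero (x ∷ y ∷ v) _ = x , y , λ t → refl , refl , refl
M-s-≡ (suc r) (x ∷ v) (s≤s lt) = M-s-≡ r v lt

applyS-∉ : ∀ {k} rs P t (v : Vec ℕ k) → P ∉ rs → M P t (applyS rs v) ≡ M P t v
applyS-∉ [] P t v _ = refl
applyS-∉ (r ∷ rs) P t v P∉ = trans (applyS-∉ rs P t (s r v) (P∉ ∘ there)) (M-s-≢ r P t v (P∉ ∘ here))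

applyS-++ : ∀ {k} rs rs′ (v : Vec ℕ k) → applyS (rs ++ rs′) v ≡ applyS rs′ (applyS rs v)
applyS-++ [] rs′ v = refl
applyS-++ (r ∷ rs) rs′ v = applyS-++ rs rs′ (s r v)

linked-head : ∀ {r rs} → Linked _<_ (r ∷ rs) → ∀ {r′} → r′ ∈ rs → r < r′
linked-head [-] ()
linked-head (r<r′ ∷ Ls) (here refl) = r<r′
linked-head (r<r′ ∷ Ls) (there r″∈) = <-trans r<r′ (linked-head Ls r″∈)

linked-∉ : ∀ {r rs} → Linked _<_ (r ∷ rs) → ∀ {r′} → r′ ≤ r → r′ ∉ rs
linked-∉ L le r′∈ = <⇒≱ (linked-head L r′∈) le

linked-tail : ∀ {r rs} → Linked _<_ (r ∷ rs) → Linked _<_ rs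
linked-tail [-] = []
linked-tail (_ ∷ Ls) = Ls

-- Exchanges act in increasing order: up to and including `s r` the count beyond `suc r` is the
-- original one, and after `s r` the count beyond `r` is final.
applyS-≥ : ∀ {k rs r} t (v : Vec ℕ k) → Linked _<_ rs → r ∈ rs → M (suc r) t v ≤ M r t (applyS rs v)
applyS-≥ {rs = r ∷ rs} t v L (here refl) = begin
  M (suc r) t v ≡⟨ M-s-≢ r (suc r) t v 1+n≢n ⟨
  M (suc r) t (s r v) ≤⟨ M-anti r t (s r v) ⟩
  M r t (s r v) ≡⟨ applyS-∉ rs r t (s r v) (linked-∉ L ≤-refl) ⟨
  M r t (applyS rs (s r v)) ∎
  where open ≤-Reasoning
applyS-≥ {rs = r₀ ∷ rs} {r} t v L (there r∈) = ≤-trans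
  (≤-reflexive (sym (M-s-≢ r₀ (suc r) t v (λ eq → <⇒≢ (m<n⇒m<1+n (linked-head L r∈)) (sym eq)))))
  (applyS-≥ t (s r₀ v) (linked-tail L) r∈)

-- Repairing violated bounds by simple transpositions

module _ (n : ℕ) (B : ℕ → ℕ → ℕ) (B-step : ∀ r t → r < n → B r t ≤ suc (B (suc r) t)) where

  -- Where the bound fails for v at r + 1, the bounds at its neighbours force y > t and x ≤ t; so the exchange replaces y
  -- by the smaller entry x in the count.
  s-bound : ∀ r (v : Vec ℕ n) → suc r < n → (∀ t → M r t v ≤ B r t) → (∀ t → M (suc (suc r)) t v ≤ B (suc r) t) →
            ¬ (∀ t → M (suc r) t v ≤ B (suc r) t) → ∀ t → M (suc r) t (s (suc r) v) ≤ B (suc r) t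
  s-bound r v r<n below beyond tight t′ = decidable-stable (_ ≤? _) λ ≰ → tight (bound ≰)
    where
    x = proj₁ (M-s-≡ r v r<n)
    y = proj₁ (proj₂ (M-s-≡ r v r<n))
    eqs = proj₂ (proj₂ (M-s-≡ r v r<n))
    -- When both `x` and `y` exceed `t`, the count falls by two between its neighbours, while the
    -- bound falls by at most one in a single step.
    two : ∀ t → t < x → t < y → suc (M (suc (suc r)) t v) ≤ B (suc r) t
    two t t<x t<y = s≤s⁻¹ (begin
      suc (suc (M (suc (suc r)) t v)) ≡⟨ cong₂ (λ a b → a + (b + M (suc (suc r)) t v)) (above-< t<x) (above-< t<y) ⟨
      above t x + (above t y + M (suc (suc r)) t v) ≡⟨ cong (above t x +_) (proj₁ (proj₂ (eqs t))) ⟨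
      above t x + M (suc r) t v ≡⟨ proj₁ (eqs t) ⟨
      M r t v ≤⟨ below t ⟩
      B r t ≤⟨ B-step r t (<-trans (n<1+n r) r<n) ⟩
      suc (B (suc r) t) ∎)
      where open ≤-Reasoning
    bound : ¬ (M (suc r) t′ (s (suc r) v) ≤ B (suc r) t′) → ∀ t → M (suc r) t v ≤ B (suc r) t
    bound ≰ t with t <? y
    ... | no t≮y = ≤-trans (≤-reflexive (trans (proj₁ (proj₂ (eqs t))) (cong (_+ M (suc (suc r)) t v) (above-≥ (≮⇒≥ t≮y))))) (beyond t)
    ... | yes t<y with t′ <? x
    ...   | no t′≮x = contradiction (≤-trans (≤-reflexive (trans (proj₂ (proj₂ (eqs t′)))
                        (cong (_+ M (suc (suc r)) t′ v) (above-≥ (≮⇒≥ t′≮x))))) (beyond t′)) ≰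
    ...   | yes t′<x with t <? x
    ...     | yes t<x = ≤-trans (≤-reflexive (trans (proj₁ (proj₂ (eqs t))) (cong (_+ M (suc (suc r)) t v) (above-< t<y)))) (two t t<x t<y)
    ...     | no t≮x = contradiction (≤-trans (≤-reflexive (trans (proj₂ (proj₂ (eqs t′)))
                        (cong (_+ M (suc (suc r)) t′ v) (above-< t′<x)))) (two t′ t′<x (<-trans (<-≤-trans t′<x (≮⇒≥ t≮x)) t<y))) ≰

  -- In increasing order, when an exchange at `r` is due, the count at its left neighbour is already
  -- within bounds, repaired or never violated, and nothing has touched the counts at `r` and
  -- beyond. So `s-bound` applies at every step.
  applyS-bound : ∀ rs (v : Vec ℕ n) → Linked _<_ rs → All (λ r → 1 ≤ r × r < n) rs →
    (∀ P → P ∉ rs → ∀ t → M P t v ≤ B P t) → (∀ {r} → r ∈ rs → ∀ t → M (suc r) t v ≤ B r t) →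
    (∀ {r} → r ∈ rs → ¬ (∀ t → M r t v ≤ B r t)) → ∀ P t → M P t (applyS rs v) ≤ B P t
  applyS-bound [] v _ _ out _ _ P t = out P (λ ()) t
  applyS-bound (suc r ∷ rs) v L ((_ , r<n) ∷ rng) out beyond tight =
    applyS-bound rs (s (suc r) v) (linked-tail L) rng out′
      (λ r∈ t → ≤-trans (≤-reflexive (M-s-≢ (suc r) _ t v (λ eq → <⇒≢ (m<n⇒m<1+n (linked-head L r∈)) (sym eq)))) (beyond (there r∈) t))
      (λ r∈ all → tight (there r∈) λ t → ≤-trans (≤-reflexive (sym (M-s-≢ (suc r) _ t v (λ eq → <⇒≢ (linked-head L r∈) (sym eq))))) (all t))
    where
    out′ : ∀ P → P ∉ rs → ∀ t → M P t (s (suc r) v) ≤ B P t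
    out′ P P∉ with P ≟ suc r
    ... | yes refl = s-bound r v r<n (out r λ { (here eq) → 1+n≢n (sym eq) ; (there r∈) → linked-∉ L (n≤1+n r) r∈ })
                       (beyond (here refl)) (tight (here refl))
    ... | no ne = λ t → ≤-trans (≤-reflexive (M-s-≢ (suc r) P t v ne))
                       (out P (λ { (here eq) → ne eq ; (there P∈) → P∉ P∈ }) t)

  applyS-unbound : ∀ {rs} (v : Vec ℕ n) → Linked _<_ rs → (∀ P t → M P t (applyS rs v) ≤ B P t) →
    (∀ P → P ∉ rs → ∀ t → M P t v ≤ B P t) × (∀ {r} → r ∈ rs → ∀ t → M (suc r) t v ≤ B r t)
  applyS-unbound {rs} v L all = (λ P P∉ t → ≤-trans (≤-reflexive (sym (applyS-∉ rs P t v P∉))) (all P t))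
                              , λ {r} r∈ t → ≤-trans (applyS-≥ t v L r∈) (all r t)

-- Near-staircases

removeAt-split : ∀ {X : Set} (xs : List X) i → ∃ λ ys → ∃₂ λ x zs → xs ≡ ys ++ x ∷ zs × removeAt xs i ≡ ys ++ zs
removeAt-split (x ∷ xs) Fin.zero = [] , x , xs , refl , refl
removeAt-split (x ∷ xs) (Fin.suc i) with removeAt-split xs i
... | ys , y , zs , eq , eq′ = x ∷ ys , y , zs , cong (x ∷_) eq , cong (x ∷_) eq′

split-removeAt : ∀ {X : Set} (ys : List X) x zs → ∃ λ i → removeAt (ys ++ x ∷ zs) i ≡ ys ++ zs
split-removeAt [] x zs = Fin.zero , refl
split-removeAt (y ∷ ys) x zs with split-removeAt ys x zs
... | i , eq = Fin.suc i , cong (y ∷_) eq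

-- Deletion by index, rephrased as a splitting of the list; in this form it is compatible with
-- concatenation and reversal.
Irredundant : (List ℕ → Set) → List ℕ → Set
Irredundant Pr rs = ∀ xs r ys → rs ≡ xs ++ r ∷ ys → ¬ Pr (xs ++ ys)

irredundant : ∀ {Pr : List ℕ → Set} {rs} → (∀ i → ¬ Pr (removeAt rs i)) ⇔ Irredundant Pr rs
irredundant {Pr} = mk⇔
  (λ { f xs r ys refl p → let (i , eq) = split-removeAt xs r ys in f i (subst Pr (sym eq) p) })
  (λ f i p → let (xs , r , ys , eq , eq′) = removeAt-split _ i in f xs r ys eq (subst Pr eq′ p))

complement-≤ : ∀ {a b c d} → a + b ≡ c + d → b ≤ c → d ≤ a
complement-≤ {a} {b} {c} {d} eq b≤c = +-cancelˡ-≤ b d a (≤-trans (+-monoˡ-≤ d b≤c) (≤-reflexive (trans (sym eq) (+-comm a b))))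

N+M≡ : ∀ {k} p q t (α γ : Vec ℕ k) → total t α ≡ total t γ → N p t α + M p t α ≡ N q t γ + M q t γ
N+M≡ p q t α γ eq = trans (N+M p t α) (trans eq (sym (N+M q t γ)))

-- The first `n ∸ p` entries of `ω γ` are the entries of `γ` beyond position `p`.
≤ω⇒counts : ∀ {n} {α γ : Vec ℕ n} → α ≤B ω γ → ∀ p t → M p t γ ≤ N (n ∸ p) t α
≤ω⇒counts {n} {α} {γ} le p t with p ≤? n
... | yes p≤n = ≤-trans (≤-reflexive (trans (cong (λ k → M k t γ) (sym (m∸[m∸n]≡n p≤n))) (sym (N-ω (n ∸ p) t γ (m∸n≤m n p)))))
                        (≤B⇒N le (n ∸ p) t)
... | no p≰n = ≤-trans (≤-reflexive (M-over p t γ (<⇒≤ (≰⇒> p≰n)))) z≤n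

counts⇒≤ω : ∀ {n} {α γ : Vec ℕ n} → (∀ t → total t γ ≡ total t α) → (∀ p t → M p t γ ≤ N (n ∸ p) t α) → α ≤B ω γ
counts⇒≤ω {n} {α} {γ} tot dom = N⇒≤B α (ω γ) dom′ (λ t → sym (trans (total-ω t γ) (tot t)))
  where
  dom′ : ∀ m t → N m t (ω γ) ≤ N m t α
  dom′ m t with m ≤? n
  ... | yes m≤n = ≤-trans (≤-reflexive (N-ω m t γ m≤n)) (≤-trans (dom (n ∸ m) t) (≤-reflexive (cong (λ k → N k t α) (m∸[m∸n]≡n m≤n))))
  ... | no m≰n = ≤-reflexive (trans (N-over m t (ω γ) (<⇒≤ (≰⇒> m≰n))) (trans (total-ω t γ)
                   (trans (tot t) (sym (N-over m t α (<⇒≤ (≰⇒> m≰n)))))))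

-- Reversal turns the Bruhat order around; in terms of counts, both sides are subtracted from the
-- common total.
≤ω-flip : ∀ {n} {α γ : Vec ℕ n} → (∀ t → total t γ ≡ total t α) → α ≤B ω γ → γ ≤B ω α
≤ω-flip {n} {α} {γ} tot le = counts⇒≤ω {α = γ} {α} (λ t → sym (tot t)) flipped
  where
  flipped : ∀ p t → M p t α ≤ N (n ∸ p) t γ
  flipped p t with p ≤? n
  ... | no p≰n = ≤-trans (≤-reflexive (M-over p t α (<⇒≤ (≰⇒> p≰n)))) z≤n
  ... | yes p≤n = complement-≤ (N+M≡ (n ∸ p) p t γ α (tot t))
      (≤-trans (≤ω⇒counts {α = α} {γ} le (n ∸ p) t) (≤-reflexive (cong (λ k → N k t α) (m∸[m∸n]≡n p≤n))))

sorted-split : ∀ xs {r ys} → Linked _<_ (xs ++ r ∷ ys) → All (_< r) xs × Linked _<_ (r ∷ ys)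
sorted-split xs L with allPairs-mid xs (Linked⇒AllPairs <-trans L)
... | below , above-r , pairs = below , AllPairs⇒Linked (above-r ∷ pairs)

sorted-remove : ∀ xs {r ys} → Linked _<_ (xs ++ r ∷ ys) → Linked _<_ (xs ++ ys) × r ∉ xs ++ ys
sorted-remove xs {r} {ys} L = AllPairs⇒Linked (pairs xs (Linked⇒AllPairs <-trans L)) , λ r∈ → absent (∈-++⁻ xs r∈)
  where
  pairs : ∀ xs → AllPairs _<_ (xs ++ r ∷ ys) → AllPairs _<_ (xs ++ ys)
  pairs [] (_ ∷ ps) = ps
  pairs (x ∷ xs) (p ∷ ps) with AllP.++⁻ xs p
  ... | q , _ ∷ q′ = ++⁺ q q′ ∷ pairs xs ps
  absent : r ∈ xs ⊎ r ∈ ys → ⊥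
  absent (inj₁ r∈) = <-irrefl refl (All.lookup (proj₁ (sorted-split xs L)) r∈)
  absent (inj₂ r∈) = linked-∉ (proj₂ (sorted-split xs L)) ≤-refl r∈

last-failing : ∀ {Pr : ℕ → Set} → (∀ r → Dec (Pr r)) → ∀ rs → All Pr rs ⊎ ∃ λ xs → ∃₂ λ r ys → rs ≡ xs ++ r ∷ ys × ¬ Pr r × All Pr ys
last-failing dec [] = inj₁ []
last-failing dec (r ∷ rs) with last-failing dec rs
... | inj₂ (xs , r′ , ys , eq , ¬p , ps) = inj₂ (r ∷ xs , r′ , ys , cong (r ∷_) eq , ¬p , ps)
... | inj₁ ps with dec r
...   | yes p = inj₁ (p ∷ ps)
...   | no ¬p = inj₂ ([] , r , rs , refl , ¬p , ps)

Missing : ℕ → ℕ → Biletter → Set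
Missing p q b = ¬ (p < proj₂ b × q < proj₁ b)

module Cells (n : ℕ) where

  Box : Biletter → Set
  Box b = InRange n (proj₁ b) × InRange n (proj₂ b)

  Allowed : List ℕ → Biletter → Set
  Allowed rs b = InStaircase n b ⊎ b ∈ map (extraCell n) rs

  stair-missing : ∀ {b} p → InStaircase n b → Missing p (n ∸ p) b
  stair-missing {j , i} p st (p<i , q<j) = <⇒≱ (begin-strict
    p + (n ∸ p) <⟨ n<1+n _ ⟩
    suc p + (n ∸ p) ≤⟨ s≤s⁻¹ (subst (_≤ suc n) (+-suc (suc p) (n ∸ p)) (≤-trans (+-mono-≤ p<i q<j) st)) ⟩
    n ∎) (m≤n+m∸n n p)
    where open ≤-Reasoning

  below-diagonal : ∀ {p r} → n ∸ p < suc n ∸ r → r ≤ p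
  below-diagonal {p} {r} lt = ≮⇒≥ λ p<r → <⇒≱ lt (∸-monoʳ-≤ (suc n) p<r)

  -- The extra cell of `r` is the lower left corner of the cells with i > r and j > n - r. The
  -- condition for `r ∈ rs` clears the rows above it; the cells to its right are cleared by the
  -- condition at `r - 1`, whichever of the two kinds that is.
  AllowedRegion : List ℕ → Biword → Set
  AllowedRegion rs W = (∀ p → p ∉ rs → All (Missing p (n ∸ p)) W) × (∀ {r} → r ∈ rs → All (Missing (suc r) (n ∸ r)) W)

  allowed⇒region : ∀ {rs W} → All (Allowed rs) W → AllowedRegion rs W
  allowed⇒region {rs} all = (λ p p∉ → All.map (out p p∉) all) , λ r∈ → All.map (beyond _) all
    where
    out : ∀ p → p ∉ rs → ∀ {b} → Allowed rs b → Missing p (n ∸ p) b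
    out p p∉ (inj₁ st) = stair-missing p st
    out p p∉ (inj₂ b∈) with ∈-map⁻ (extraCell n) b∈
    ... | r , r∈ , refl = λ { (p<i , q<j) → p∉ (subst (_∈ rs) (≤-antisym (below-diagonal q<j) (s≤s⁻¹ p<i)) r∈) }
    beyond : ∀ r {b} → Allowed rs b → Missing (suc r) (n ∸ r) b
    beyond r (inj₁ st) (lt , lt′) = stair-missing r st (<-trans (n<1+n r) lt , lt′)
    beyond r (inj₂ b∈) with ∈-map⁻ (extraCell n) b∈
    ... | r′ , r′∈ , refl = λ { (lt , lt′) → <⇒≱ (s≤s⁻¹ lt) (below-diagonal lt′) }

  region⇒allowed : ∀ {rs W} → All Box W → AllowedRegion rs W → All (Allowed rs) W
  region⇒allowed {rs} {W} boxes (out , beyond) = All.tabulate λ b∈ → allowed _ (All.lookup boxes b∈) b∈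
    where
    gap : ∀ {j} k → k ≤ n → n < k + j → n ∸ k < j
    gap {j} k k≤n lt = +-cancelˡ-< k _ _ (subst (_< k + j) (sym (m+[n∸m]≡n k≤n)) lt)
    diagonal : ∀ {i j} → suc n ≡ i + j → (j , suc i) ≡ extraCell n i
    diagonal {i} {j} eq = cong (_, suc i) (sym (trans (cong (_∸ i) eq) (m+n∸m≡n i j)))
    far : ∀ {i j} → j ≤ n → suc i ≤ n → suc n < i + j → ¬ (j , suc i) ∈ W
    far {zero} j≤n _ lt _ = <⇒≱ (<-trans (n<1+n n) lt) j≤n
    far {suc k} j≤n i≤n lt b∈ with k ∈? rs
    ... | yes k∈ = All.lookup (beyond k∈) b∈ (n<1+n (suc k) , gap k (<⇒≤ (<⇒≤ i≤n)) (s≤s⁻¹ lt))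
    ... | no k∉ = All.lookup (out k k∉) b∈ (m<n⇒m<1+n (n<1+n k) , gap k (<⇒≤ (<⇒≤ i≤n)) (s≤s⁻¹ lt))
    allowed : ∀ b → Box b → b ∈ W → Allowed rs b
    allowed (j , suc i) ((1≤j , j≤n) , (_ , i<n)) b∈ with suc i + j ≤? suc n | i ∈? rs
    ... | yes st | _ = inj₁ st
    ... | no ¬st | no i∉ = contradiction (n<1+n i , gap i (<⇒≤ i<n) (s≤s⁻¹ (≰⇒> ¬st))) (All.lookup (out i i∉) b∈)
    ... | no ¬st | yes i∈ with m≤n⇒m<n∨m≡n (s≤s⁻¹ (≰⇒> ¬st))
    ...   | inj₁ lt = contradiction b∈ (far j≤n i<n lt)
    ...   | inj₂ eq = inj₂ (subst (_∈ map (extraCell n) rs) (sym (diagonal eq)) (∈-map⁺ (extraCell n) i∈))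

  used : ∀ {r W} → r ≤ n → extraCell n r ∈ W → ¬ All (Missing r (n ∸ r)) W
  used {r} r≤n b∈ miss = All.lookup miss b∈ (n<1+n r , ≤-reflexive (sym (+-∸-assoc 1 r≤n)))

  unused : ∀ {r rs W} → All (Allowed rs) W → extraCell n r ∉ W → All (Missing r (n ∸ r)) W
  unused {r} {rs} {W} all b∉ = All.tabulate λ b∈ → missing-cell b∈ (All.lookup all b∈)
    where
    missing-cell : ∀ {b} → b ∈ W → Allowed rs b → Missing r (n ∸ r) b
    missing-cell b∈ (inj₁ st) = stair-missing r st
    missing-cell b∈ (inj₂ e∈) with ∈-map⁻ (extraCell n) e∈
    ... | r′ , _ , refl = λ { (lt , lt′) →
      b∉ (subst (λ r → extraCell n r ∈ W) (≤-antisym (below-diagonal lt′) (s≤s⁻¹ lt)) b∈) }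

-- Equivalence of the cell condition with the Bruhat condition

module Criterion {n : ℕ} {ν β : Vec ℕ n} {W : Biword} (boxes : All (Cells.Box n) W)
  (key : ∀ p q → All (Missing p q) W ⇔ (∀ t → M p t ν ≤ N q t β)) (tot : ∀ t → total t ν ≡ total t β) where

  open Cells n

  B : ℕ → ℕ → ℕ
  B p t = N (n ∸ p) t β

  B-step : ∀ r t → r < n → B r t ≤ suc (B (suc r) t)
  B-step r t r<n = subst (λ m → N m t β ≤ suc (B (suc r) t)) (sym (+-∸-assoc 1 r<n)) (N-suc (n ∸ suc r) t β)

  Below : List ℕ → Set
  Below rs = β ≤B ω (applyS rs ν)

  Steps : List ℕ → Set
  Steps = All (λ r → 1 ≤ r × r < n)

  below⇒ : ∀ rs → Below rs → ∀ p t → M p t (applyS rs ν) ≤ B p t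
  below⇒ rs = ≤ω⇒counts {α = β} {applyS rs ν}

  ⇒below : ∀ {rs} → Steps rs → (∀ p t → M p t (applyS rs ν) ≤ B p t) → Below rs
  ⇒below {rs} st = counts⇒≤ω {α = β} {applyS rs ν} λ t → trans (applyS-∉ rs 0 t ν (λ 0∈ → contradiction (proj₁ (All.lookup st 0∈)) λ ())) (tot t)

  CondA CondB : List ℕ → Set
  CondA rs = All (Allowed rs) W × All (λ r → extraCell n r ∈ W) rs
  CondB rs = Below rs × Irredundant Below rs

  -- The presence of the extra cell of `r` makes the inequality at `r` fail. This is what lets `s r`
  -- repair it, and also why `s r` cannot be deleted: the remaining exchanges leave the count at `r`
  -- as it was.
  a⇒b : ∀ {rs} → Linked _<_ rs → Steps rs → CondA rs → CondB rs
  a⇒b {rs} L st (all , extras) = ⇒below st bound , irr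
    where
    region = allowed⇒region all
    tight : ∀ {r} → r ∈ rs → ¬ (∀ t → M r t ν ≤ B r t)
    tight r∈ le = used (<⇒≤ (proj₂ (All.lookup st r∈))) (All.lookup extras r∈) (Equivalence.from (key _ _) le)
    bound = applyS-bound n B B-step rs ν L st (λ p p∉ → Equivalence.to (key _ _) (proj₁ region p p∉))
              (λ r∈ → Equivalence.to (key _ _) (proj₂ region r∈)) tight
    irr : Irredundant Below rs
    irr xs r ys refl below = tight (∈-insert xs)
      (proj₁ (applyS-unbound n B B-step ν (proj₁ (sorted-remove xs L)) (below⇒ (xs ++ ys) below)) r (proj₂ (sorted-remove xs L)))

  -- If an extra cell is absent, the last such `r` can be deleted, against irredundancy. The
  -- inequality at `r` holds without `s r`; the later ones fail for `ν`, as their cells are present,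
  -- and are repaired by `ys`; the others are inherited from the full product. Choosing the last `r`
  -- ensures the failures that `applyS-bound` requires.
  b⇒a : ∀ {rs} → Linked _<_ rs → Steps rs → CondB rs → CondA rs
  b⇒a {rs} L st (below , irr) = all , extras (last-failing (λ r → extraCell n r ∈ᶜ? W) rs)
    where
    unbound = applyS-unbound n B B-step ν L (below⇒ rs below)
    all : All (Allowed rs) W
    all = region⇒allowed boxes ((λ p p∉ → Equivalence.from (key _ _) (proj₁ unbound p p∉))
                               , λ r∈ → Equivalence.from (key _ _) (proj₂ unbound r∈))
    extras : (All (λ r → extraCell n r ∈ W) rs ⊎ ∃ λ xs → ∃₂ λ r ys → rs ≡ xs ++ r ∷ ys × ¬ (extraCell n r ∈ W) × All (λ r → extraCell n r ∈ W) ys) →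
             All (λ r → extraCell n r ∈ W) rs
    extras (inj₁ ps) = ps
    extras (inj₂ (xs , r , ys , refl , r-unused , ys-used)) = contradiction
      (⇒below (++⁺ (AllP.++⁻ˡ xs st) ys-steps) (λ p t → subst (λ v → M p t v ≤ B p t) (sym (applyS-++ xs ys ν)) (bound p t)))
      (irr xs r ys refl)
      where
      v = applyS xs ν
      xs<r = proj₁ (sorted-split xs L)
      Lys = proj₂ (sorted-split xs L)
      ys-steps : Steps ys
      ys-steps = All.tail (AllP.++⁻ʳ xs st)
      ∉xs : ∀ {p} → r ≤ p → p ∉ xs
      ∉xs r≤p p∈ = <⇒≱ (All.lookup xs<r p∈) r≤p
      above-r : ∀ {r′} → r′ ∈ ys → r < r′
      above-r = linked-head Lys
      bound : ∀ p t → M p t (applyS ys v) ≤ B p t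
      bound = applyS-bound n B B-step ys v (linked-tail Lys) ys-steps out
        (λ {r′} r′∈ t → ≤-trans (≤-reflexive (applyS-∉ xs (suc r′) t ν (∉xs (m≤n⇒m≤1+n (<⇒≤ (above-r r′∈))))))
                               (proj₂ unbound (∈-++⁺ʳ xs (there r′∈)) t))
        (λ {r′} r′∈ le → used (<⇒≤ (proj₂ (All.lookup ys-steps r′∈))) (All.lookup ys-used r′∈)
          (Equivalence.from (key _ _) λ t → ≤-trans (≤-reflexive (sym (applyS-∉ xs r′ t ν (∉xs (<⇒≤ (above-r r′∈)))))) (le t)))
        where
        out : ∀ p → p ∉ ys → ∀ t → M p t v ≤ B p t
        out p p∉ t with p ≟ r
        ... | yes refl = ≤-trans (≤-reflexive (applyS-∉ xs r t ν (∉xs ≤-refl))) (Equivalence.to (key _ _) (unused all r-unused) t)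
        ... | no ne = ≤-trans (≤-reflexive (trans (sym (applyS-∉ (r ∷ ys) p t v λ { (here eq) → ne eq ; (there p∈) → p∉ p∈ }))
                        (cong (M p t) (sym (applyS-++ xs (r ∷ ys) ν))))) (below⇒ (xs ++ r ∷ ys) below p t)

  a⇔b : ∀ {rs} → Linked _<_ rs → Steps rs → CondA rs ⇔ CondB rs
  a⇔b L st = mk⇔ (a⇒b L st) (b⇒a L st)

-- Transposition of the biword

mirror : ℕ → List ℕ → List ℕ
mirror n rs = reverse (map (n ∸_) rs)

module _ (n : ℕ) where

  private
    Steps : List ℕ → Set
    Steps = All (λ r → 1 ≤ r × r < n)

  mirror-++ : ∀ xs ys → mirror n (xs ++ ys) ≡ mirror n ys ++ mirror n xs
  mirror-++ xs ys = trans (cong reverse (map-++ (n ∸_) xs ys)) (reverse-++ (map (n ∸_) xs) (map (n ∸_) ys))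

  mirror-mid : ∀ xs r ys → mirror n (xs ++ r ∷ ys) ≡ mirror n ys ++ (n ∸ r) ∷ mirror n xs
  mirror-mid xs r ys = trans (mirror-++ xs (r ∷ ys))
    (trans (cong (_++ mirror n xs) (unfold-reverse (n ∸ r) (map (n ∸_) ys))) (++-assoc (mirror n ys) [ n ∸ r ] (mirror n xs)))

  mirror-involutive : ∀ {rs} → Steps rs → mirror n (mirror n rs) ≡ rs
  mirror-involutive {rs} st = begin
    reverse (map (n ∸_) (reverse (map (n ∸_) rs))) ≡⟨ cong reverse (reverse-map (n ∸_) (map (n ∸_) rs)) ⟩
    reverse (reverse (map (n ∸_) (map (n ∸_) rs))) ≡⟨ reverse-involutive _ ⟩
    map (n ∸_) (map (n ∸_) rs) ≡⟨ map-∘ rs ⟨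
    map (λ r → n ∸ (n ∸ r)) rs ≡⟨ map-id-local (All.map (λ { (_ , r<n) → m∸[m∸n]≡n (<⇒≤ r<n) }) st) ⟩
    rs ∎
    where open ≡-Reasoning

  mirror-steps : ∀ {rs} → Steps rs → Steps (mirror n rs)
  mirror-steps st = all-reverse (AllP.map⁺ (All.map (λ { {suc r} (_ , r<n) → m<n⇒0<n∸m r<n , ∸-monoʳ-< {o = 0} (s≤s z≤n) (<⇒≤ r<n) }) st))

  mirror-linked : ∀ {rs} → Steps rs → Linked _<_ rs → Linked _<_ (mirror n rs)
  mirror-linked {rs} st L = linked-reverse (Linked⇒AllPairs (λ p q → <-trans q p) (LinkedP.map⁺ (go st L)))
    where
    go : ∀ {rs} → Steps rs → Linked _<_ rs → Linked (flip _<_ on (n ∸_)) rs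
    go [] [] = []
    go (_ ∷ []) [-] = [-]
    go (_ ∷ q ∷ st) (r<r′ ∷ L) = ∸-monoʳ-< r<r′ (<⇒≤ (proj₂ q)) ∷ go (q ∷ st) L

  Region : List ℕ → Biword → Set
  Region rs W = All (Cells.Allowed n rs) W × All (λ r → extraCell n r ∈ W) rs

  -- This is the source of the indices `n ∸ r` in (c); reversing their list makes it increasing
  -- again.
  transpose-extra : ∀ {r} → r < n → transpose (extraCell n r) ≡ extraCell n (n ∸ r)
  transpose-extra {r} r<n = cong₂ _,_
    (sym (trans (+-∸-assoc 1 (m∸n≤m n r)) (cong suc (m∸[m∸n]≡n (<⇒≤ r<n)))))
    (+-∸-assoc 1 (<⇒≤ r<n))

  region-transpose : ∀ {rs W} → Steps rs → Region rs W → Region (mirror n rs) (map transpose W)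
  region-transpose {rs} {W} st (all , extras) = AllP.map⁺ (All.map allowed all)
    , all-reverse (AllP.map⁺ (All.zipWith (λ { ((_ , r<n) , e∈) → subst (_∈ map transpose W) (transpose-extra r<n) (∈-map⁺ transpose e∈) }) (st , extras)))
    where
    allowed : ∀ {b} → Cells.Allowed n rs b → Cells.Allowed n (mirror n rs) (transpose b)
    allowed {j , i} (inj₁ st) = inj₁ (subst (_≤ suc n) (+-comm i j) st)
    allowed (inj₂ b∈) with ∈-map⁻ (extraCell n) b∈
    ... | r , r∈ , refl = inj₂ (subst (_∈ map (extraCell n) (mirror n rs)) (sym (transpose-extra (proj₂ (All.lookup st r∈))))
                            (∈-map⁺ (extraCell n) (reverse⁺ (∈-map⁺ (n ∸_) r∈))))

  region-transpose⁻ : ∀ {rs W} → Steps rs → Region (mirror n rs) (map transpose W) → Region rs W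
  region-transpose⁻ {rs} {W} st reg = subst₂ Region (mirror-involutive st)
    (trans (sym (map-∘ W)) (map-id-local (All.universal (λ _ → refl) W))) (region-transpose (mirror-steps st) reg)

  module _ {ν β : Vec ℕ n} (tot : ∀ t → total t ν ≡ total t β) where

    Belowᵗ Dual : List ℕ → Set
    Belowᵗ rs = ν ≤B ω (applyS rs β)
    Dual rs = applyS (mirror n rs) β ≤B ω ν

    total-applyS : ∀ {rs} → Steps rs → ∀ t → total t (applyS rs β) ≡ total t ν
    total-applyS {rs} st t = trans (applyS-∉ rs 0 t β (λ 0∈ → contradiction (proj₁ (All.lookup st 0∈)) λ ())) (sym (tot t))

    dual⇒ : ∀ {rs} → Steps rs → Dual rs → Belowᵗ (mirror n rs)
    dual⇒ {rs} st = ≤ω-flip {α = applyS (mirror n rs) β} {ν} λ t → sym (total-applyS (mirror-steps st) t)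

    ⇒dual : ∀ {rs} → Steps rs → Belowᵗ (mirror n rs) → Dual rs
    ⇒dual {rs} st = ≤ω-flip {α = ν} {applyS (mirror n rs) β} (total-applyS (mirror-steps st))

    remove-steps : ∀ xs {r ys} → Steps (xs ++ r ∷ ys) → Steps (xs ++ ys)
    remove-steps xs st = ++⁺ (AllP.++⁻ˡ xs st) (All.tail (AllP.++⁻ʳ xs st))

    dual-irredundant : ∀ {rs} → Steps rs → Irredundant Belowᵗ (mirror n rs) → Irredundant Dual rs
    dual-irredundant st irr xs r ys refl d = irr (mirror n ys) (n ∸ r) (mirror n xs) (mirror-mid xs r ys)
      (subst Belowᵗ (mirror-++ xs ys) (dual⇒ (remove-steps xs st) d))

    dual-irredundant⁻ : ∀ {rs} → Steps rs → Irredundant Dual rs → Irredundant Belowᵗ (mirror n rs)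
    dual-irredundant⁻ {rs} st irr xs r ys eq below = irr (mirror n ys) (n ∸ r) (mirror n xs)
      (trans (sym (mirror-involutive st)) (trans (cong (mirror n) eq) (mirror-mid xs r ys)))
      (subst Dual (mirror-++ xs ys) (⇒dual (mirror-steps st′) (subst Belowᵗ (sym (mirror-involutive st′)) below)))
      where
      st′ = remove-steps xs (subst Steps eq (mirror-steps st))

  -- Subtracting both sides of `M q t ν ≤ N p t β` from the common total gives `M p t β ≤ N q t ν`.
  missing-transpose : ∀ {ν β : Vec ℕ n} {W} → (∀ t → total t ν ≡ total t β) →
    (∀ p q → All (Missing p q) W ⇔ (∀ t → M p t ν ≤ N q t β)) →
    ∀ p q → All (Missing p q) (map transpose W) ⇔ (∀ t → M p t β ≤ N q t ν)
  missing-transpose {ν} {β} tot key p q = mk⇔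
    (λ all t → complement-≤ (N+M≡ q p t ν β (tot t)) (Equivalence.to (key q p) (All.map (λ miss (a , b) → miss (b , a)) (AllP.map⁻ all)) t))
    (λ le → AllP.map⁺ (All.map (λ miss (a , b) → miss (b , a)) (Equivalence.from (key q p)
      λ t → complement-≤ (N+M≡ p q t β ν (sym (tot t))) (le t))))

theorem3 : (n : ℕ) → 1 ≤ n →
    (w : Biword) → IsBiword n w →
    (ν β : Vec ℕ n) → keyPair n w ≡ just (ν , β) →
    (rs : List ℕ) → Linked _<_ rs → All (λ r → 1 ≤ r × r < n) rs →
    let
      condA = All (λ b → InStaircase n b ⊎ b ∈ map (extraCell n) rs) w
              × All (λ r → extraCell n r ∈ w) rs
      condB = (β ≤B ω (applyS rs ν))
              × ((i : Fin (length rs)) → ¬ (β ≤B ω (applyS (removeAt rs i) ν)))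
      condC = (applyS (reverse (map (n ∸_) rs)) β ≤B ω ν)
              × ((i : Fin (length rs)) →
                   ¬ (applyS (reverse (map (n ∸_) (removeAt rs i))) β ≤B ω ν))
    in (condA ⇔ condB) × (condA ⇔ condC)
theorem3 n _ w biword ν β eq rs L st = mk⇔ a→b b→a , mk⇔ a→c c→a
  where
  key = proj₁ (key-cells biword eq)
  tot = proj₂ (key-cells biword eq)
  boxes = allIn⇒all (proj₁ biword)
  module C = Criterion {ν = ν} {β} boxes key tot
  module Cᵗ = Criterion {ν = β} {ν} {map transpose w} (AllP.map⁺ (All.map transpose boxes)) (missing-transpose n {ν} {β} tot key) (sym ∘ tot)
  direct = C.a⇔b L st
  dual = Cᵗ.a⇔b (mirror-linked n st L) (mirror-steps n st)
  a→b = λ a → map₂ (Equivalence.from (irredundant {C.Below})) (Equivalence.to direct a)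
  b→a = λ b → Equivalence.from direct (map₂ (Equivalence.to (irredundant {C.Below})) b)
  a→c = λ a → let (below , irr) = Equivalence.to dual (region-transpose n st a)
              in ⇒dual n {ν} {β} tot st below , Equivalence.from (irredundant {Dual n {ν} {β} tot}) (dual-irredundant n {ν} {β} tot st irr)
  c→a = λ { (below , irr) → region-transpose⁻ n st (Equivalence.from dual
              (dual⇒ n {ν} {β} tot st below , dual-irredundant⁻ n {ν} {β} tot st (Equivalence.to (irredundant {Dual n {ν} {β} tot}) irr))) }
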